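{- Let $d$ range over the odd positive integers and set $\gamma(d)=\max_{k\mid d}\phi(k)$, where $\phi$ is Euler's totient function; then $\gamma(d)\leq d-1$ (for $d>1$), with equality whenever $d$ is an odd prime. Let $p$ range over primes with $p\equiv 1\pmod{2d}$. Then $$\mathcal{A}(p,d)=\frac{2d+1}{6}p+O\!\left(d(\log p)^2p^{1-1/\gamma(d)}\right),$$ where the implied constant is absolute. In particular, if $d\leq c\frac{\log p}{\log\log p}$ with a fixed $c<1/2$, then $\mathcal{A}(p,d)\sim\frac{2d+1}{6}p$ as $p\to\infty$.
   Context: For an odd prime $p$ and an odd $d$ with $p\equiv1\pmod{2d}$, let $m=(p-1)/d$ and let $\chi$ be an odd Dirichlet character modulo $p$ of order $m$. Define $$\mathcal{A}(p,d)=\frac{1}{p-1}\sum_{N=1}^{p-1}\#\{(n_1,n_2):1\le n_1,n_2\le N,\ \chi(n_1)=\chi(n_2)\}$$ (independent of the choice of $\chi$). -}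

module Defs where

open import Algebra.Bundles using (CommutativeRing)
open import Algebra.Consequences.Setoid using (comm∧idˡ⇒id; comm∧invˡ⇒inv; comm∧distrʳ⇒distr)
open import Data.Integer.Base as ℤ using (ℤ; +_; -[1+_])
open import Data.Integer.Coprimality as ℤ using (Coprime; coprime?)
import Data.Integer.Properties as ℤ
open import Data.List.Base using (List; map; filter; length; applyUpTo; cartesianProduct)
open import Data.List.Extrema.Nat using (max; v≤max⁺)
open import Data.List.Membership.Propositional using (lose)
open import Data.List.Membership.Propositional.Properties using (∈-filter⁺; ∈-map⁺)
open import Data.List.Relation.Unary.Any using (here)
open import Data.Nat.Base as ℕ using (ℕ; zero; suc)
import Data.Nat.Coprimality as ℕ
open import Data.Nat.Divisibility using (_∣?_; 1∣_)
open import Data.Nat.ListAction using (sum)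
open import Data.Nat.Primality using (Prime; prime⇒nonTrivial)
import Data.Nat.Properties as ℕ
open import Data.Product.Base using (∃-syntax; _×_; _,_)
open import Data.Rational.Base as ℚ
  using (ℚ; 0ℚ; 1ℚ; ½; _+_; _*_; _-_; -_; _⊔_; ∣_∣; _≤_; _<_; Positive)
import Data.Rational.Properties as ℚ
open import Data.Rational.Solver using (module +-*-Solver)
import Data.Rational.Unnormalised.Base as ℚᵘ
import Data.Rational.Unnormalised.Properties as ℚᵘ
open import Data.Sum.Base using (_⊎_; inj₁; inj₂)
open import Level using (0ℓ)
open import Relation.Binary.Bundles using (Setoid)
open import Relation.Binary.PropositionalEquality
  using (_≡_; refl; sym; trans; cong; cong₂; subst; subst₂)
open import Relation.Nullary using (¬_; Dec; yes; no; contradiction)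

open +-*-Solver
module ℚR = ℚ.≤-Reasoning

halves : ∀ ε → ½ * ε + ½ * ε ≡ ε
halves = solve 1 (λ e → con ½ :* e :+ con ½ :* e := e) refl

0<* : ∀ {a b} → 0ℚ < a → 0ℚ < b → 0ℚ < a * b
0<* {a} {b} 0<a 0<b =
  ℚ.positive⁻¹ (a * b) {{ℚ.pos*pos⇒pos a {{ℚ.positive 0<a}} b {{ℚ.positive 0<b}}}}

0<½* : ∀ {ε} → 0ℚ < ε → 0ℚ < ½ * ε
0<½* = 0<* (ℚ.positive⁻¹ ½)

sub-mid : ∀ a b c → (a - b) + (b - c) ≡ a - c
sub-mid = solve 3 (λ a b c → (a :- b) :+ (b :- c) := a :- c) refl

triangle : ∀ a b c → ∣ a - c ∣ ≤ ∣ a - b ∣ + ∣ b - c ∣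
triangle a b c = subst (λ t → ∣ t ∣ ≤ ∣ a - b ∣ + ∣ b - c ∣) (sub-mid a b c)
  (ℚ.∣p+q∣≤∣p∣+∣q∣ (a - b) (b - c))

neg-sub : ∀ a b → - (a - b) ≡ b - a
neg-sub = solve 2 (λ a b → :- (a :- b) := b :- a) refl

∣-∣-swap : ∀ a b → ∣ a - b ∣ ≡ ∣ b - a ∣
∣-∣-swap a b = trans (sym (ℚ.∣-p∣≡∣p∣ (a - b))) (cong ∣_∣ (neg-sub a b))

≤∣∣ : ∀ p → p ≤ ∣ p ∣
≤∣∣ p with ℚ.≤-total 0ℚ p
... | inj₁ 0≤p = ℚ.≤-reflexive (sym (ℚ.0≤p⇒∣p∣≡p 0≤p))
... | inj₂ p≤0 = ℚ.≤-trans p≤0 (ℚ.0≤∣p∣ p)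

*-mono : ∀ {a b c d} → 0ℚ ≤ a → 0ℚ ≤ d → a ≤ b → c ≤ d → a * c ≤ b * d
*-mono {a} {b} {c} {d} 0≤a 0≤d a≤b c≤d = ℚ.≤-trans
  (ℚ.*-monoˡ-≤-nonNeg a {{ℚ.nonNegative 0≤a}} c≤d)
  (ℚ.*-monoʳ-≤-nonNeg d {{ℚ.nonNegative 0≤d}} a≤b)

0≤* : ∀ {a b} → 0ℚ ≤ a → 0ℚ ≤ b → 0ℚ ≤ a * b
0≤* {a} {b} 0≤a 0≤b = ℚ.nonNegative⁻¹ (a * b)
  {{ℚ.nonNeg*nonNeg⇒nonNeg a {{ℚ.nonNegative 0≤a}} b {{ℚ.nonNegative 0≤b}}}}

0≤+ : ∀ {a b} → 0ℚ ≤ a → 0ℚ ≤ b → 0ℚ ≤ a + b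
0≤+ = ℚ.+-mono-≤

split : ∀ {ε B} → 0ℚ < ε → 0ℚ < B → ∃[ δ ] 0ℚ < δ × B * δ ≡ ε
split {ε} {B} 0<ε 0<B = δ , 0<* 0<iB 0<ε , eq
  where
  instance
    B+ : Positive B
    B+ = ℚ.positive 0<B
    B≢0 : ℚ.NonZero B
    B≢0 = ℚ.pos⇒nonZero B
  iB : ℚ
  iB = ℚ.1/ B
  δ : ℚ
  δ = iB * ε
  0<iB : 0ℚ < iB
  0<iB = ℚ.positive⁻¹ iB {{ℚ.1/pos⇒pos B}}
  eq : B * δ ≡ ε
  eq = trans (sym (ℚ.*-assoc B iB ε))
         (trans (cong (_* ε) (ℚ.*-inverseʳ B)) (ℚ.*-identityˡ ε))

∣prod-diff∣ : ∀ a b c d → ∣ a * b - c * d ∣ ≤ ∣ a ∣ * ∣ b - d ∣ + ∣ d ∣ * ∣ a - c ∣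
∣prod-diff∣ a b c d = ℚR.begin
  ∣ a * b - c * d ∣
    ℚR.≡⟨ cong ∣_∣ (solve 4 (λ a b c d →
            a :* b :- c :* d := a :* (b :- d) :+ d :* (a :- c)) refl a b c d) ⟩
  ∣ a * (b - d) + d * (a - c) ∣
    ℚR.≤⟨ ℚ.∣p+q∣≤∣p∣+∣q∣ (a * (b - d)) (d * (a - c)) ⟩
  ∣ a * (b - d) ∣ + ∣ d * (a - c) ∣
    ℚR.≡⟨ cong₂ _+_ (ℚ.∣p*q∣≡∣p∣*∣q∣ a (b - d)) (ℚ.∣p*q∣≡∣p∣*∣q∣ d (a - c)) ⟩
  ∣ a ∣ * ∣ b - d ∣ + ∣ d ∣ * ∣ a - c ∣ ℚR.∎

∣sum-diff∣ : ∀ a b c d → ∣ (a + b) - (c + d) ∣ ≤ ∣ a - c ∣ + ∣ b - d ∣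
∣sum-diff∣ a b c d = subst (λ t → ∣ t ∣ ≤ ∣ a - c ∣ + ∣ b - d ∣)
  (solve 4 (λ a b c d → (a :- c) :+ (b :- d) := (a :+ b) :- (c :+ d)) refl a b c d)
  (ℚ.∣p+q∣≤∣p∣+∣q∣ (a - c) (b - d))

IsCauchy : (ℕ → ℚ) → Set
IsCauchy x = ∀ ε → 0ℚ < ε → ∃[ N ] (∀ m n → N ℕ.≤ m → N ℕ.≤ n → ∣ x m - x n ∣ ≤ ε)

-- A real number is a Cauchy sequence of rationals, with _≃ᴿ_ as equality. Eta is off and the
-- operations are defined by copatterns so that conversion checking never unfolds the Cauchy proofs.
record ℝ : Set where
  no-eta-equality
  field
    seq    : ℕ → ℚ
    cauchy : IsCauchy seq

open ℝ public

infix 4 _≃ᴿ_ _≤ᴿ_ _<ᴿ_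
infixl 6 _+ᴿ_
infixl 7 _*ᴿ_
infix 8 -ᴿ_

record _≃ᴿ_ (x y : ℝ) : Set where
  constructor mk≃
  field
    close : ∀ ε → 0ℚ < ε → ∃[ N ] (∀ n → N ℕ.≤ n → ∣ seq x n - seq y n ∣ ≤ ε)

open _≃ᴿ_ public

_≤ᴿ_ : ℝ → ℝ → Set
x ≤ᴿ y = ∀ ε → 0ℚ < ε → ∃[ N ] (∀ n → N ℕ.≤ n → seq x n ≤ seq y n + ε)

_<ᴿ_ : ℝ → ℝ → Set
x <ᴿ y = ∃[ ε ] 0ℚ < ε × ∃[ N ] (∀ n → N ℕ.≤ n → seq x n + ε ≤ seq y n)

fromℚ : ℚ → ℝ
seq    (fromℚ q) _ = q
cauchy (fromℚ q) ε 0<ε = 0 , λ _ _ _ _ →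
  subst (λ t → ∣ t ∣ ≤ ε) (sym (ℚ.+-inverseʳ q)) (ℚ.<⇒≤ 0<ε)

bounded : ∀ x → ∃[ B ] 0ℚ < B × ∃[ N ] (∀ n → N ℕ.≤ n → ∣ seq x n ∣ ≤ B)
bounded x with cauchy x 1ℚ (ℚ.positive⁻¹ 1ℚ)
... | N , close = ∣ seq x N ∣ + 1ℚ
                , ℚ.+-mono-≤-< (ℚ.0≤∣p∣ (seq x N)) (ℚ.positive⁻¹ 1ℚ)
                , N , λ n N≤n → ℚR.begin
  ∣ seq x n ∣ ℚR.≡⟨ cong ∣_∣ (solve 2 (λ a b → a := b :+ (a :- b)) refl (seq x n) (seq x N)) ⟩
  ∣ seq x N + (seq x n - seq x N) ∣ ℚR.≤⟨ ℚ.∣p+q∣≤∣p∣+∣q∣ (seq x N) (seq x n - seq x N) ⟩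
  ∣ seq x N ∣ + ∣ seq x n - seq x N ∣
    ℚR.≤⟨ ℚ.+-monoʳ-≤ ∣ seq x N ∣ (close n N N≤n ℕ.≤-refl) ⟩
  ∣ seq x N ∣ + 1ℚ ℚR.∎

≤⊔ˡ : ∀ {a b n} → a ℕ.⊔ b ℕ.≤ n → a ℕ.≤ n
≤⊔ˡ {a} {b} = ℕ.≤-trans (ℕ.m≤m⊔n a b)
≤⊔ʳ : ∀ {a b n} → a ℕ.⊔ b ℕ.≤ n → b ℕ.≤ n
≤⊔ʳ {a} {b} = ℕ.≤-trans (ℕ.m≤n⊔m a b)

∣neg-diff∣ : ∀ a b → ∣ (- a) - (- b) ∣ ≡ ∣ a - b ∣
∣neg-diff∣ a b = trans (cong ∣_∣ (solve 2 (λ a b → (:- a) :- (:- b) := b :- a) refl a b))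
                      (∣-∣-swap b a)

_+ᴿ_ : ℝ → ℝ → ℝ
seq    (x +ᴿ y) n = seq x n + seq y n
cauchy (x +ᴿ y) ε 0<ε =
  let (M , p) = cauchy x (½ * ε) (0<½* 0<ε)
      (N , q) = cauchy y (½ * ε) (0<½* 0<ε)
  in M ℕ.⊔ N , λ m n hm hn → ℚ.≤-trans
       (∣sum-diff∣ (seq x m) (seq y m) (seq x n) (seq y n))
       (subst (_ ≤_) (halves ε)
         (ℚ.+-mono-≤ (p m n (≤⊔ˡ hm) (≤⊔ˡ hn)) (q m n (≤⊔ʳ {M} hm) (≤⊔ʳ {M} hn))))

-ᴿ_ : ℝ → ℝ
seq    (-ᴿ x) n = - seq x n
cauchy (-ᴿ x) ε 0<ε =
  let (M , p) = cauchy x ε 0<ε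
  in M , λ m n hm hn →
       subst (_≤ ε) (sym (∣neg-diff∣ (seq x m) (seq x n))) (p m n hm hn)

_*ᴿ_ : ℝ → ℝ → ℝ
seq    (x *ᴿ y) n = seq x n * seq y n
cauchy (x *ᴿ y) ε 0<ε =
  let (A , 0<A , Na , bx) = bounded x
      (B , 0<B , Nb , by) = bounded y
      (δ , 0<δ , eq) = split 0<ε (ℚ.+-mono-< 0<A 0<B)
      (M , p) = cauchy x δ 0<δ
      (N , q) = cauchy y δ 0<δ
  in (Na ℕ.⊔ Nb) ℕ.⊔ (M ℕ.⊔ N) , λ m n hm hn → ℚ.≤-trans
       (∣prod-diff∣ (seq x m) (seq y m) (seq x n) (seq y n))
       (subst (_ ≤_) (trans (sym (ℚ.*-distribʳ-+ δ A B)) eq)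
         (ℚ.+-mono-≤
           (*-mono (ℚ.0≤∣p∣ _) (ℚ.<⇒≤ 0<δ) (bx m (≤⊔ˡ (≤⊔ˡ hm)))
             (q m n (≤⊔ʳ {M} (≤⊔ʳ {Na ℕ.⊔ Nb} hm)) (≤⊔ʳ {M} (≤⊔ʳ {Na ℕ.⊔ Nb} hn))))
           (*-mono (ℚ.0≤∣p∣ _) (ℚ.<⇒≤ 0<δ) (by n (≤⊔ʳ {Na} (≤⊔ˡ hn)))
             (p m n (≤⊔ˡ (≤⊔ʳ {Na ℕ.⊔ Nb} hm)) (≤⊔ˡ (≤⊔ʳ {Na ℕ.⊔ Nb} hn))))))

≡⇒≃ᴿ : ∀ {x y} → (∀ n → seq x n ≡ seq y n) → x ≃ᴿ y
≡⇒≃ᴿ {x} {y} x≡y = mk≃ λ ε 0<ε → 0 , λ n _ → ℚ.≤-trans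
  (ℚ.≤-reflexive (cong ∣_∣ (trans (cong (_- seq y n) (x≡y n)) (ℚ.+-inverseʳ (seq y n)))))
  (ℚ.<⇒≤ 0<ε)

≃ᴿ-refl : ∀ {x} → x ≃ᴿ x
≃ᴿ-refl = ≡⇒≃ᴿ (λ _ → refl)

≃ᴿ-sym : ∀ {x y} → x ≃ᴿ y → y ≃ᴿ x
≃ᴿ-sym {x} {y} x≃y = mk≃ λ ε 0<ε →
  let (N , p) = close x≃y ε 0<ε
  in N , λ n N≤n → subst (_≤ ε) (∣-∣-swap (seq x n) (seq y n)) (p n N≤n)

≃ᴿ-trans : ∀ {x y z} → x ≃ᴿ y → y ≃ᴿ z → x ≃ᴿ z
≃ᴿ-trans {x} {y} {z} x≃y y≃z = mk≃ λ ε 0<ε →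
  let (M , p) = close x≃y (½ * ε) (0<½* 0<ε)
      (N , q) = close y≃z (½ * ε) (0<½* 0<ε)
  in M ℕ.⊔ N , λ n h → ℚ.≤-trans (triangle (seq x n) (seq y n) (seq z n))
       (subst (_ ≤_) (halves ε) (ℚ.+-mono-≤ (p n (≤⊔ˡ h)) (q n (≤⊔ʳ {M} h))))

+ᴿ-cong : ∀ {x x′ y y′} → x ≃ᴿ x′ → y ≃ᴿ y′ → x +ᴿ y ≃ᴿ x′ +ᴿ y′
+ᴿ-cong {x} {x′} {y} {y′} x≃ y≃ = mk≃ λ ε 0<ε →
  let (M , p) = close x≃ (½ * ε) (0<½* 0<ε)
      (N , q) = close y≃ (½ * ε) (0<½* 0<ε)
  in M ℕ.⊔ N , λ n h → ℚ.≤-trans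
       (∣sum-diff∣ (seq x n) (seq y n) (seq x′ n) (seq y′ n))
       (subst (_ ≤_) (halves ε) (ℚ.+-mono-≤ (p n (≤⊔ˡ h)) (q n (≤⊔ʳ {M} h))))

-ᴿ-cong : ∀ {x y} → x ≃ᴿ y → -ᴿ x ≃ᴿ -ᴿ y
-ᴿ-cong {x} {y} x≃y = mk≃ λ ε 0<ε →
  let (N , p) = close x≃y ε 0<ε
  in N , λ n N≤n → subst (_≤ ε) (sym (∣neg-diff∣ (seq x n) (seq y n))) (p n N≤n)

*ᴿ-cong : ∀ {x x′ y y′} → x ≃ᴿ x′ → y ≃ᴿ y′ → x *ᴿ y ≃ᴿ x′ *ᴿ y′
*ᴿ-cong {x} {x′} {y} {y′} x≃ y≃ = mk≃ λ ε 0<ε →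
  let (A , 0<A , Na , bx) = bounded x
      (B , 0<B , Nb , by) = bounded y′
      (δ , 0<δ , eq) = split 0<ε (ℚ.+-mono-< 0<A 0<B)
      (M , p) = close x≃ δ 0<δ
      (N , q) = close y≃ δ 0<δ
  in (Na ℕ.⊔ Nb) ℕ.⊔ (M ℕ.⊔ N) , λ n h → ℚ.≤-trans
       (∣prod-diff∣ (seq x n) (seq y n) (seq x′ n) (seq y′ n))
       (subst (_ ≤_) (trans (sym (ℚ.*-distribʳ-+ δ A B)) eq)
         (ℚ.+-mono-≤
           (*-mono (ℚ.0≤∣p∣ _) (ℚ.<⇒≤ 0<δ) (bx n (≤⊔ˡ (≤⊔ˡ h)))
             (q n (≤⊔ʳ {M} (≤⊔ʳ {Na ℕ.⊔ Nb} h))))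
           (*-mono (ℚ.0≤∣p∣ _) (ℚ.<⇒≤ 0<δ) (by n (≤⊔ʳ {Na} (≤⊔ˡ h)))
             (p n (≤⊔ˡ (≤⊔ʳ {Na ℕ.⊔ Nb} h))))))

+ᴿ-assoc : ∀ x y z → (x +ᴿ y) +ᴿ z ≃ᴿ x +ᴿ (y +ᴿ z)
+ᴿ-assoc x y z = ≡⇒≃ᴿ (λ n → ℚ.+-assoc (seq x n) (seq y n) (seq z n))

+ᴿ-comm : ∀ x y → x +ᴿ y ≃ᴿ y +ᴿ x
+ᴿ-comm x y = ≡⇒≃ᴿ (λ n → ℚ.+-comm (seq x n) (seq y n))

+ᴿ-identityˡ : ∀ x → fromℚ 0ℚ +ᴿ x ≃ᴿ x
+ᴿ-identityˡ x = ≡⇒≃ᴿ (λ n → ℚ.+-identityˡ (seq x n))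

-ᴿ-inverseˡ : ∀ x → -ᴿ x +ᴿ x ≃ᴿ fromℚ 0ℚ
-ᴿ-inverseˡ x = ≡⇒≃ᴿ (λ n → ℚ.+-inverseˡ (seq x n))

*ᴿ-assoc : ∀ x y z → (x *ᴿ y) *ᴿ z ≃ᴿ x *ᴿ (y *ᴿ z)
*ᴿ-assoc x y z = ≡⇒≃ᴿ (λ n → ℚ.*-assoc (seq x n) (seq y n) (seq z n))

*ᴿ-comm : ∀ x y → x *ᴿ y ≃ᴿ y *ᴿ x
*ᴿ-comm x y = ≡⇒≃ᴿ (λ n → ℚ.*-comm (seq x n) (seq y n))

*ᴿ-identityˡ : ∀ x → fromℚ 1ℚ *ᴿ x ≃ᴿ x
*ᴿ-identityˡ x = ≡⇒≃ᴿ (λ n → ℚ.*-identityˡ (seq x n))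

*ᴿ-distribʳ : ∀ x y z → (y +ᴿ z) *ᴿ x ≃ᴿ y *ᴿ x +ᴿ z *ᴿ x
*ᴿ-distribʳ x y z = ≡⇒≃ᴿ (λ n → ℚ.*-distribʳ-+ (seq x n) (seq y n) (seq z n))

≃ᴿ-setoid : Setoid 0ℓ 0ℓ
≃ᴿ-setoid = record
  { _≈_ = _≃ᴿ_
  ; isEquivalence = record { refl = ≃ᴿ-refl ; sym = ≃ᴿ-sym ; trans = ≃ᴿ-trans }
  }

ℝ-commutativeRing : CommutativeRing 0ℓ 0ℓ
ℝ-commutativeRing = record
  { Carrier = ℝ
  ; _≈_ = _≃ᴿ_
  ; _+_ = _+ᴿ_
  ; _*_ = _*ᴿ_
  ; -_  = -ᴿ_
  ; 0#  = fromℚ 0ℚ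
  ; 1#  = fromℚ 1ℚ
  ; isCommutativeRing = record
    { isRing = record
      { +-isAbelianGroup = record
        { isGroup = record
          { isMonoid = record
            { isSemigroup = record
              { isMagma = record
                { isEquivalence = Setoid.isEquivalence ≃ᴿ-setoid
                ; ∙-cong        = +ᴿ-cong
                }
              ; assoc = +ᴿ-assoc
              }
            ; identity = comm∧idˡ⇒id ≃ᴿ-setoid +ᴿ-comm +ᴿ-identityˡ
            }
          ; inverse = comm∧invˡ⇒inv ≃ᴿ-setoid +ᴿ-comm -ᴿ-inverseˡ
          ; ⁻¹-cong = -ᴿ-cong
          }
        ; comm = +ᴿ-comm
        }
      ; *-cong     = *ᴿ-cong
      ; *-assoc    = *ᴿ-assoc
      ; *-identity = comm∧idˡ⇒id ≃ᴿ-setoid *ᴿ-comm *ᴿ-identityˡ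
      ; distrib    = comm∧distrʳ⇒distr ≃ᴿ-setoid +ᴿ-cong *ᴿ-comm *ᴿ-distribʳ
      }
    ; *-comm = *ᴿ-comm
    }
  }

0<⊎<1 : ∀ x → (fromℚ 0ℚ <ᴿ x) ⊎ (x <ᴿ fromℚ 1ℚ)
0<⊎<1 x with cauchy x ¼ 0<¼
  where
  ¼ : ℚ
  ¼ = ½ * ½
  0<¼ : 0ℚ < ¼
  0<¼ = ℚ.positive⁻¹ ¼
... | N , p with ℚ.≤-total ½ (seq x N)
... | inj₁ ½≤x = inj₁ (½ * ½ , ℚ.positive⁻¹ (½ * ½) , N , λ n N≤n → ℚR.begin
  0ℚ + ½ * ½                    ℚR.≡⟨⟩
  ½ - ½ * ½                     ℚR.≤⟨ ℚ.+-mono-≤ ½≤x (ℚ.neg-antimono-≤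
                                    (ℚ.≤-trans (≤∣∣ _) (p N n ℕ.≤-refl N≤n))) ⟩
  seq x N - (seq x N - seq x n) ℚR.≡⟨ solve 2 (λ a b → a :- (a :- b) := b) refl (seq x N) (seq x n) ⟩
  seq x n                       ℚR.∎)
... | inj₂ x≤½ = inj₂ (½ * ½ , ℚ.positive⁻¹ (½ * ½) , N , λ n N≤n → ℚR.begin
  seq x n + ½ * ½                         ℚR.≡⟨ solve 2 (λ a b → b :+ con (½ * ½) := a :+ (b :- a) :+ con (½ * ½)) refl (seq x N) (seq x n) ⟩
  seq x N + (seq x n - seq x N) + ½ * ½   ℚR.≤⟨ ℚ.+-monoˡ-≤ (½ * ½) (ℚ.+-mono-≤ x≤½
                                              (ℚ.≤-trans (≤∣∣ _) (p n N N≤n ℕ.≤-refl))) ⟩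
  1ℚ ℚR.∎)

*-cancel-0 : ∀ x y → fromℚ 0ℚ <ᴿ y → x *ᴿ y ≃ᴿ fromℚ 0ℚ → x ≃ᴿ fromℚ 0ℚ
*-cancel-0 x y (δ , 0<δ , M , δ≤y) xy≃0 = mk≃ λ ε 0<ε →
  let (N , p) = close xy≃0 (ε * δ) (0<* 0<ε 0<δ)
  in M ℕ.⊔ N , λ n h → ℚ.*-cancelʳ-≤-pos δ {{ℚ.positive 0<δ}} (ℚR.begin
  ∣ seq x n - 0ℚ ∣ * δ              ℚR.≡⟨ cong (λ t → ∣ t ∣ * δ) (ℚ.+-identityʳ (seq x n)) ⟩
  ∣ seq x n ∣ * δ                   ℚR.≤⟨ ℚ.*-monoˡ-≤-nonNeg ∣ seq x n ∣ {{ℚ.∣-∣-nonNeg (seq x n)}}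
                                       (ℚ.≤-trans (subst (_≤ seq y n) (ℚ.+-identityˡ δ) (δ≤y n (≤⊔ˡ h))) (≤∣∣ (seq y n))) ⟩
  ∣ seq x n ∣ * ∣ seq y n ∣         ℚR.≡⟨ ℚ.∣p*q∣≡∣p∣*∣q∣ (seq x n) (seq y n) ⟨
  ∣ seq x n * seq y n ∣             ℚR.≡⟨ cong ∣_∣ (ℚ.+-identityʳ (seq x n * seq y n)) ⟨
  ∣ seq x n * seq y n - 0ℚ ∣        ℚR.≤⟨ p n (≤⊔ʳ {M} h) ⟩
  ε * δ                             ℚR.∎)

0<ᴿ-sq+ : ∀ x y → fromℚ 0ℚ <ᴿ x → fromℚ 0ℚ <ᴿ (x *ᴿ x +ᴿ y *ᴿ y)
0<ᴿ-sq+ x y (δ , 0<δ , N , p) = δ * δ , 0<* 0<δ 0<δ , N , λ n h →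
  let δ≤x = subst (_≤ seq x n) (ℚ.+-identityˡ δ) (p n h)
      0≤δ = ℚ.<⇒≤ 0<δ
  in subst (_≤ seq x n * seq x n + seq y n * seq y n) (ℚ.+-comm (δ * δ) 0ℚ)
       (ℚ.+-mono-≤ (*-mono 0≤δ (ℚ.≤-trans 0≤δ δ≤x) δ≤x δ≤x) (0≤sq (seq y n)))
  where
  0≤sq : ∀ a → 0ℚ ≤ a * a
  0≤sq a with ℚ.≤-total 0ℚ a
  ... | inj₁ 0≤a = 0≤* 0≤a 0≤a
  ... | inj₂ a≤0 = subst (0ℚ ≤_) (solve 1 (λ a → (:- a) :* (:- a) := a :* a) refl a)
                     (0≤* (ℚ.neg-antimono-≤ a≤0) (ℚ.neg-antimono-≤ a≤0))

<1⇒≄ : ∀ x q → 1ℚ ≤ q → x <ᴿ fromℚ 1ℚ → ¬ (x ≃ᴿ fromℚ q)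
<1⇒≄ x q 1≤q (δ , 0<δ , M , x+δ≤1) x≃q with close x≃q (½ * δ) (0<½* 0<δ)
... | N , p = ℚ.<-irrefl refl (ℚR.begin-strict
  q                             ℚR.≡⟨ solve 3 (λ q x d → q := (q :- x) :+ (x :+ d) :- d) refl q x′ δ ⟩
  (q - x′) + (x′ + δ) - δ       ℚR.≤⟨ ℚ.+-monoˡ-≤ (- δ) (ℚ.+-mono-≤
                                   (ℚ.≤-trans (≤∣∣ (q - x′)) (subst (_≤ ½ * δ) (∣-∣-swap x′ q) (p k (ℕ.m≤n⊔m M N))))
                                   (ℚ.≤-trans (x+δ≤1 k (ℕ.m≤m⊔n M N)) 1≤q)) ⟩
  ½ * δ + q - δ                 ℚR.≡⟨ solve 2 (λ d q → con ½ :* d :+ q :- d := q :+ :- (con ½ :* d)) refl δ q ⟩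
  q + - (½ * δ)                 ℚR.<⟨ ℚ.+-monoʳ-< q (ℚ.neg-antimono-< (0<½* 0<δ)) ⟩
  q + 0ℚ                        ℚR.≡⟨ ℚ.+-identityʳ q ⟩
  q                             ℚR.∎)
  where
  k : ℕ
  k = M ℕ.⊔ N
  x′ : ℚ
  x′ = seq x k

record ℂ : Set where
  no-eta-equality
  field
    re im : ℝ

open ℂ public

infix 4 _≃ᶜ_
infixl 6 _+ᶜ_
infixl 7 _*ᶜ_
infix 8 -ᶜ_

record _≃ᶜ_ (z w : ℂ) : Set where
  constructor mk≃ᶜ
  field
    re≃ : re z ≃ᴿ re w
    im≃ : im z ≃ᴿ im w

open _≃ᶜ_ public

0ᶜ 1ᶜ : ℂ
re 0ᶜ = fromℚ 0ℚ
im 0ᶜ = fromℚ 0ℚ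
re 1ᶜ = fromℚ 1ℚ
im 1ᶜ = fromℚ 0ℚ

_+ᶜ_ _*ᶜ_ : ℂ → ℂ → ℂ
re (z +ᶜ w) = re z +ᴿ re w
im (z +ᶜ w) = im z +ᴿ im w
re (z *ᶜ w) = re z *ᴿ re w +ᴿ -ᴿ (im z *ᴿ im w)
im (z *ᶜ w) = re z *ᴿ im w +ᴿ im z *ᴿ re w

-ᶜ_ : ℂ → ℂ
re (-ᶜ z) = -ᴿ re z
im (-ᶜ z) = -ᴿ im z

≃ᶜ-setoid : Setoid 0ℓ 0ℓ
≃ᶜ-setoid = record
  { _≈_ = _≃ᶜ_
  ; isEquivalence = record
    { refl  = mk≃ᶜ ≃ᴿ-refl ≃ᴿ-refl
    ; sym   = λ (mk≃ᶜ r i) → mk≃ᶜ (≃ᴿ-sym r) (≃ᴿ-sym i)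
    ; trans = λ (mk≃ᶜ r i) (mk≃ᶜ r′ i′) → mk≃ᶜ (≃ᴿ-trans r r′) (≃ᴿ-trans i i′)
    }
  }

+ᶜ-cong : ∀ {z z′ w w′} → z ≃ᶜ z′ → w ≃ᶜ w′ → z +ᶜ w ≃ᶜ z′ +ᶜ w′
+ᶜ-cong (mk≃ᶜ a b) (mk≃ᶜ c d) = mk≃ᶜ (+ᴿ-cong a c) (+ᴿ-cong b d)

*ᶜ-cong : ∀ {z z′ w w′} → z ≃ᶜ z′ → w ≃ᶜ w′ → z *ᶜ w ≃ᶜ z′ *ᶜ w′
*ᶜ-cong (mk≃ᶜ a b) (mk≃ᶜ c d) = mk≃ᶜ
  (+ᴿ-cong (*ᴿ-cong a c) (-ᴿ-cong (*ᴿ-cong b d)))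
  (+ᴿ-cong (*ᴿ-cong a d) (*ᴿ-cong b c))

+ᶜ-comm : ∀ z w → z +ᶜ w ≃ᶜ w +ᶜ z
+ᶜ-comm z w = mk≃ᶜ (+ᴿ-comm (re z) (re w)) (+ᴿ-comm (im z) (im w))

*ᶜ-comm : ∀ z w → z *ᶜ w ≃ᶜ w *ᶜ z
*ᶜ-comm z w = mk≃ᶜ
  (+ᴿ-cong (*ᴿ-comm (re z) (re w)) (-ᴿ-cong (*ᴿ-comm (im z) (im w))))
  (≃ᴿ-trans (+ᴿ-comm (re z *ᴿ im w) (im z *ᴿ re w))
    (+ᴿ-cong (*ᴿ-comm (im z) (re w)) (*ᴿ-comm (re z) (im w))))

*ᶜ-identityˡ : ∀ z → 1ᶜ *ᶜ z ≃ᶜ z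
*ᶜ-identityˡ z = mk≃ᶜ
  (≡⇒≃ᴿ λ n → solve 2 (λ a b → con 1ℚ :* a :+ :- (con 0ℚ :* b) := a) refl (seq (re z) n) (seq (im z) n))
  (≡⇒≃ᴿ λ n → solve 2 (λ a b → con 1ℚ :* b :+ con 0ℚ :* a := b) refl (seq (re z) n) (seq (im z) n))

*ᶜ-assoc : ∀ z w v → (z *ᶜ w) *ᶜ v ≃ᶜ z *ᶜ (w *ᶜ v)
*ᶜ-assoc z w v = mk≃ᶜ
  (≡⇒≃ᴿ λ n → solve 6 (λ a b c d e f →
    (a :* c :+ :- (b :* d)) :* e :+ :- ((a :* d :+ b :* c) :* f)
    := a :* (c :* e :+ :- (d :* f)) :+ :- (b :* (c :* f :+ d :* e))) refl
    (seq (re z) n) (seq (im z) n) (seq (re w) n) (seq (im w) n) (seq (re v) n) (seq (im v) n))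
  (≡⇒≃ᴿ λ n → solve 6 (λ a b c d e f →
    (a :* c :+ :- (b :* d)) :* f :+ (a :* d :+ b :* c) :* e
    := a :* (c :* f :+ d :* e) :+ b :* (c :* e :+ :- (d :* f))) refl
    (seq (re z) n) (seq (im z) n) (seq (re w) n) (seq (im w) n) (seq (re v) n) (seq (im v) n))

*ᶜ-distribʳ : ∀ z w v → (w +ᶜ v) *ᶜ z ≃ᶜ w *ᶜ z +ᶜ v *ᶜ z
*ᶜ-distribʳ z w v = mk≃ᶜ
  (≡⇒≃ᴿ λ n → solve 6 (λ a b c d e f →
    (c :+ e) :* a :+ :- ((d :+ f) :* b) := (c :* a :+ :- (d :* b)) :+ (e :* a :+ :- (f :* b))) refl
    (seq (re z) n) (seq (im z) n) (seq (re w) n) (seq (im w) n) (seq (re v) n) (seq (im v) n))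
  (≡⇒≃ᴿ λ n → solve 6 (λ a b c d e f →
    (c :+ e) :* b :+ (d :+ f) :* a := (c :* b :+ d :* a) :+ (e :* b :+ f :* a)) refl
    (seq (re z) n) (seq (im z) n) (seq (re w) n) (seq (im w) n) (seq (re v) n) (seq (im v) n))

ℂ-commutativeRing : CommutativeRing 0ℓ 0ℓ
ℂ-commutativeRing = record
  { Carrier = ℂ
  ; _≈_ = _≃ᶜ_
  ; _+_ = _+ᶜ_
  ; _*_ = _*ᶜ_
  ; -_  = -ᶜ_
  ; 0#  = 0ᶜ
  ; 1#  = 1ᶜ
  ; isCommutativeRing = record
    { isRing = record
      { +-isAbelianGroup = record
        { isGroup = record
          { isMonoid = record
            { isSemigroup = record
              { isMagma = record
                { isEquivalence = Setoid.isEquivalence ≃ᶜ-setoid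
                ; ∙-cong        = +ᶜ-cong
                }
              ; assoc = λ z w v → mk≃ᶜ (+ᴿ-assoc (re z) (re w) (re v)) (+ᴿ-assoc (im z) (im w) (im v))
              }
            ; identity = comm∧idˡ⇒id ≃ᶜ-setoid +ᶜ-comm
                (λ z → mk≃ᶜ (+ᴿ-identityˡ (re z)) (+ᴿ-identityˡ (im z)))
            }
          ; inverse = comm∧invˡ⇒inv ≃ᶜ-setoid +ᶜ-comm
              (λ z → mk≃ᶜ (-ᴿ-inverseˡ (re z)) (-ᴿ-inverseˡ (im z)))
          ; ⁻¹-cong = λ (mk≃ᶜ r i) → mk≃ᶜ (-ᴿ-cong r) (-ᴿ-cong i)
          }
        ; comm = +ᶜ-comm
        }
      ; *-cong     = *ᶜ-cong
      ; *-assoc    = *ᶜ-assoc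
      ; *-identity = comm∧idˡ⇒id ≃ᶜ-setoid *ᶜ-comm *ᶜ-identityˡ
      ; distrib    = comm∧distrʳ⇒distr ≃ᶜ-setoid +ᶜ-cong *ᶜ-comm *ᶜ-distribʳ
      }
    ; *-comm = *ᶜ-comm
    }
  }

-- A nonzero real part makes multiplication cancellable: multiply u z ≃ 0 by the conjugate of z.
*ᶜ-cancel-0 : ∀ u z → fromℚ 0ℚ <ᴿ re z → u *ᶜ z ≃ᶜ 0ᶜ → u ≃ᶜ 0ᶜ
*ᶜ-cancel-0 u z 0<r (mk≃ᶜ re≃0 im≃0) = mk≃ᶜ
  (*-cancel-0 a (r *ᴿ r +ᴿ s *ᴿ s) 0<q (≃ᴿ-trans
    (≡⇒≃ᴿ λ n → solve 4 (λ a b r s → a :* (r :* r :+ s :* s)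
        := r :* (a :* r :+ :- (b :* s)) :+ s :* (a :* s :+ b :* r)) refl
        (seq a n) (seq b n) (seq r n) (seq s n))
    (comb≃0 r s (a *ᴿ r +ᴿ -ᴿ (b *ᴿ s)) (a *ᴿ s +ᴿ b *ᴿ r) re≃0 im≃0)))
  (*-cancel-0 b (r *ᴿ r +ᴿ s *ᴿ s) 0<q (≃ᴿ-trans
    (≡⇒≃ᴿ λ n → solve 4 (λ a b r s → b :* (r :* r :+ s :* s)
        := r :* (a :* s :+ b :* r) :+ (:- s) :* (a :* r :+ :- (b :* s))) refl
        (seq a n) (seq b n) (seq r n) (seq s n))
    (comb≃0 r (-ᴿ s) (a *ᴿ s +ᴿ b *ᴿ r) (a *ᴿ r +ᴿ -ᴿ (b *ᴿ s)) im≃0 re≃0)))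
  where
  open CommutativeRing ℝ-commutativeRing using (zeroʳ)
  a b r s : ℝ
  a = re u
  b = im u
  r = re z
  s = im z
  0<q : fromℚ 0ℚ <ᴿ (r *ᴿ r +ᴿ s *ᴿ s)
  0<q = 0<ᴿ-sq+ r s 0<r
  comb≃0 : ∀ x y u v → u ≃ᴿ fromℚ 0ℚ → v ≃ᴿ fromℚ 0ℚ → x *ᴿ u +ᴿ y *ᴿ v ≃ᴿ fromℚ 0ℚ
  comb≃0 x y u v u≃0 v≃0 = ≃ᴿ-trans
    (+ᴿ-cong (≃ᴿ-trans (*ᴿ-cong ≃ᴿ-refl u≃0) (zeroʳ x)) (≃ᴿ-trans (*ᴿ-cong ≃ᴿ-refl v≃0) (zeroʳ y)))
    (+ᴿ-identityˡ (fromℚ 0ℚ))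

open import Algebra.Properties.Semiring.Exp (CommutativeRing.semiring ℂ-commutativeRing) public
  using () renaming (_^_ to infixr 8 _^ᶜ_)

module Geometric (R : CommutativeRing 0ℓ 0ℓ) where
  open CommutativeRing R renaming (_+_ to _⊕_; _*_ to _⊛_; -_ to ⊖_; refl to ≈-refl; sym to ≈-sym)
  open import Algebra.Properties.Semiring.Exp semiring using (_^_; ^-congˡ)
  open import Algebra.Properties.Semiring.Mult semiring using (×-congʳ) renaming (_×_ to _·_)
  open import Algebra.Properties.Ring ring using (-‿distribˡ-*; +-cancelʳ)
  open import Algebra.Solver.Ring.NaturalCoefficients.Default commutativeSemiring
    using () renaming (solve to solve′; con to con′; _:+_ to _:⊕_; _:*_ to _:⊛_; _:=_ to _:≈_)
  open import Relation.Binary.Reasoning.Setoid setoid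

  -- geom z w k = Σ_{i<k} z^i w^(k-1-i)
  geom : Carrier → Carrier → ℕ → Carrier
  geom z w zero    = 0#
  geom z w (suc k) = (z ^ k) ⊕ (w ⊛ geom z w k)

  geom-telescope : ∀ z w k → (z ⊛ geom z w k) ⊕ (w ^ k) ≈ (z ^ k) ⊕ (w ⊛ geom z w k)
  geom-telescope z w zero = solve′ 2 (λ z w → z :⊛ con′ 0 :⊕ con′ 1 :≈ con′ 1 :⊕ w :⊛ con′ 0) ≈-refl z w
  geom-telescope z w (suc k) = begin
    (z ⊛ ((z ^ k) ⊕ (w ⊛ g))) ⊕ (w ⊛ (w ^ k))
      ≈⟨ solve′ 5 (λ z w p g q → z :⊛ (p :⊕ w :⊛ g) :⊕ w :⊛ q :≈ z :⊛ p :⊕ w :⊛ (z :⊛ g :⊕ q))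
           ≈-refl z w (z ^ k) g (w ^ k) ⟩
    (z ⊛ (z ^ k)) ⊕ (w ⊛ ((z ⊛ g) ⊕ (w ^ k)))
      ≈⟨ +-congˡ (*-congˡ (geom-telescope z w k)) ⟩
    (z ⊛ (z ^ k)) ⊕ (w ⊛ ((z ^ k) ⊕ (w ⊛ g))) ∎
    where
    g : Carrier
    g = geom z w k

  ·-comm : ∀ w x j → w ⊛ (j · x) ≈ j · (w ⊛ x)
  ·-comm w x zero    = zeroʳ w
  ·-comm w x (suc j) = trans′ (distribˡ w x (j · x)) (+-congˡ (·-comm w x j))
    where open CommutativeRing R using () renaming (trans to trans′)

  geom-diagonal : ∀ {z w} → z ≈ w → ∀ k → w ⊛ geom z w k ≈ k · (w ^ k)
  geom-diagonal {z} {w} z≈w zero    = zeroʳ w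
  geom-diagonal {z} {w} z≈w (suc k) = begin
    w ⊛ ((z ^ k) ⊕ (w ⊛ geom z w k))
      ≈⟨ *-congˡ (+-cong (^-congˡ k z≈w) (geom-diagonal z≈w k)) ⟩
    w ⊛ ((w ^ k) ⊕ (k · (w ^ k)))
      ≈⟨ distribˡ w (w ^ k) (k · (w ^ k)) ⟩
    (w ^ suc k) ⊕ (w ⊛ (k · (w ^ k)))
      ≈⟨ +-congˡ (·-comm w (w ^ k) k) ⟩
    (w ^ suc k) ⊕ (k · (w ^ suc k)) ∎

  roots-product : ∀ m {z w} → z ^ m ≈ 1# → w ^ m ≈ 1# → (z ⊕ ⊖ w) ⊛ (w ⊛ geom z w m) ≈ 0#
  roots-product m {z} {w} z^m≈1 w^m≈1 = begin
    (z ⊕ ⊖ w) ⊛ (w ⊛ g)               ≈⟨ distribʳ (w ⊛ g) z (⊖ w) ⟩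
    (z ⊛ (w ⊛ g)) ⊕ (⊖ w ⊛ (w ⊛ g))
      ≈⟨ +-cong (solve′ 3 (λ z w g → z :⊛ (w :⊛ g) :≈ w :⊛ (z :⊛ g)) ≈-refl z w g)
                (≈-sym (-‿distribˡ-* w (w ⊛ g))) ⟩
    (w ⊛ (z ⊛ g)) ⊕ ⊖ (w ⊛ (w ⊛ g))   ≈⟨ +-congʳ (*-congˡ zg≈wg) ⟩
    (w ⊛ (w ⊛ g)) ⊕ ⊖ (w ⊛ (w ⊛ g))   ≈⟨ -‿inverseʳ (w ⊛ (w ⊛ g)) ⟩
    0# ∎
    where
    g : Carrier
    g = geom z w m
    zg≈wg : z ⊛ g ≈ w ⊛ g
    zg≈wg = +-cancelʳ 1# (z ⊛ g) (w ⊛ g) (begin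
      (z ⊛ g) ⊕ 1#      ≈⟨ +-congˡ w^m≈1 ⟨
      (z ⊛ g) ⊕ (w ^ m) ≈⟨ geom-telescope z w m ⟩
      (z ^ m) ⊕ (w ⊛ g) ≈⟨ +-congʳ z^m≈1 ⟩
      1# ⊕ (w ⊛ g)      ≈⟨ +-comm 1# (w ⊛ g) ⟩
      (w ⊛ g) ⊕ 1# ∎)

module ℂ-roots where
  open CommutativeRing ℂ-commutativeRing using (semiring; ring; zeroˡ) renaming (trans to trans′; sym to sym′)
  open Geometric ℂ-commutativeRing
  open import Algebra.Properties.Semiring.Exp semiring using (^-congˡ)
  open import Algebra.Properties.Semiring.Mult semiring using (×-congʳ) renaming (_×_ to _·_)
  open import Algebra.Properties.Ring ring using (x∙y⁻¹≈ε⇒x≈y)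

  re-ℕ : ∀ k → ∃[ q ] 0ℚ ≤ q × re (k · 1ᶜ) ≃ᴿ fromℚ q
  re-ℕ zero = 0ℚ , ℚ.≤-refl , ≃ᴿ-refl
  re-ℕ (suc k) with re-ℕ k
  ... | q , 0≤q , e = 1ℚ + q , 0≤+ (ℚ.nonNegative⁻¹ 1ℚ) 0≤q
                    , ≃ᴿ-trans (+ᴿ-cong ≃ᴿ-refl e) (≡⇒≃ᴿ λ _ → refl)

  re-ℕ⁺ : ∀ k → ∃[ q ] 1ℚ ≤ q × re (suc k · 1ᶜ) ≃ᴿ fromℚ q
  re-ℕ⁺ k with re-ℕ k
  ... | q , 0≤q , e = 1ℚ + q , subst (_≤ 1ℚ + q) (ℚ.+-identityʳ 1ℚ) (ℚ.+-monoʳ-≤ 1ℚ 0≤q)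
                    , ≃ᴿ-trans (+ᴿ-cong ≃ᴿ-refl e) (≡⇒≃ᴿ λ _ → refl)

  -- With g = Σ z^i w^(m-1-i) one has (z - w) w g ≃ 0, while w g ≃ m when z ≃ w;
  -- so it suffices to compare re (w g) with the gap between 0 and 1.
  roots-≟ : ∀ m .{{_ : ℕ.NonZero m}} {z w} → z ^ᶜ m ≃ᶜ 1ᶜ → w ^ᶜ m ≃ᶜ 1ᶜ → Dec (z ≃ᶜ w)
  roots-≟ m@(suc k) {z} {w} z^m≃1 w^m≃1 = decide (0<⊎<1 (re wg))
    where
    wg : ℂ
    wg = w *ᶜ geom z w m
    decide : (fromℚ 0ℚ <ᴿ re wg) ⊎ (re wg <ᴿ fromℚ 1ℚ) → Dec (z ≃ᶜ w)
    decide (inj₁ 0<r) = yes (x∙y⁻¹≈ε⇒x≈y z w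
      (*ᶜ-cancel-0 (z +ᶜ -ᶜ w) wg 0<r (roots-product m z^m≃1 w^m≃1)))
    decide (inj₂ r<1) = no λ z≃w → let (q , 1≤q , e) = re-ℕ⁺ k in
      <1⇒≄ (re wg) q 1≤q r<1
        (≃ᴿ-trans (re≃ (trans′ (geom-diagonal z≃w m) (×-congʳ m w^m≃1))) e)

  0≄1 : ¬ (0ᶜ ≃ᶜ 1ᶜ)
  0≄1 0≃1 = <1⇒≄ (fromℚ 0ℚ) 1ℚ ℚ.≤-refl
    (½ , ℚ.positive⁻¹ ½ , 0 , λ _ _ → ℚ.≤ᵇ⇒≤ _) (re≃ 0≃1)

  root≄0 : ∀ m .{{_ : ℕ.NonZero m}} {z w} → z ^ᶜ m ≃ᶜ 1ᶜ → w ≃ᶜ 0ᶜ → ¬ (z ≃ᶜ w)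
  root≄0 m@(suc k) {z} {w} z^m≃1 w≃0 z≃w =
    0≄1 (trans′ (sym′ (trans′ (^-congˡ m (trans′ z≃w w≃0)) (zeroˡ (0ᶜ ^ᶜ k)))) z^m≃1)

fromℕ : ℕ → ℚ
fromℕ n = + n ℚ./ 1

fromℕ-mono : ∀ {m n} → m ℕ.≤ n → fromℕ m ≤ fromℕ n
fromℕ-mono {m} {n} m≤n = ℚ.toℚᵘ-cancel-≤ (ℚᵘ.≤-respˡ-≃ (ℚᵘ.≃-sym (ℚ.toℚᵘ-fromℚᵘ (ℚᵘ.mkℚᵘ (+ m) 0)))
  (ℚᵘ.≤-respʳ-≃ (ℚᵘ.≃-sym (ℚ.toℚᵘ-fromℚᵘ (ℚᵘ.mkℚᵘ (+ n) 0)))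
    (ℚᵘ.*≤* (ℤ.*-monoʳ-≤-nonNeg (+ 1) (ℤ.+≤+ m≤n)))))

fromℕ-* : ∀ m n → fromℕ (m ℕ.* n) ≡ fromℕ m * fromℕ n
fromℕ-* m n = ℚ.toℚᵘ-injective (begin
  ℚ.toℚᵘ (fromℕ (m ℕ.* n))              ≈⟨ ℚ.toℚᵘ-fromℚᵘ (ℚᵘ.mkℚᵘ (+ (m ℕ.* n)) 0) ⟩
  ℚᵘ.mkℚᵘ (+ (m ℕ.* n)) 0               ≡⟨ cong (λ i → ℚᵘ.mkℚᵘ i 0) (ℤ.pos-* m n) ⟩
  ℚᵘ.mkℚᵘ (+ m) 0 ℚᵘ.* ℚᵘ.mkℚᵘ (+ n) 0  ≈⟨ ℚᵘ.*-cong (ℚ.toℚᵘ-fromℚᵘ (ℚᵘ.mkℚᵘ (+ m) 0)) (ℚ.toℚᵘ-fromℚᵘ (ℚᵘ.mkℚᵘ (+ n) 0)) ⟨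
  ℚ.toℚᵘ (fromℕ m) ℚᵘ.* ℚ.toℚᵘ (fromℕ n) ≈⟨ ℚ.toℚᵘ-homo-* (fromℕ m) (fromℕ n) ⟨
  ℚ.toℚᵘ (fromℕ m * fromℕ n)            ∎)
  where open ℚᵘ.≃-Reasoning

fromℕ-suc : ∀ n → fromℕ (suc n) ≡ 1ℚ + fromℕ n
fromℕ-suc n = ℚ.toℚᵘ-injective (begin
  ℚ.toℚᵘ (fromℕ (suc n))                   ≈⟨ ℚ.toℚᵘ-fromℚᵘ (ℚᵘ.mkℚᵘ (+ suc n) 0) ⟩
  ℚᵘ.mkℚᵘ (+ suc n) 0                      ≈⟨ ℚᵘ.*≡* (cong (ℤ._* + 1) (sym (cong (ℤ._+_ (+ 1)) (ℤ.*-identityʳ (+ n))))) ⟩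
  ℚᵘ.mkℚᵘ (+ 1) 0 ℚᵘ.+ ℚᵘ.mkℚᵘ (+ n) 0     ≈⟨ ℚᵘ.+-cong (ℚᵘ.≃-refl {ℚ.toℚᵘ 1ℚ}) (ℚ.toℚᵘ-fromℚᵘ (ℚᵘ.mkℚᵘ (+ n) 0)) ⟨
  ℚ.toℚᵘ 1ℚ ℚᵘ.+ ℚ.toℚᵘ (fromℕ n)          ≈⟨ ℚ.toℚᵘ-homo-+ 1ℚ (fromℕ n) ⟨
  ℚ.toℚᵘ (1ℚ + fromℕ n)                    ∎)
  where open ℚᵘ.≃-Reasoning

0≤fromℕ : ∀ n → 0ℚ ≤ fromℕ n
0≤fromℕ n = fromℕ-mono {0} {n} ℕ.z≤n

archimedean : ∀ q → ∃[ n ] q ≤ fromℕ n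
archimedean q@(ℚ.mkℚ i d-1 _) = ℤ.∣ i ∣ , ℚ.toℚᵘ-cancel-≤
  (ℚᵘ.≤-respʳ-≃ (ℚᵘ.≃-sym (ℚ.toℚᵘ-fromℚᵘ (ℚᵘ.mkℚᵘ (+ ℤ.∣ i ∣) 0))) (ℚᵘ.*≤* (lem i)))
  where
  lem : ∀ i → i ℤ.* + 1 ℤ.≤ + ℤ.∣ i ∣ ℤ.* + suc d-1
  lem (+ n)    = subst₂ ℤ._≤_ (ℤ.pos-* n 1) (ℤ.pos-* n (suc d-1))
                   (ℤ.+≤+ (ℕ.*-monoʳ-≤ n (ℕ.s≤s ℕ.z≤n)))
  lem -[1+ n ] = ℤ.≤-trans (ℤ.≤-reflexive (ℤ.*-identityʳ -[1+ n ])) ℤ.-≤+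

2⁻ : ℕ → ℚ
2⁻ zero    = 1ℚ
2⁻ (suc n) = ½ * 2⁻ n

0≤½ : 0ℚ ≤ ½
0≤½ = ℚ.nonNegative⁻¹ ½

0≤1 : 0ℚ ≤ 1ℚ
0≤1 = ℚ.nonNegative⁻¹ 1ℚ

0≤2⁻ : ∀ n → 0ℚ ≤ 2⁻ n
0≤2⁻ zero    = 0≤1
0≤2⁻ (suc n) = 0≤* 0≤½ (0≤2⁻ n)

½*≤ : ∀ {q} → 0ℚ ≤ q → ½ * q ≤ q
½*≤ {q} 0≤q = subst₂ _≤_ (ℚ.+-identityʳ (½ * q)) (halves q) (ℚ.+-monoʳ-≤ (½ * q) (0≤* 0≤½ 0≤q))

2⁻≤1 : ∀ n → 2⁻ n ≤ 1ℚ
2⁻≤1 zero    = ℚ.≤-refl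
2⁻≤1 (suc n) = ℚ.≤-trans (½*≤ (0≤2⁻ n)) (2⁻≤1 n)

n2⁻ⁿ≤1 : ∀ n → fromℕ n * 2⁻ n ≤ 1ℚ
n2⁻ⁿ≤1 zero    = ℚ.≤-trans (ℚ.≤-reflexive (ℚ.*-zeroˡ 1ℚ)) 0≤1
n2⁻ⁿ≤1 (suc n) = ℚR.begin
  fromℕ (suc n) * (½ * 2⁻ n)          ℚR.≡⟨ cong (_* (½ * 2⁻ n)) (fromℕ-suc n) ⟩
  (1ℚ + fromℕ n) * (½ * 2⁻ n)         ℚR.≡⟨ solve 2 (λ a h → (con 1ℚ :+ a) :* (con ½ :* h)
                                             := con ½ :* h :+ con ½ :* (a :* h)) refl (fromℕ n) (2⁻ n) ⟩
  ½ * 2⁻ n + ½ * (fromℕ n * 2⁻ n)     ℚR.≤⟨ ℚ.+-mono-≤ (ℚ.*-monoˡ-≤-nonNeg ½ (2⁻≤1 n))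
                                                     (ℚ.*-monoˡ-≤-nonNeg ½ (n2⁻ⁿ≤1 n)) ⟩
  ½ * 1ℚ + ½ * 1ℚ                     ℚR.≡⟨⟩
  1ℚ                                  ℚR.∎

2⁻-small : ∀ C ε → 0ℚ < C → 0ℚ < ε → ∃[ N ] C * 2⁻ N ≤ ε
2⁻-small C ε 0<C 0<ε with split 0<C 0<ε
... | δ , 0<δ , εδ≡C with archimedean δ
... | N , δ≤N = N , (ℚR.begin
  C * 2⁻ N              ℚR.≡⟨ cong (_* 2⁻ N) εδ≡C ⟨
  ε * δ * 2⁻ N          ℚR.≡⟨ ℚ.*-assoc ε δ (2⁻ N) ⟩
  ε * (δ * 2⁻ N)        ℚR.≤⟨ *-mono (ℚ.<⇒≤ 0<ε) 0≤1 ℚ.≤-refl (ℚ.≤-trans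
                              (*-mono (ℚ.<⇒≤ 0<δ) (0≤2⁻ N) δ≤N ℚ.≤-refl) (n2⁻ⁿ≤1 N)) ⟩
  ε * 1ℚ                ℚR.≡⟨ ℚ.*-identityʳ ε ⟩
  ε                     ℚR.∎)

≤-halves : ∀ {a} b c ε → a ≤ b + c → b ≤ ½ * ε → c ≤ ½ * ε → a ≤ ε
≤-halves b c ε a≤b+c b≤ c≤ = ℚ.≤-trans a≤b+c (subst (b + c ≤_) (halves ε) (ℚ.+-mono-≤ b≤ c≤))

2⁻-close⇒cauchy : ∀ x → (∀ n m → n ℕ.≤ m → ∣ x m - x n ∣ ≤ 2⁻ n) → IsCauchy x
2⁻-close⇒cauchy x x-close ε 0<ε =
  let (N , small) = 2⁻-small 1ℚ (½ * ε) (ℚ.positive⁻¹ 1ℚ) (0<½* 0<ε)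
      2⁻N≤ = subst (_≤ ½ * ε) (ℚ.*-identityˡ (2⁻ N)) small
  in N , λ m n hm hn → ≤-halves ∣ x m - x N ∣ ∣ x N - x n ∣ ε (triangle (x m) (x N) (x n))
       (ℚ.≤-trans (x-close N m hm) 2⁻N≤)
       (ℚ.≤-trans (ℚ.≤-reflexive (∣-∣-swap (x N) (x n))) (ℚ.≤-trans (x-close N n hn) 2⁻N≤))

2⁻-cancel : ∀ n k → fromℕ (2 ℕ.^ k) * 2⁻ (k ℕ.+ n) ≡ 2⁻ n
2⁻-cancel n zero    = ℚ.*-identityˡ (2⁻ n)
2⁻-cancel n (suc k) = trans (cong (_* (½ * 2⁻ (k ℕ.+ n))) (fromℕ-* 2 (2 ℕ.^ k)))
  (trans (solve 2 (λ a h → con (fromℕ 2) :* a :* (con ½ :* h) := a :* h) refl (fromℕ (2 ℕ.^ k)) (2⁻ (k ℕ.+ n)))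
         (2⁻-cancel n k))

^-distribʳ-* : ∀ n x y → (x ℕ.* y) ℕ.^ n ≡ x ℕ.^ n ℕ.* y ℕ.^ n
^-distribʳ-* zero    x y = refl
^-distribʳ-* (suc n) x y = trans (cong (x ℕ.* y ℕ.*_) (^-distribʳ-* n x y))
  (ℕ.[m*n]*[o*p]≡[m*o]*[n*p] x y (x ℕ.^ n) (y ℕ.^ n))

⌊root⌋≤ : (b N j : ℕ) → ℕ
⌊root⌋≤ b N zero = zero
⌊root⌋≤ b N (suc j) with (suc j) ℕ.^ b ℕ.≤? N
... | yes _ = suc j
... | no  _ = ⌊root⌋≤ b N j

-- the largest j with j ^ b ≤ N (for b ≥ 1)
⌊root⌋ : (b N : ℕ) → ℕ
⌊root⌋ b N = ⌊root⌋≤ b N N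

⌊root⌋≤-sound : ∀ b .{{_ : ℕ.NonZero b}} N j → ⌊root⌋≤ b N j ℕ.^ b ℕ.≤ N
⌊root⌋≤-sound (suc b) N zero = ℕ.z≤n
⌊root⌋≤-sound b N (suc j) with (suc j) ℕ.^ b ℕ.≤? N
... | yes p = p
... | no  _ = ⌊root⌋≤-sound b N j

⌊root⌋≤-max : ∀ b N j i → i ℕ.≤ j → i ℕ.^ b ℕ.≤ N → i ℕ.≤ ⌊root⌋≤ b N j
⌊root⌋≤-max b N zero    i i≤j p = i≤j
⌊root⌋≤-max b N (suc j) i i≤j p with (suc j) ℕ.^ b ℕ.≤? N
... | yes _ = i≤j
... | no ¬q with ℕ.m≤n⇒m<n∨m≡n i≤j
...   | inj₁ (ℕ.s≤s i≤j′) = ⌊root⌋≤-max b N j i i≤j′ p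
...   | inj₂ refl         = contradiction p ¬q

⌊root⌋-lower : ∀ b .{{_ : ℕ.NonZero b}} N → ⌊root⌋ b N ℕ.^ b ℕ.≤ N
⌊root⌋-lower b N = ⌊root⌋≤-sound b N N

⌊root⌋-max : ∀ b .{{_ : ℕ.NonZero b}} N i → i ℕ.^ b ℕ.≤ N → i ℕ.≤ ⌊root⌋ b N
⌊root⌋-max b N zero p = ℕ.z≤n
⌊root⌋-max b@(suc b-1) N i@(suc i-1) p = ⌊root⌋≤-max b N N i
  (ℕ.≤-trans (ℕ.m≤m*n i (i ℕ.^ b-1) {{ℕ.m^n≢0 i b-1}}) p) p

⌊root⌋-upper : ∀ b .{{_ : ℕ.NonZero b}} N → N ℕ.< suc (⌊root⌋ b N) ℕ.^ b
⌊root⌋-upper b N = ℕ.≰⇒> λ p → ℕ.<-irrefl refl (⌊root⌋-max b N (suc (⌊root⌋ b N)) p)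

module Root (b : ℕ) .{{_ : ℕ.NonZero b}} (N : ℕ) where
  M : ℕ → ℕ
  M n = N ℕ.* (2 ℕ.^ n) ℕ.^ b

  M-shift : ∀ n k → M (k ℕ.+ n) ≡ M n ℕ.* (2 ℕ.^ k) ℕ.^ b
  M-shift n k = trans
    (cong (λ t → N ℕ.* t ℕ.^ b) (trans (ℕ.^-distribˡ-+-* 2 k n) (ℕ.*-comm (2 ℕ.^ k) (2 ℕ.^ n))))
    (trans (cong (N ℕ.*_) (^-distribʳ-* b (2 ℕ.^ n) (2 ℕ.^ k)))
           (sym (ℕ.*-assoc N ((2 ℕ.^ n) ℕ.^ b) ((2 ℕ.^ k) ℕ.^ b))))

  r : ℕ → ℕ
  r n = ⌊root⌋ b (M n)

  x : ℕ → ℚ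
  x n = fromℕ (r n) * 2⁻ n

  r-lower : ∀ n k → r n ℕ.* 2 ℕ.^ k ℕ.≤ r (k ℕ.+ n)
  r-lower n k = ⌊root⌋-max b (M (k ℕ.+ n)) (r n ℕ.* 2 ℕ.^ k)
    (subst₂ ℕ._≤_ (sym (^-distribʳ-* b (r n) (2 ℕ.^ k))) (sym (M-shift n k))
      (ℕ.*-monoˡ-≤ ((2 ℕ.^ k) ℕ.^ b) (⌊root⌋-lower b (M n))))

  r-upper : ∀ n k → r (k ℕ.+ n) ℕ.≤ suc (r n) ℕ.* 2 ℕ.^ k
  r-upper n k = ℕ.≮⇒≥ λ lt → ℕ.<-irrefl refl (ℕ.<-≤-trans
    (ℕ.*-monoˡ-< ((2 ℕ.^ k) ℕ.^ b) {{ℕ.m^n≢0 (2 ℕ.^ k) b {{ℕ.m^n≢0 2 k}}}} (⌊root⌋-upper b (M n)))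
    (subst₂ ℕ._≤_ (^-distribʳ-* b (suc (r n)) (2 ℕ.^ k)) (M-shift n k)
      (ℕ.≤-trans (ℕ.^-monoˡ-≤ b (ℕ.<⇒≤ lt)) (⌊root⌋-lower b (M (k ℕ.+ n))))))

  scale : ∀ j n k → fromℕ (j ℕ.* 2 ℕ.^ k) * 2⁻ (k ℕ.+ n) ≡ fromℕ j * 2⁻ n
  scale j n k = trans (cong (_* 2⁻ (k ℕ.+ n)) (fromℕ-* j (2 ℕ.^ k)))
    (trans (ℚ.*-assoc (fromℕ j) (fromℕ (2 ℕ.^ k)) (2⁻ (k ℕ.+ n))) (cong (fromℕ j *_) (2⁻-cancel n k)))

  x-lower : ∀ n k → x n ≤ x (k ℕ.+ n)
  x-lower n k = subst (_≤ x (k ℕ.+ n)) (scale (r n) n k)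
    (ℚ.*-monoʳ-≤-nonNeg (2⁻ (k ℕ.+ n)) {{ℚ.nonNegative (0≤2⁻ (k ℕ.+ n))}} (fromℕ-mono (r-lower n k)))

  x-upper : ∀ n k → x (k ℕ.+ n) ≤ 2⁻ n + x n
  x-upper n k = subst (x (k ℕ.+ n) ≤_)
    (trans (scale (suc (r n)) n k) (trans (cong (_* 2⁻ n) (fromℕ-suc (r n)))
      (solve 2 (λ a h → (con 1ℚ :+ a) :* h := h :+ a :* h) refl (fromℕ (r n)) (2⁻ n))))
    (ℚ.*-monoʳ-≤-nonNeg (2⁻ (k ℕ.+ n)) {{ℚ.nonNegative (0≤2⁻ (k ℕ.+ n))}} (fromℕ-mono (r-upper n k)))

  x-close : ∀ n m → n ℕ.≤ m → ∣ x m - x n ∣ ≤ 2⁻ n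
  x-close n m n≤m = subst (λ m → ∣ x m - x n ∣ ≤ 2⁻ n) (ℕ.m∸n+n≡m n≤m) (ℚR.begin
    ∣ x (k ℕ.+ n) - x n ∣    ℚR.≡⟨ ℚ.0≤p⇒∣p∣≡p (subst (_≤ x (k ℕ.+ n) - x n) (ℚ.+-inverseʳ (x n))
                                   (ℚ.+-monoˡ-≤ (- x n) (x-lower n k))) ⟩
    x (k ℕ.+ n) - x n        ℚR.≤⟨ ℚ.+-monoˡ-≤ (- x n) (x-upper n k) ⟩
    2⁻ n + x n - x n         ℚR.≡⟨ solve 2 (λ h x → h :+ x :- x := h) refl (2⁻ n) (x n) ⟩
    2⁻ n                     ℚR.∎)
    where
    k : ℕ
    k = m ℕ.∸ n

  x-cauchy : IsCauchy x
  x-cauchy = 2⁻-close⇒cauchy x x-close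

-- The real number (N ^ a) ^ (1/b): its n-th term is ⌊ 2ⁿ (N ^ a) ^ (1/b) ⌋ / 2ⁿ.
_^[_/_] : ℕ → ℕ → (b : ℕ) .{{_ : ℕ.NonZero b}} → ℝ
seq    (N ^[ a / b ]) = Root.x b (N ℕ.^ a)
cauchy (N ^[ a / b ]) = Root.x-cauchy b (N ℕ.^ a)

-- 1/a for a ≥ 1; only such arguments occur below.
inv : ℚ → ℚ
inv a = ℚ.1/_ (a ⊔ 1ℚ) {{ℚ.>-nonZero (ℚ.<-≤-trans (ℚ.positive⁻¹ 1ℚ) (ℚ.p≤q⊔p a 1ℚ))}}

-- The left Riemann sum of 1/t over [a , a + w] with 2ⁿ equal subintervals.
riemann : ℕ → ℚ → ℚ → ℚ
riemann zero    a w = w * inv a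
riemann (suc n) a w = riemann n a (½ * w) + riemann n (a + ½ * w) (½ * w)

inv-inverse : ∀ {a} → 1ℚ ≤ a → a * inv a ≡ 1ℚ
inv-inverse {a} 1≤a = trans (cong (_* inv a) (sym (ℚ.p≥q⇒p⊔q≡p 1≤a)))
  (ℚ.*-inverseʳ (a ⊔ 1ℚ) {{ℚ.>-nonZero (ℚ.<-≤-trans (ℚ.positive⁻¹ 1ℚ) (ℚ.p≤q⊔p a 1ℚ))}})

0≤inv : ∀ a → 0ℚ ≤ inv a
0≤inv a = ℚ.<⇒≤ (ℚ.positive⁻¹ (inv a) {{ℚ.1/pos⇒pos (a ⊔ 1ℚ)
  {{ℚ.positive (ℚ.<-≤-trans (ℚ.positive⁻¹ 1ℚ) (ℚ.p≤q⊔p a 1ℚ))}}}})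

inv≤1 : ∀ {a} → 1ℚ ≤ a → inv a ≤ 1ℚ
inv≤1 {a} 1≤a = subst₂ _≤_ (ℚ.*-identityˡ (inv a)) (inv-inverse 1≤a)
  (ℚ.*-monoʳ-≤-nonNeg (inv a) {{ℚ.nonNegative (0≤inv a)}} 1≤a)

∣inv∣≤1 : ∀ {a} → 1ℚ ≤ a → ∣ inv a ∣ ≤ 1ℚ
∣inv∣≤1 {a} 1≤a = subst (_≤ 1ℚ) (sym (ℚ.0≤p⇒∣p∣≡p (0≤inv a))) (inv≤1 1≤a)

inv-lipschitz : ∀ {a b} → 1ℚ ≤ a → 1ℚ ≤ b → ∣ inv a - inv b ∣ ≤ ∣ a - b ∣
inv-lipschitz {a} {b} 1≤a 1≤b = ℚR.begin
  ∣ inv a - inv b ∣                          ℚR.≡⟨ cong ∣_∣ eq ⟩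
  ∣ (b - a) * (inv a * inv b) ∣              ℚR.≡⟨ ℚ.∣p*q∣≡∣p∣*∣q∣ (b - a) (inv a * inv b) ⟩
  ∣ b - a ∣ * ∣ inv a * inv b ∣              ℚR.≡⟨ cong (∣ b - a ∣ *_) (ℚ.∣p*q∣≡∣p∣*∣q∣ (inv a) (inv b)) ⟩
  ∣ b - a ∣ * (∣ inv a ∣ * ∣ inv b ∣)        ℚR.≤⟨ *-mono (ℚ.0≤∣p∣ (b - a)) 0≤1 ℚ.≤-refl
                                                (*-mono (ℚ.0≤∣p∣ (inv a)) 0≤1 (∣inv∣≤1 1≤a) (∣inv∣≤1 1≤b)) ⟩
  ∣ b - a ∣ * 1ℚ                             ℚR.≡⟨ trans (ℚ.*-identityʳ ∣ b - a ∣) (∣-∣-swap b a) ⟩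
  ∣ a - b ∣                                  ℚR.∎
  where
  eq : inv a - inv b ≡ (b - a) * (inv a * inv b)
  eq = sym (trans
    (solve 4 (λ a b x y → (b :- a) :* (x :* y) := (b :* y) :* x :- (a :* x) :* y) refl a b (inv a) (inv b))
    (cong₂ _-_ (trans (cong (_* inv a) (inv-inverse 1≤b)) (ℚ.*-identityˡ (inv a)))
               (trans (cong (_* inv b) (inv-inverse 1≤a)) (ℚ.*-identityˡ (inv b)))))

0≤½* : ∀ {w} → 0ℚ ≤ w → 0ℚ ≤ ½ * w
0≤½* = 0≤* 0≤½

1≤+ : ∀ {a w} → 1ℚ ≤ a → 0ℚ ≤ w → 1ℚ ≤ a + w
1≤+ {a} {w} 1≤a 0≤w = subst (_≤ a + w) (ℚ.+-identityʳ 1ℚ) (ℚ.+-mono-≤ 1≤a 0≤w)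

∣½*-diff∣ : ∀ w w′ → ∣ ½ * w - ½ * w′ ∣ ≡ ½ * ∣ w - w′ ∣
∣½*-diff∣ w w′ = trans (cong ∣_∣ (solve 2 (λ w w′ → con ½ :* w :- con ½ :* w′ := con ½ :* (w :- w′)) refl w w′))
  (trans (ℚ.∣p*q∣≡∣p∣*∣q∣ ½ (w - w′)) (cong (_* ∣ w - w′ ∣) (ℚ.0≤p⇒∣p∣≡p 0≤½)))

riemann-refine : ∀ n {a w} → 1ℚ ≤ a → 0ℚ ≤ w →
                 ∣ riemann n a w - riemann (suc n) a w ∣ ≤ w * w * 2⁻ n
riemann-refine zero {a} {w} 1≤a 0≤w = ℚR.begin
  ∣ w * inv a - (½ * w * inv a + ½ * w * inv (a + ½ * w)) ∣
    ℚR.≡⟨ cong ∣_∣ (solve 3 (λ w x y → w :* x :- (con ½ :* w :* x :+ con ½ :* w :* y)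
                                := con ½ :* w :* (x :- y)) refl w (inv a) (inv (a + ½ * w))) ⟩
  ∣ ½ * w * (inv a - inv (a + ½ * w)) ∣
    ℚR.≡⟨ ℚ.∣p*q∣≡∣p∣*∣q∣ (½ * w) (inv a - inv (a + ½ * w)) ⟩
  ∣ ½ * w ∣ * ∣ inv a - inv (a + ½ * w) ∣
    ℚR.≤⟨ *-mono (ℚ.0≤∣p∣ (½ * w)) 0≤w ½w≤w (ℚ.≤-trans (inv-lipschitz 1≤a (1≤+ 1≤a (0≤½* 0≤w))) step≤w) ⟩
  w * w      ℚR.≡⟨ ℚ.*-identityʳ (w * w) ⟨
  w * w * 1ℚ ℚR.∎
  where
  ½w≤w : ∣ ½ * w ∣ ≤ w
  ½w≤w = subst (_≤ w) (sym (ℚ.0≤p⇒∣p∣≡p (0≤½* 0≤w))) (½*≤ 0≤w)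
  step≤w : ∣ a - (a + ½ * w) ∣ ≤ w
  step≤w = subst (_≤ w) (trans (sym (ℚ.∣-p∣≡∣p∣ (½ * w)))
    (cong ∣_∣ (solve 2 (λ a v → :- v := a :- (a :+ v)) refl a (½ * w)))) ½w≤w
riemann-refine (suc n) {a} {w} 1≤a 0≤w = ℚR.begin
  ∣ (riemann n a v + riemann n (a + v) v) - (riemann (suc n) a v + riemann (suc n) (a + v) v) ∣
    ℚR.≤⟨ ∣sum-diff∣ (riemann n a v) (riemann n (a + v) v) (riemann (suc n) a v) (riemann (suc n) (a + v) v) ⟩
  ∣ riemann n a v - riemann (suc n) a v ∣ + ∣ riemann n (a + v) v - riemann (suc n) (a + v) v ∣
    ℚR.≤⟨ ℚ.+-mono-≤ (riemann-refine n 1≤a (0≤½* 0≤w)) (riemann-refine n (1≤+ 1≤a (0≤½* 0≤w)) (0≤½* 0≤w)) ⟩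
  v * v * 2⁻ n + v * v * 2⁻ n
    ℚR.≡⟨ solve 2 (λ w h → (con ½ :* w) :* (con ½ :* w) :* h :+ (con ½ :* w) :* (con ½ :* w) :* h
             := w :* w :* (con ½ :* h)) refl w (2⁻ n) ⟩
  w * w * (½ * 2⁻ n) ℚR.∎
  where
  v : ℚ
  v = ½ * w

2ℚ : ℚ
2ℚ = 1ℚ + 1ℚ

riemann-tail : ∀ n k {a w} → 1ℚ ≤ a → 0ℚ ≤ w →
               ∣ riemann n a w - riemann (k ℕ.+ n) a w ∣ ≤ w * w * (2ℚ * 2⁻ n - 2ℚ * 2⁻ (k ℕ.+ n))
riemann-tail n zero {a} {w} 1≤a 0≤w = ℚ.≤-reflexive (trans
  (cong ∣_∣ (ℚ.+-inverseʳ (riemann n a w)))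
  (sym (trans (cong (w * w *_) (ℚ.+-inverseʳ (2ℚ * 2⁻ n))) (ℚ.*-zeroʳ (w * w)))))
riemann-tail n (suc k) {a} {w} 1≤a 0≤w = ℚR.begin
  ∣ riemann n a w - riemann (suc k ℕ.+ n) a w ∣
    ℚR.≤⟨ triangle (riemann n a w) (riemann (k ℕ.+ n) a w) (riemann (suc k ℕ.+ n) a w) ⟩
  ∣ riemann n a w - riemann (k ℕ.+ n) a w ∣ + ∣ riemann (k ℕ.+ n) a w - riemann (suc k ℕ.+ n) a w ∣
    ℚR.≤⟨ ℚ.+-mono-≤ (riemann-tail n k 1≤a 0≤w) (riemann-refine (k ℕ.+ n) 1≤a 0≤w) ⟩
  w * w * (2ℚ * 2⁻ n - 2ℚ * 2⁻ (k ℕ.+ n)) + w * w * 2⁻ (k ℕ.+ n)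
    ℚR.≡⟨ solve 3 (λ w x y → w :* w :* (con 2ℚ :* x :- con 2ℚ :* y) :+ w :* w :* y
             := w :* w :* (con 2ℚ :* x :- con 2ℚ :* (con ½ :* y))) refl w (2⁻ n) (2⁻ (k ℕ.+ n)) ⟩
  w * w * (2ℚ * 2⁻ n - 2ℚ * (½ * 2⁻ (k ℕ.+ n))) ℚR.∎

riemann-close : ∀ n m {a w} → n ℕ.≤ m → 1ℚ ≤ a → 0ℚ ≤ w →
                ∣ riemann n a w - riemann m a w ∣ ≤ w * w * (2ℚ * 2⁻ n)
riemann-close n m {a} {w} n≤m 1≤a 0≤w =
  subst (λ m → ∣ riemann n a w - riemann m a w ∣ ≤ w * w * (2ℚ * 2⁻ n)) (ℕ.m∸n+n≡m n≤m)
    (ℚ.≤-trans (riemann-tail n k 1≤a 0≤w)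
      (ℚ.*-monoˡ-≤-nonNeg (w * w) {{ℚ.nonNegative (0≤* 0≤w 0≤w)}}
        (subst (2ℚ * 2⁻ n - 2ℚ * 2⁻ (k ℕ.+ n) ≤_) (ℚ.+-identityʳ (2ℚ * 2⁻ n))
          (ℚ.+-monoʳ-≤ (2ℚ * 2⁻ n) (ℚ.neg-antimono-≤ (0≤* (ℚ.nonNegative⁻¹ 2ℚ) (0≤2⁻ (k ℕ.+ n))))))))
  where
  k : ℕ
  k = m ℕ.∸ n

riemann-lipschitz : ∀ n {a a′ w w′} → 1ℚ ≤ a → 1ℚ ≤ a′ → 0ℚ ≤ w → 0ℚ ≤ w′ →
  ∣ riemann n a w - riemann n a′ w′ ∣ ≤ ∣ w - w′ ∣ + w′ * ∣ a - a′ ∣ + ½ * w′ * ∣ w - w′ ∣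
riemann-lipschitz zero {a} {a′} {w} {w′} 1≤a 1≤a′ 0≤w 0≤w′ = ℚR.begin
  ∣ w * inv a - w′ * inv a′ ∣
    ℚR.≡⟨ cong ∣_∣ (cong₂ _-_ (ℚ.*-comm w (inv a)) (ℚ.*-comm w′ (inv a′))) ⟩
  ∣ inv a * w - inv a′ * w′ ∣
    ℚR.≤⟨ ∣prod-diff∣ (inv a) w (inv a′) w′ ⟩
  ∣ inv a ∣ * ∣ w - w′ ∣ + ∣ w′ ∣ * ∣ inv a - inv a′ ∣
    ℚR.≤⟨ ℚ.+-mono-≤
      (*-mono (ℚ.0≤∣p∣ (inv a)) (ℚ.0≤∣p∣ (w - w′)) (∣inv∣≤1 1≤a) ℚ.≤-refl)
      (*-mono (ℚ.0≤∣p∣ w′) (ℚ.0≤∣p∣ (a - a′)) (ℚ.≤-reflexive (ℚ.0≤p⇒∣p∣≡p 0≤w′)) (inv-lipschitz 1≤a 1≤a′)) ⟩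
  1ℚ * ∣ w - w′ ∣ + w′ * ∣ a - a′ ∣
    ℚR.≡⟨ cong (_+ w′ * ∣ a - a′ ∣) (ℚ.*-identityˡ ∣ w - w′ ∣) ⟩
  ∣ w - w′ ∣ + w′ * ∣ a - a′ ∣
    ℚR.≡⟨ ℚ.+-identityʳ (∣ w - w′ ∣ + w′ * ∣ a - a′ ∣) ⟨
  ∣ w - w′ ∣ + w′ * ∣ a - a′ ∣ + 0ℚ
    ℚR.≤⟨ ℚ.+-monoʳ-≤ (∣ w - w′ ∣ + w′ * ∣ a - a′ ∣) (0≤* (0≤½* 0≤w′) (ℚ.0≤∣p∣ (w - w′))) ⟩
  ∣ w - w′ ∣ + w′ * ∣ a - a′ ∣ + ½ * w′ * ∣ w - w′ ∣ ℚR.∎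
riemann-lipschitz (suc n) {a} {a′} {w} {w′} 1≤a 1≤a′ 0≤w 0≤w′ = ℚR.begin
  ∣ (riemann n a v + riemann n (a + v) v) - (riemann n a′ v′ + riemann n (a′ + v′) v′) ∣
    ℚR.≤⟨ ∣sum-diff∣ (riemann n a v) (riemann n (a + v) v) (riemann n a′ v′) (riemann n (a′ + v′) v′) ⟩
  ∣ riemann n a v - riemann n a′ v′ ∣ + ∣ riemann n (a + v) v - riemann n (a′ + v′) v′ ∣
    ℚR.≤⟨ ℚ.+-mono-≤ (riemann-lipschitz n 1≤a 1≤a′ 0≤v 0≤v′)
                     (riemann-lipschitz n (1≤+ 1≤a 0≤v) (1≤+ 1≤a′ 0≤v′) 0≤v 0≤v′) ⟩
  (D + v′ * E + ½ * v′ * D) + (D + v′ * E′ + ½ * v′ * D)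
    ℚR.≤⟨ ℚ.+-monoʳ-≤ (D + v′ * E + ½ * v′ * D) (ℚ.+-monoˡ-≤ (½ * v′ * D) (ℚ.+-monoʳ-≤ D
           (ℚ.*-monoˡ-≤-nonNeg v′ {{ℚ.nonNegative 0≤v′}} (∣sum-diff∣ a v a′ v′)))) ⟩
  (D + v′ * E + ½ * v′ * D) + (D + v′ * (E + D) + ½ * v′ * D)
    ℚR.≡⟨ cong (λ t → (t + v′ * E + ½ * v′ * t) + (t + v′ * (E + t) + ½ * v′ * t)) (∣½*-diff∣ w w′) ⟩
  (½ * F + v′ * E + ½ * v′ * (½ * F)) + (½ * F + v′ * (E + ½ * F) + ½ * v′ * (½ * F))
    ℚR.≡⟨ solve 3 (λ F E w → let v = con ½ :* w ; G = con ½ :* F in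
             (G :+ v :* E :+ con ½ :* v :* G) :+ (G :+ v :* (E :+ G) :+ con ½ :* v :* G)
             := F :+ w :* E :+ con ½ :* w :* F) refl F E w′ ⟩
  F + w′ * E + ½ * w′ * F ℚR.∎
  where
  v v′ D E E′ F : ℚ
  v  = ½ * w
  v′ = ½ * w′
  D  = ∣ v - v′ ∣
  E  = ∣ a - a′ ∣
  E′ = ∣ (a + v) - (a′ + v′) ∣
  F  = ∣ w - w′ ∣
  0≤v : 0ℚ ≤ v
  0≤v = 0≤½* 0≤w
  0≤v′ : 0ℚ ≤ v′
  0≤v′ = 0≤½* 0≤w′

⊔-lipschitz : ∀ a b c → ∣ (a ⊔ c) - (b ⊔ c) ∣ ≤ ∣ a - b ∣
⊔-lipschitz a b c = by-cases (ℚ.≤-total a b)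
  where
  ordered : ∀ {a b} → a ≤ b → (b ⊔ c) - (a ⊔ c) ≤ b - a
  ordered {a} {b} a≤b = sub (ℚ.≤-total b c)
    where
    sub : (b ≤ c) ⊎ (c ≤ b) → (b ⊔ c) - (a ⊔ c) ≤ b - a
    sub (inj₁ b≤c) = ℚ.≤-trans (ℚ.≤-reflexive (trans
        (cong₂ _-_ (ℚ.p≤q⇒p⊔q≡q b≤c) (ℚ.p≤q⇒p⊔q≡q (ℚ.≤-trans a≤b b≤c))) (ℚ.+-inverseʳ c)))
      (subst (_≤ b - a) (ℚ.+-inverseʳ a) (ℚ.+-monoˡ-≤ (- a) a≤b))
    sub (inj₂ c≤b) = subst (λ t → t - (a ⊔ c) ≤ b - a) (sym (ℚ.p≥q⇒p⊔q≡p c≤b))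
      (ℚ.+-monoʳ-≤ b (ℚ.neg-antimono-≤ (ℚ.p≤p⊔q a c)))
  abs : ∀ {a b} → a ≤ b → ∣ (b ⊔ c) - (a ⊔ c) ∣ ≤ ∣ b - a ∣
  abs {a} {b} a≤b = subst (_≤ ∣ b - a ∣) (sym (ℚ.0≤p⇒∣p∣≡p 0≤)) (ℚ.≤-trans (ordered a≤b) (≤∣∣ (b - a)))
    where
    0≤ : 0ℚ ≤ (b ⊔ c) - (a ⊔ c)
    0≤ = subst (_≤ (b ⊔ c) - (a ⊔ c)) (ℚ.+-inverseʳ (a ⊔ c)) (ℚ.+-monoˡ-≤ (- (a ⊔ c)) (ℚ.⊔-mono-≤ a≤b (ℚ.≤-refl {c})))
  by-cases : (a ≤ b) ⊎ (b ≤ a) → ∣ (a ⊔ c) - (b ⊔ c) ∣ ≤ ∣ a - b ∣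
  by-cases (inj₁ a≤b) = subst₂ _≤_ (∣-∣-swap (b ⊔ c) (a ⊔ c)) (∣-∣-swap b a) (abs a≤b)
  by-cases (inj₂ b≤a) = abs b≤a

module Log (x : ℝ) where
  width : ℕ → ℚ
  width n = (seq x n ⊔ 1ℚ) - 1ℚ

  approx : ℕ → ℚ
  approx n = riemann n 1ℚ (width n)

  0≤width : ∀ n → 0ℚ ≤ width n
  0≤width n = ℚ.+-monoˡ-≤ (- 1ℚ) (ℚ.p≤q⊔p (seq x n) 1ℚ)

  width-diff : ∀ m n → ∣ width m - width n ∣ ≤ ∣ seq x m - seq x n ∣
  width-diff m n = subst (_≤ ∣ seq x m - seq x n ∣)
    (cong ∣_∣ (solve 2 (λ a b → a :- b := (a :- con 1ℚ) :- (b :- con 1ℚ)) refl (seq x m ⊔ 1ℚ) (seq x n ⊔ 1ℚ)))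
    (⊔-lipschitz (seq x m) (seq x n) 1ℚ)

  width≤ : ∀ n B → ∣ seq x n ∣ ≤ B → width n ≤ B + 1ℚ
  width≤ n B x≤B = ℚ.≤-trans (≤∣∣ (width n)) (ℚ.≤-trans (⊔-lipschitz (seq x n) 1ℚ 1ℚ)
    (ℚ.≤-trans (ℚ.∣p-q∣≤∣p∣+∣q∣ (seq x n) 1ℚ) (ℚ.+-monoˡ-≤ 1ℚ x≤B)))

  level-diff : ∀ K m n W ε → K ℕ.≤ m → K ℕ.≤ n → width n ≤ W →
               W * W * 2ℚ * 2⁻ K ≤ ε → ∣ riemann m 1ℚ (width n) - riemann n 1ℚ (width n) ∣ ≤ ε + ε
  level-diff K m n W ε K≤m K≤n w≤W small = ℚ.≤-trans
    (triangle (riemann m 1ℚ w) (riemann K 1ℚ w) (riemann n 1ℚ w))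
    (ℚ.+-mono-≤
      (ℚ.≤-trans (ℚ.≤-reflexive (∣-∣-swap (riemann m 1ℚ w) (riemann K 1ℚ w))) (bound m K≤m))
      (bound n K≤n))
    where
    w : ℚ
    w = width n
    0≤w : 0ℚ ≤ w
    0≤w = 0≤width n
    bound : ∀ j → K ℕ.≤ j → ∣ riemann K 1ℚ w - riemann j 1ℚ w ∣ ≤ ε
    bound j K≤j = ℚ.≤-trans (riemann-close K j K≤j ℚ.≤-refl 0≤w) (ℚ.≤-trans
      (subst (_≤ W * W * 2ℚ * 2⁻ K) (ℚ.*-assoc (w * w) 2ℚ (2⁻ K))
        (ℚ.*-monoʳ-≤-nonNeg (2⁻ K) {{ℚ.nonNegative (0≤2⁻ K)}} (ℚ.*-monoʳ-≤-nonNeg 2ℚ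
          (*-mono 0≤w (ℚ.≤-trans 0≤w w≤W) w≤W w≤W)))) small)

  value-diff : ∀ m n W δ → width n ≤ W → ∣ seq x m - seq x n ∣ ≤ δ →
               ∣ riemann m 1ℚ (width m) - riemann m 1ℚ (width n) ∣ ≤ (1ℚ + ½ * W) * δ
  value-diff m n W δ w≤W xmn≤δ = ℚR.begin
    ∣ riemann m 1ℚ (width m) - riemann m 1ℚ (width n) ∣
      ℚR.≤⟨ riemann-lipschitz m ℚ.≤-refl ℚ.≤-refl (0≤width m) (0≤width n) ⟩
    D + width n * 0ℚ + ½ * width n * D
      ℚR.≡⟨ solve 2 (λ D w → D :+ w :* con 0ℚ :+ con ½ :* w :* D := (con 1ℚ :+ con ½ :* w) :* D) refl D (width n) ⟩
    (1ℚ + ½ * width n) * D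
      ℚR.≤⟨ *-mono (0≤+ 0≤1 (0≤½* (0≤width n))) (ℚ.≤-trans (ℚ.0≤∣p∣ _) xmn≤δ)
             (ℚ.+-monoʳ-≤ 1ℚ (ℚ.*-monoˡ-≤-nonNeg ½ w≤W)) (ℚ.≤-trans (width-diff m n) xmn≤δ) ⟩
    (1ℚ + ½ * W) * δ ℚR.∎
    where
    D : ℚ
    D = ∣ width m - width n ∣

  approx-cauchy : IsCauchy approx
  approx-cauchy ε 0<ε =
    let ε₂ = ½ * ε
        ε₄ = ½ * ε₂
        (B , 0<B , Nb , x≤B) = bounded x
        W = B + 1ℚ
        0<W = ℚ.+-mono-< 0<B (ℚ.positive⁻¹ 1ℚ)
        0<L = ℚ.+-mono-<-≤ (ℚ.positive⁻¹ 1ℚ) (0≤½* (ℚ.<⇒≤ 0<W))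
        (δ , 0<δ , Lδ≡) = split (0<½* 0<ε) 0<L
        (Nx , xs) = cauchy x δ 0<δ
        (K , small) = 2⁻-small (W * W * 2ℚ) ε₄ (0<* (0<* 0<W 0<W) (ℚ.positive⁻¹ 2ℚ)) (0<½* (0<½* 0<ε))
    in (Nb ℕ.⊔ Nx) ℕ.⊔ K , λ m n hm hn →
      let w≤W = width≤ n B (x≤B n (≤⊔ˡ (≤⊔ˡ hn)))
          b = ∣ riemann m 1ℚ (width m) - riemann m 1ℚ (width n) ∣
          c = ∣ riemann m 1ℚ (width n) - riemann n 1ℚ (width n) ∣
      in ≤-halves b c ε
        (triangle (riemann m 1ℚ (width m)) (riemann m 1ℚ (width n)) (riemann n 1ℚ (width n)))
        (subst (b ≤_) Lδ≡ (value-diff m n W δ w≤W (xs m n (≤⊔ʳ {Nb} (≤⊔ˡ hm)) (≤⊔ʳ {Nb} (≤⊔ˡ hn)))))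
        (subst (c ≤_) (halves ε₂)
          (level-diff K m n W ε₄ (≤⊔ʳ {Nb ℕ.⊔ Nx} hm) (≤⊔ʳ {Nb ℕ.⊔ Nx} hn) w≤W small))

-- ∫ dt/t from 1 to x, for x ≥ 1. Below 1 the upper limit is clamped, so log x = 0 there;
-- log p and log (log p) are unaffected for p ≥ 3, as log 3 > 1.
log : ℝ → ℝ
seq    (log x) = Log.approx x
cauchy (log x) = Log.approx-cauchy x

[1⋯_] : ℕ → List ℕ
[1⋯ n ] = applyUpTo suc n

φ : ℕ → ℕ
φ n = length (filter (λ k → ℕ.coprime? k n) [1⋯ n ])

γ : ℕ → ℕ
γ d = max 0 (map φ (filter (_∣? d) [1⋯ d ]))

γ-nonZero : ∀ d .{{_ : ℕ.NonZero d}} → ℕ.NonZero (γ d)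
γ-nonZero d@(suc _) = ℕ.>-nonZero (v≤max⁺ 0 (map φ (filter (_∣? d) [1⋯ d ]))
  (inj₂ (lose (∈-map⁺ φ (∈-filter⁺ (_∣? d) (here refl) (1∣ d))) ℕ.≤-refl)))

record DirichletCharacter (q : ℕ) : Set where
  field
    χ        : ℤ → ℂ
    χ-1      : χ (+ 1) ≃ᶜ 1ᶜ
    χ-*      : ∀ a b → χ (a ℤ.* b) ≃ᶜ χ a *ᶜ χ b
    periodic : ∀ a → χ (a ℤ.+ + q) ≃ᶜ χ a
    vanishes : ∀ a → ¬ Coprime a (+ q) → χ a ≃ᶜ 0ᶜ

open DirichletCharacter public

IsOddCharacter : ∀ {q} → DirichletCharacter q → Set
IsOddCharacter X = χ X (ℤ.- (+ 1)) ≃ᶜ -ᶜ 1ᶜ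

-- X ^ j is the principal character; off the units both vanish for j > 0.
IsPrincipal^ : ∀ {q} → DirichletCharacter q → ℕ → Set
IsPrincipal^ {q} X j = ∀ a → Coprime a (+ q) → χ X a ^ᶜ j ≃ᶜ 1ᶜ

record HasOrder {q : ℕ} (X : DirichletCharacter q) (m : ℕ) : Set where
  field
    .{{nonZero}} : ℕ.NonZero m
    principal    : IsPrincipal^ X m
    minimal      : ∀ j → 0 ℕ.< j → j ℕ.< m → ¬ IsPrincipal^ X j

-- Equality in ℂ is undecidable, but the values of a character of finite order are
-- zero or roots of unity of bounded order, which can be told apart.
χ-≟ : ∀ {q m} (X : DirichletCharacter q) → HasOrder X m → ∀ a b → Dec (χ X a ≃ᶜ χ X b)
χ-≟ {q} {m} X ord a b = cases (coprime? a (+ q)) (coprime? b (+ q))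
  where
  open HasOrder ord
  open Setoid ≃ᶜ-setoid using () renaming (sym to ≃-sym; trans to ≃-trans)
  cases : Dec (Coprime a (+ q)) → Dec (Coprime b (+ q)) → Dec (χ X a ≃ᶜ χ X b)
  cases (yes ca) (yes cb) = ℂ-roots.roots-≟ m (principal a ca) (principal b cb)
  cases (yes ca) (no ¬cb) = no (ℂ-roots.root≄0 m (principal a ca) (vanishes X b ¬cb))
  cases (no ¬ca) (yes cb) =
    no λ e → ℂ-roots.root≄0 m (principal b cb) (vanishes X a ¬ca) (≃-sym e)
  cases (no ¬ca) (no ¬cb) = yes (≃-trans (vanishes X a ¬ca) (≃-sym (vanishes X b ¬cb)))

-- #{(n₁, n₂) : 1 ≤ n₁, n₂ ≤ N, χ(n₁) = χ(n₂)}
agreements : ∀ {q m} (X : DirichletCharacter q) → HasOrder X m → ℕ → ℕ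
agreements X ord N = length (filter (λ (n₁ , n₂) → χ-≟ X ord (+ n₁) (+ n₂))
                                    (cartesianProduct [1⋯ N ] [1⋯ N ]))

𝒜 : ∀ {p m} → Prime p → (X : DirichletCharacter p) → HasOrder X m → ℚ
𝒜 {p} p-prime X ord = (+ sum (map (agreements X ord) [1⋯ p ℕ.∸ 1 ]) ℚ./ (p ℕ.∸ 1)) {{p∸1≢0}}
  where
  p∸1≢0 : ℕ.NonZero (p ℕ.∸ 1)
  p∸1≢0 = ℕ.>-nonZero (ℕ.m<n⇒0<n∸m (ℕ.nonTrivial⇒n>1 p {{prime⇒nonTrivial p-prime}}))

mainTerm : (p d : ℕ) → ℚ
mainTerm p d = (+ (2 ℕ.* d ℕ.+ 1) ℚ./ 6) * fromℕ p

{-# OPTIONS --safe #-}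

-- Let H be the kernel of χ. Orthogonality of the powers of χ gives |H| = d, so every h ∈ H
-- satisfies h^d = 1. Counting N ≥ max(n₁, n₂) first,
--   Σ_N #{…} = Σ_{h ∈ H} Σ_{1≤n<p} (p - max(n, hn mod p)),
-- where h = 1 contributes p(p-1)/2, and for h ≠ 1 the inner sum is p²/3 + O(p² / Y), with Y the
-- sup norm of a short vector of the lattice {(x, y) : y ≡ hx mod p}. Indeed the sums over the
-- translated lines v = hu + e change by at most 2p when e moves by 1 or h, they are p²/3 on
-- average, and with the short vector every e is reached from 0 in O(p / Y) such moves.
-- If h has order k > 1, a short vector (Y, x) makes p a divisor of Φ_k(Y, x), and
-- 0 < |Φ_k(Y, x)| ≤ (CY)^φ(k) ≤ (CY)^γ(d), so that p / Y = O(p^(1-1/γ(d))).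
-- The integer Φ_k(Y, x) enters as the quotient of Y^k - x^k by the lcm of the Y^(k/q) - x^(k/q)
-- for q ∣ k prime.

module Submission where

-- The crux is that C in |Φ_k(Y, x)| ≤ (CY)^φ(k) must not depend on k. No complex roots are used to
-- factor Φ_k: it is an alternating product of 2^|S| values |Y^i - x^i|, where S is the set of
-- primes dividing k. Each value is Y^i times a common factor |Y - x| / Y, which cancels, up to a
-- relative error of at most 2i. These errors multiply to at most (2k)^(2^|S|), and it is the
-- oddness of k that tames the exponent 2^|S|: it divides ∏(q - 1), leaving ∏(q - 1)/2, and this
-- product is large enough to pay for the logarithm of ∏q. The total error is at most 2^(9 φ(k)),
-- which gives C = 512. Oddness enters twice more: in the lower bound for |Y^i - x^i| when x is
-- negative, and in excluding h = -1, whose short vector would have |x| = Y. On the side of the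
-- characters the obstacle is that equality in ℂ is undecidable. Only zeros and roots of unity are
-- ever compared, and a division by z - 1 is replaced by summing the powers of z and dividing by a
-- positive integer.

-- Primitive parts of strong divisibility sequences.

module PrimitiveParts where

  open import Data.List.Base using (List; []; _∷_)
  open import Data.List.Relation.Unary.All using (All; []; _∷_)
  open import Data.List.Relation.Unary.AllPairs using ([]; _∷_)
  open import Data.Nat.Base
  open import Data.Nat.Divisibility
  open import Data.Nat.GCD
  open import Data.Nat.LCM
  open import Data.Nat.ListAction using (product)
  open import Data.Nat.Primality
  open import Data.Nat.Properties
  open import Data.Nat.Tactic.RingSolver using (solve-∀)
  open import Data.Product.Base using (_,_)
  open import Data.Sum.Base using (inj₁; inj₂)
  open import Relation.Binary.PropositionalEquality
  open import Relation.Nullary using (¬_; contradiction)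

  *-nonZero : ∀ m {n} .{{_ : NonZero m}} → NonZero n → NonZero (m * n)
  *-nonZero m {n} n≢0 = m*n≢0 m n
    where
    instance
      n≢0′ : NonZero n
      n≢0′ = n≢0

  -- Multiplication distributes over gcd, so the four products together have gcd a b * gcd c d as
  -- their gcd.
  ∣gcd*gcd : ∀ {e} a b c d → e ∣ a * c → e ∣ b * c → e ∣ a * d → e ∣ b * d → e ∣ gcd a b * gcd c d
  ∣gcd*gcd {e} a b c d e∣ac e∣bc e∣ad e∣bd =
    subst (e ∣_) (sym (c*gcd[m,n]≡gcd[cm,cn] (gcd a b) c d)) (gcd-greatest (part c e∣ac e∣bc) (part d e∣ad e∣bd))
    where
    part : ∀ c → e ∣ a * c → e ∣ b * c → e ∣ gcd a b * c
    part c e∣ac e∣bc = subst (e ∣_) (trans (sym (c*gcd[m,n]≡gcd[cm,cn] c a b)) (*-comm c (gcd a b)))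
      (gcd-greatest (subst (e ∣_) (*-comm a c) e∣ac) (subst (e ∣_) (*-comm b c) e∣bc))

  -- With g = gcd a (gcd b c), the claim follows from
  -- gcd a (lcm b c) * g ∣ gcd a b * gcd a c, where the right side is the gcd of aa, ab, ac, bc.
  gcd-distribˡ-lcm : ∀ a b c .{{_ : NonZero a}} → gcd a (lcm b c) ≡ lcm (gcd a b) (gcd a c)
  gcd-distribˡ-lcm a b c = ∣-antisym
    (*-cancelʳ-∣ g {{g≢0}} (subst (e * g ∣_) (sym split) (∣gcd*gcd a b a c eg∣aa eg∣ba eg∣ac eg∣bc)))
    (lcm-least
      (gcd-greatest (gcd[m,n]∣m a b) (∣-trans (gcd[m,n]∣n a b) (m∣lcm[m,n] b c)))
      (gcd-greatest (gcd[m,n]∣m a c) (∣-trans (gcd[m,n]∣n a c) (n∣lcm[m,n] b c))))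
    where
    e g : ℕ
    e = gcd a (lcm b c)
    g = gcd a (gcd b c)
    g≢0 : NonZero g
    g≢0 = ≢-nonZero λ g≡0 → ≢-nonZero⁻¹ a (gcd[m,n]≡0⇒m≡0 {a} g≡0)
    g≡ : gcd (gcd a b) (gcd a c) ≡ g
    g≡ = ∣-antisym
      (gcd-greatest (∣-trans (gcd[m,n]∣m (gcd a b) _) (gcd[m,n]∣m a b))
        (gcd-greatest (∣-trans (gcd[m,n]∣m (gcd a b) _) (gcd[m,n]∣n a b))
                      (∣-trans (gcd[m,n]∣n (gcd a b) _) (gcd[m,n]∣n a c))))
      (gcd-greatest
        (gcd-greatest (gcd[m,n]∣m a _) (∣-trans (gcd[m,n]∣n a _) (gcd[m,n]∣m b c)))
        (gcd-greatest (gcd[m,n]∣m a _) (∣-trans (gcd[m,n]∣n a _) (gcd[m,n]∣n b c))))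
    split : lcm (gcd a b) (gcd a c) * g ≡ gcd a b * gcd a c
    split = trans (*-comm l g) (trans (cong (_* l) (sym g≡)) (gcd*lcm (gcd a b) (gcd a c)))
      where
      l : ℕ
      l = lcm (gcd a b) (gcd a c)
    e∣a : e ∣ a
    e∣a = gcd[m,n]∣m a (lcm b c)
    g∣a : g ∣ a
    g∣a = gcd[m,n]∣m a (gcd b c)
    eg∣aa : e * g ∣ a * a
    eg∣aa = *-pres-∣ e∣a g∣a
    eg∣ba : e * g ∣ b * a
    eg∣ba = subst (e * g ∣_) (*-comm a b) (*-pres-∣ e∣a (∣-trans (gcd[m,n]∣n a _) (gcd[m,n]∣m b c)))
    eg∣ac : e * g ∣ a * c
    eg∣ac = *-pres-∣ e∣a (∣-trans (gcd[m,n]∣n a _) (gcd[m,n]∣n b c))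
    eg∣bc : e * g ∣ b * c
    eg∣bc = subst (e * g ∣_) (trans (*-comm (lcm b c) _) (gcd*lcm b c))
      (*-pres-∣ (gcd[m,n]∣n a (lcm b c)) (gcd[m,n]∣n a (gcd b c)))

  odd-* : ∀ {m n} → ¬ 2 ∣ m → ¬ 2 ∣ n → ¬ 2 ∣ m * n
  odd-* {m} {n} 2∤m 2∤n 2∣mn with euclidsLemma m n prime[2] 2∣mn
  ... | inj₁ 2∣m = 2∤m 2∣m
  ... | inj₂ 2∣n = 2∤n 2∣n

  odd⇒nonZero : ∀ {n} → ¬ 2 ∣ n → NonZero n
  odd⇒nonZero {zero}  2∤0 = contradiction (2 ∣0) 2∤0
  odd⇒nonZero {suc n} _   = _

  prime-gcd : ∀ {p q} → Prime p → Prime q → ¬ p ≡ q → gcd p q ≡ 1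
  prime-gcd {p} {q} pp pq p≢q with prime⇒irreducible pp (gcd[m,n]∣m p q)
  ... | inj₁ g≡1 = g≡1
  ... | inj₂ g≡p with prime⇒irreducible pq (subst (_∣ q) g≡p (gcd[m,n]∣n p q))
  ...   | inj₁ refl = contradiction pp ¬prime[1]
  ...   | inj₂ p≡q = contradiction p≡q p≢q

  module PrimitivePart
    (a : ℕ → ℕ)
    (a≢0 : ∀ j .{{_ : NonZero j}} → NonZero (a j))
    (gcd-a : ∀ m n .{{_ : NonZero m}} → gcd (a m) (a n) ≡ a (gcd m n))
    where

    a-∣ : ∀ m n .{{_ : NonZero m}} → m ∣ n → a m ∣ a n
    a-∣ m n m∣n = subst (_∣ a n) (trans (gcd-a m n) (cong a gcd≡m)) (gcd[m,n]∣n (a m) (a n))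
      where
      gcd≡m : gcd m n ≡ m
      gcd≡m = ∣-antisym (gcd[m,n]∣m m n) (gcd-greatest ∣-refl m∣n)

    -- The lcm of the a (j * P / q) for q ∈ S, where P = product S.
    L : List ℕ → ℕ → ℕ
    L []      j = 1
    L (q ∷ S) j = lcm (a (j * product S)) (L S (j * q))

    *-swapʳ : ∀ a b c → a * b * c ≡ a * c * b
    *-swapʳ = solve-∀

    L-∣ : ∀ S j .{{_ : NonZero j}} → All Prime S → L S j ∣ a (j * product S)
    L-∣ []      j []         = 1∣ _
    L-∣ (q ∷ S) j (pq ∷ pS) = lcm-least
      (a-∣ (j * product S) (j * product (q ∷ S)) {{*-nonZero j (productOfPrimes≢0 pS)}}
        (*-monoʳ-∣ j (n∣m*n q)))
      (subst (λ t → L S (j * q) ∣ a t) (*-assoc j q (product S))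
        (L-∣ S (j * q) {{*-nonZero j (prime⇒nonZero pq)}} pS))

    -- If S consists of all primes of k = j * product S and a n = |Y^n - x^n|, this is |Φ_k(Y, x)|.
    -- For smaller S it is the alternating product that arises when only the primes of S have been
    -- sieved out, which is what an induction on S needs.
    G : ∀ S j .{{_ : NonZero j}} → All Prime S → ℕ
    G S j pS = quotient (L-∣ S j pS)

    G*L : ∀ S j .{{_ : NonZero j}} (pS : All Prime S) → a (j * product S) ≡ G S j pS * L S j
    G*L S j pS = _∣_.equality (L-∣ S j pS)

    -- Distribute gcd over the lcm: the entry for r ∈ S becomes the value of `a` at the gcd of j P
    -- and j q P / r, with P = product S, and this gcd is j P / r because q ≠ r are primes. Needed
    -- to evaluate the lcm in `G-step`.
    gcd-L : ∀ S j q .{{_ : NonZero j}} → Prime q → All Prime S → All (λ r → ¬ q ≡ r) S →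
            gcd (a (j * product S)) (L S (j * q)) ≡ L S j
    gcd-L []      j q pq []        []           = gcd-zeroʳ (a (j * 1))
    gcd-L (r ∷ S) j q pq (pr ∷ pS) (q≢r ∷ q∉S) = begin
      gcd (a (j * (r * product S))) (lcm (a (j * q * product S)) (L S (j * q * r)))
        ≡⟨ gcd-distribˡ-lcm (a (j * (r * product S))) _ _ {{a≢0 _}} ⟩
      lcm (gcd (a (j * (r * product S))) (a (j * q * product S))) (gcd (a (j * (r * product S))) (L S (j * q * r)))
        ≡⟨ cong₂ lcm
             (trans (gcd-a _ _) (cong a (trans
               (cong₂ gcd (swap j r (product S)) (*-swapʳ j q (product S)))
               (trans (sym (c*gcd[m,n]≡gcd[cm,cn] (j * product S) r q))
                 (trans (cong (j * product S *_) (prime-gcd pr pq (λ r≡q → q≢r (sym r≡q)))) (*-identityʳ _))))))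
             (trans (cong₂ gcd (cong a (sym (*-assoc j r (product S)))) (cong (L S) (*-swapʳ j q r)))
               (gcd-L S (j * r) q {{*-nonZero j (prime⇒nonZero pr)}} pq pS q∉S)) ⟩
      lcm (a (j * product S)) (L S (j * r)) ∎
      where
      open ≡-Reasoning
      instance
        S≢0 : NonZero (product S)
        S≢0 = productOfPrimes≢0 pS
        r≢0 : NonZero r
        r≢0 = prime⇒nonZero pr
        rS≢0 : NonZero (r * product S)
        rS≢0 = m*n≢0 r (product S)
        jrS≢0 : NonZero (j * (r * product S))
        jrS≢0 = m*n≢0 j (r * product S)
      swap : ∀ j r s → j * (r * s) ≡ j * s * r
      swap = solve-∀

    a≢0⇒L≢0 : ∀ S j .{{_ : NonZero j}} → All Prime S → NonZero (L S j)
    a≢0⇒L≢0 S j pS = ≢-nonZero λ L≡0 →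
      ≢-nonZero⁻¹ (a (j * product S)) {{a≢0 _ {{*-nonZero j (productOfPrimes≢0 pS)}}}}
        (0∣⇒≡0 (subst (_∣ a (j * product S)) L≡0 (L-∣ S j pS)))

    -- The counterpart of Φ_nq(z) Φ_n(z) = Φ_n(z^q) for a prime q not dividing n. The lcm defining
    -- `L (q ∷ S) j` is A * L₁ divided by gcd A L₁, and `gcd-L` identifies that gcd as `L S j`.
    G-step : ∀ q S j .{{_ : NonZero j}} .{{_ : NonZero (j * q)}} (pq : Prime q) (pS : All Prime S) → All (λ r → ¬ q ≡ r) S →
             G (q ∷ S) j (pq ∷ pS) * G S j pS ≡ G S (j * q) pS
    G-step q S j pq pS q∉S = *-cancelʳ-≡ _ _ (A * L₁) {{m*n≢0 A L₁}} (begin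
      g * g₀ * (A * L₁) ≡⟨ cong (g * g₀ *_) (gcd*lcm A L₁) ⟨
      g * g₀ * (gcd A L₁ * lcm A L₁) ≡⟨ cong (λ t → g * g₀ * (t * lcm A L₁)) (gcd-L S j q pq pS q∉S) ⟩
      g * g₀ * (L S j * lcm A L₁) ≡⟨ shuffle g g₀ (L S j) (lcm A L₁) ⟩
      (g * lcm A L₁) * (g₀ * L S j) ≡⟨ cong₂ _*_ (G*L (q ∷ S) j (pq ∷ pS)) (G*L S j pS) ⟨
      a (j * (q * product S)) * A ≡⟨ cong (λ t → a t * A) (*-assoc j q (product S)) ⟨
      a (j * q * product S) * A ≡⟨ cong (_* A) (G*L S (j * q) pS) ⟩
      G S (j * q) pS * L₁ * A ≡⟨ shuffle′ (G S (j * q) pS) L₁ A ⟩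
      G S (j * q) pS * (A * L₁) ∎)
      where
      open ≡-Reasoning
      g g₀ A L₁ : ℕ
      g  = G (q ∷ S) j (pq ∷ pS)
      g₀ = G S j pS
      A  = a (j * product S)
      L₁ = L S (j * q)
      instance
        A≢0 : NonZero A
        A≢0 = a≢0 _ {{*-nonZero j (productOfPrimes≢0 pS)}}
        L₁≢0 : NonZero L₁
        L₁≢0 = a≢0⇒L≢0 S (j * q) pS
      shuffle : ∀ g g₀ l m → g * g₀ * (l * m) ≡ (g * m) * (g₀ * l)
      shuffle = solve-∀
      shuffle′ : ∀ g l m → g * l * m ≡ g * (m * l)
      shuffle′ = solve-∀

    G≢0 : ∀ S j .{{_ : NonZero j}} (pS : All Prime S) → NonZero (G S j pS)
    G≢0 S j pS = ≢-nonZero λ G≡0 →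
      ≢-nonZero⁻¹ (a (j * product S)) {{a≢0 _ {{*-nonZero j (productOfPrimes≢0 pS)}}}}
        (trans (G*L S j pS) (cong (_* L S j) G≡0))

    -- p divides a n but no a (n / q), so it survives in the quotient by their lcm.
    p∣G : ∀ {p} S j .{{_ : NonZero j}} (pS : All Prime S) → Prime p →
          p ∣ a (j * product S) → (∀ i .{{_ : NonZero i}} → i < j * product S → ¬ p ∣ a i) → p ∣ G S j pS
    p∣G {p} S j pS pp p∣a p∤a with euclidsLemma (G S j pS) (L S j) pp (subst (p ∣_) (G*L S j pS) p∣a)
    ... | inj₁ p∣G = p∣G
    ... | inj₂ p∣L = contradiction p∣L (p∤L S j pS p∤a)
      where
      p∤L : ∀ S j .{{_ : NonZero j}} (pS : All Prime S) →
            (∀ i .{{_ : NonZero i}} → i < j * product S → ¬ p ∣ a i) → ¬ p ∣ L S j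
      p∤L []      j []        p∤a p∣1 = contradiction (subst Prime (∣1⇒≡1 p∣1) pp) ¬prime[1]
      p∤L (q ∷ S) j (pq ∷ pS) p∤a p∣l with
        euclidsLemma (a (j * product S)) (L S (j * q)) pp
          (subst (p ∣_) (gcd*lcm (a (j * product S)) _) (∣n⇒∣m*n (gcd (a (j * product S)) (L S (j * q))) p∣l))
      ... | inj₁ p∣a = p∤a (j * product S) {{*-nonZero j (productOfPrimes≢0 pS)}}
        (*-monoʳ-< j (subst (product S <_) (*-comm (product S) q)
          (m<m*n (product S) q {{productOfPrimes≢0 pS}} (nonTrivial⇒n>1 q {{prime⇒nonTrivial pq}})))) p∣a
      ... | inj₂ p∣L = p∤L S (j * q) {{*-nonZero j (prime⇒nonZero pq)}} pS
        (λ i i< → p∤a i (subst (i <_) (*-assoc j q (product S)) i<)) p∣L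

-- The sequence |Y^n - x^n|: gcds and size.

module PowerDifferences where
  open import Data.Integer.Base as ℤ using (ℤ; +_; -[1+_])
  import Data.Integer.Divisibility.Signed as ℤ
  import Data.Integer.Properties as ℤ
  import Data.Integer.Tactic.RingSolver as ℤ
  open import Data.Nat.Base
  open import Data.Nat.Coprimality using (Coprime; coprime-divisor)
  open import Data.Nat.Divisibility
  open import Data.Nat.GCD
  open import Data.Nat.Properties
  open import Data.Nat.Tactic.RingSolver using (solve-∀)
  open import Data.Product.Base using (_,_; ∃-syntax)
  open import Relation.Binary.PropositionalEquality
  open import Relation.Nullary using (¬_; contradiction)

  coprime-^ : ∀ {m n} k → Coprime m n → Coprime m (n ^ k)
  coprime-^ zero    c (_ , e∣1) = ∣1⇒≡1 e∣1
  coprime-^ {m} {n} (suc k) c {e} (e∣m , e∣nnᵏ) = coprime-^ k c (e∣m , coprime-divisor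
    (λ (f∣e , f∣n) → c (∣-trans f∣e e∣m , f∣n)) e∣nnᵏ)

  abs-^ : ∀ i n → ℤ.∣ i ℤ.^ n ∣ ≡ ℤ.∣ i ∣ ^ n
  abs-^ i zero    = refl
  abs-^ i (suc n) = trans (ℤ.abs-* i (i ℤ.^ n)) (cong (ℤ.∣ i ∣ *_) (abs-^ i n))

  odd⇒half : ∀ n → ¬ 2 ∣ n → ∃[ k ] n ≡ suc (k + k)
  odd⇒half zero          2∤0 = contradiction (2 ∣0) 2∤0
  odd⇒half (suc zero)    _   = 0 , refl
  odd⇒half (suc (suc n)) 2∤n with odd⇒half n (λ 2∣n → 2∤n (∣m∣n⇒∣m+n ∣-refl 2∣n))
  ... | k , refl = suc k , cong suc (cong suc (sym (+-suc k k)))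

  0≤i² : ∀ i → + 0 ℤ.≤ i ℤ.* i
  0≤i² (+ n)    = subst (+ 0 ℤ.≤_) (ℤ.pos-* n n) (ℤ.+≤+ z≤n)
  0≤i² -[1+ n ] = ℤ.+≤+ z≤n

  0≤i*j : ∀ {i j} → + 0 ℤ.≤ i → + 0 ℤ.≤ j → + 0 ℤ.≤ i ℤ.* j
  0≤i*j {+ m} {+ n} _ _ = subst (+ 0 ℤ.≤_) (ℤ.pos-* m n) (ℤ.+≤+ z≤n)

  i≤∣i∣ : ∀ i → i ℤ.≤ + ℤ.∣ i ∣
  i≤∣i∣ (+ n)    = ℤ.≤-refl
  i≤∣i∣ -[1+ n ] = ℤ.-≤+

  module Difference (Y : ℕ) (x : ℤ) (∣x∣<Y : ℤ.∣ x ∣ < Y) (coprime : Coprime Y ℤ.∣ x ∣) where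

    y : ℤ
    y = + Y

    δ : ℕ → ℤ
    δ j = y ℤ.^ j ℤ.- x ℤ.^ j

    D : ℕ → ℕ
    D j = ℤ.∣ δ j ∣

    Y>0 : 0 < Y
    Y>0 = ≤-<-trans z≤n ∣x∣<Y

    instance
      Y≢0 : NonZero Y
      Y≢0 = >-nonZero Y>0

    y^ : ∀ j → y ℤ.^ j ≡ + (Y ^ j)
    y^ zero    = refl
    y^ (suc j) = trans (cong (y ℤ.*_) (y^ j)) (sym (ℤ.pos-* Y (Y ^ j)))

    ∣x^∣≤ : ∀ j → ℤ.∣ x ℤ.^ j ∣ ≤ Y ^ j
    ∣x^∣≤ j = subst (_≤ Y ^ j) (sym (abs-^ x j)) (^-monoˡ-≤ j (<⇒≤ ∣x∣<Y))

    D≢0 : ∀ j .{{_ : NonZero j}} → NonZero (D j)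
    D≢0 j = ≢-nonZero λ D≡0 → <⇒≢ (^-monoˡ-< j ∣x∣<Y)
      (trans (sym (abs-^ x j)) (cong ℤ.∣_∣ (trans (sym (ℤ.i-j≡0⇒i≡j (y ℤ.^ j) (x ℤ.^ j) (ℤ.∣i∣≡0⇒i≡0 D≡0))) (y^ j))))

    δ-+ : ∀ m n → δ (m + n) ≡ y ℤ.^ m ℤ.* δ n ℤ.+ x ℤ.^ n ℤ.* δ m
    δ-+ m n = trans (cong₂ ℤ._-_ (ℤ.^-distribˡ-+-* y m n) (ℤ.^-distribˡ-+-* x m n))
      (lemma (y ℤ.^ m) (y ℤ.^ n) (x ℤ.^ m) (x ℤ.^ n))
      where
      lemma : ∀ a b c d → a ℤ.* b ℤ.- c ℤ.* d ≡ a ℤ.* (b ℤ.- d) ℤ.+ d ℤ.* (a ℤ.- c)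
      lemma = ℤ.solve-∀

    module _ (e : ℕ) where
      P : ℕ → Set
      P n = (+ e) ℤ.∣ δ n

      P-+ : ∀ m n → P m → P n → P (m + n)
      P-+ m n em en = subst ((+ e) ℤ.∣_) (sym (δ-+ m n))
        (ℤ.∣m∣n⇒∣m+n (ℤ.∣n⇒∣m*n (y ℤ.^ m) en) (ℤ.∣n⇒∣m*n (x ℤ.^ n) em))

      P-* : ∀ m n → P m → P (n * m)
      P-* m zero    em = ℤ.divides (+ 0) refl
      P-* m (suc n) em = P-+ m (n * m) em (P-* m n em)

      -- A common factor of e and Y divides y^m and δ m, hence x^m, which is coprime to Y. This
      -- makes y^m cancellable modulo e in `P-cancel`.
      e⊥Y : ∀ m .{{_ : NonZero m}} → P m → Coprime e Y
      e⊥Y m@(suc m′) em {f} (f∣e , f∣Y) = coprime-^ m coprime (f∣Y , subst (f ∣_) (abs-^ x m) (ℤ.∣⇒∣ᵤ f∣xᵐ))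
        where
        f∣yᵐ : (+ f) ℤ.∣ y ℤ.^ m
        f∣yᵐ = ℤ.∣m⇒∣m*n {m = y} (y ℤ.^ m′) (ℤ.∣ᵤ⇒∣ f∣Y)
        cancel : ∀ a b → a ℤ.- (a ℤ.- b) ≡ b
        cancel = ℤ.solve-∀
        f∣xᵐ : (+ f) ℤ.∣ x ℤ.^ m
        f∣xᵐ = subst ((+ f) ℤ.∣_) (cancel (y ℤ.^ m) (x ℤ.^ m))
          (ℤ.∣m∣n⇒∣m-n f∣yᵐ (ℤ.∣-trans (ℤ.∣ᵤ⇒∣ f∣e) em))

      P-cancel : ∀ m n → Coprime e Y → P m → P (m + n) → P n
      P-cancel m n c em emn = ℤ.∣ᵤ⇒∣ (coprime-divisor (coprime-^ m c) (subst (e ∣_) eq (ℤ.∣⇒∣ᵤ e∣yδ)))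
        where
        e∣yδ : (+ e) ℤ.∣ y ℤ.^ m ℤ.* δ n
        e∣yδ = ℤ.∣m+n∣n⇒∣m (subst ((+ e) ℤ.∣_) (δ-+ m n) emn) (ℤ.∣n⇒∣m*n (x ℤ.^ n) em)
        eq : ℤ.∣ y ℤ.^ m ℤ.* δ n ∣ ≡ Y ^ m * D n
        eq = trans (ℤ.abs-* (y ℤ.^ m) (δ n)) (cong (_* D n) (abs-^ y m))

      -- The exponents n with y^n ≡ x^n modulo e are closed under addition and under subtraction, so
      -- Bézout's identity applies. As e is arbitrary, it may later be taken to be the gcd of D m
      -- and D n.
      P-gcd : ∀ m n .{{_ : NonZero m}} → P m → P n → P (gcd m n)
      P-gcd m n em en with Bézout.identity (gcd-GCD m n)
      ... | Bézout.+- u v eq = P-cancel (v * n) (gcd m n) (e⊥Y m em) (P-* n v en)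
        (subst P (trans (sym eq) (+-comm (gcd m n) (v * n))) (P-* m u em))
      ... | Bézout.-+ u v eq = P-cancel (u * m) (gcd m n) (e⊥Y m em) (P-* m u em)
        (subst P (trans (sym eq) (+-comm (gcd m n) (u * m))) (P-* n v en))

    gcd-D : ∀ m n .{{_ : NonZero m}} → gcd (D m) (D n) ≡ D (gcd m n)
    gcd-D m n = ∣-antisym
      (ℤ.∣⇒∣ᵤ (P-gcd g m n (ℤ.∣ᵤ⇒∣ (gcd[m,n]∣m (D m) (D n))) (ℤ.∣ᵤ⇒∣ (gcd[m,n]∣n (D m) (D n)))))
      (gcd-greatest (divides-D (gcd[m,n]∣m m n)) (divides-D (gcd[m,n]∣n m n)))
      where
      g : ℕ
      g = gcd (D m) (D n)
      divides-D : ∀ {k} → gcd m n ∣ k → D (gcd m n) ∣ D k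
      divides-D (divides c refl) = ℤ.∣⇒∣ᵤ (P-* (D (gcd m n)) (gcd m n) c (ℤ.∣ᵤ⇒∣ ∣-refl))

    -- By induction from δ (1 + j) = y δ j + x^j δ 1 and |x| ≤ Y. The extra factor Y avoids the
    -- exponent j - 1 and puts the estimate in the same form as `D-lower`: D j is compared with (D 1
    -- / Y) Y^j.
    D-upper : ∀ j → Y * D j ≤ j * (D 1 * Y ^ j)
    D-upper zero    = ≤-reflexive (*-zeroʳ Y)
    D-upper (suc j) = begin
      Y * D (suc j) ≤⟨ *-monoʳ-≤ Y D-suc ⟩
      Y * (Y * D j + Y ^ j * D 1) ≤⟨ *-monoʳ-≤ Y (+-monoˡ-≤ (Y ^ j * D 1) (D-upper j)) ⟩
      Y * (j * (D 1 * Y ^ j) + Y ^ j * D 1) ≡⟨ lemma Y j (D 1) (Y ^ j) ⟩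
      suc j * (D 1 * (Y * Y ^ j)) ∎
      where
      open ≤-Reasoning
      lemma : ∀ Y j d p → Y * (j * (d * p) + p * d) ≡ suc j * (d * (Y * p))
      lemma = solve-∀
      D-suc : D (suc j) ≤ Y * D j + Y ^ j * D 1
      D-suc = begin
        ℤ.∣ δ (1 + j) ∣
          ≡⟨ cong ℤ.∣_∣ (δ-+ 1 j) ⟩
        ℤ.∣ y ℤ.^ 1 ℤ.* δ j ℤ.+ x ℤ.^ j ℤ.* δ 1 ∣
          ≤⟨ ℤ.∣i+j∣≤∣i∣+∣j∣ (y ℤ.^ 1 ℤ.* δ j) _ ⟩
        ℤ.∣ y ℤ.^ 1 ℤ.* δ j ∣ + ℤ.∣ x ℤ.^ j ℤ.* δ 1 ∣
          ≡⟨ cong₂ _+_ (trans (ℤ.abs-* (y ℤ.^ 1) (δ j)) (cong (_* D j) (trans (abs-^ y 1) (*-identityʳ Y))))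
                       (ℤ.abs-* (x ℤ.^ j) (δ 1)) ⟩
        Y * D j + ℤ.∣ x ℤ.^ j ∣ * D 1
          ≤⟨ +-monoʳ-≤ (Y * D j) (*-monoˡ-≤ (D 1) (∣x^∣≤ j)) ⟩
        Y * D j + Y ^ j * D 1 ∎

    -- For even n, 2 (y^(n+1) - x^(n+1)) - (y - x) y^n = (y + x)(y^n - x^n) + (y - x) x^n ≥ 0.
    D-lower : ∀ j → ¬ 2 ∣ j → D 1 * Y ^ j ≤ 2 * (Y * D j)
    D-lower j 2∤j with odd⇒half j 2∤j
    ... | k , refl = begin
      D 1 * (Y * Y ^ n) ≡⟨ shuffle (D 1) Y (Y ^ n) ⟩
      Y * (D 1 * Y ^ n) ≤⟨ *-monoʳ-≤ Y (ℤ.drop‿+≤+ bound) ⟩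
      Y * (2 * D (suc n)) ≡⟨ shuffle′ Y (D (suc n)) ⟩
      2 * (Y * D (suc n)) ∎
      where
      open ≤-Reasoning
      n : ℕ
      n = k + k
      shuffle : ∀ a b c → a * (b * c) ≡ b * (a * c)
      shuffle = solve-∀
      shuffle′ : ∀ a b → a * (2 * b) ≡ 2 * (a * b)
      shuffle′ = solve-∀
      0≤y+x : + 0 ℤ.≤ y ℤ.+ x
      0≤y+x = subst (ℤ._≤ y ℤ.+ x) (ℤ.+-inverseˡ x)
        (ℤ.+-monoˡ-≤ x (ℤ.≤-trans (subst (ℤ.- x ℤ.≤_) (cong +_ (ℤ.∣-i∣≡∣i∣ x)) (i≤∣i∣ (ℤ.- x))) (ℤ.+≤+ (<⇒≤ ∣x∣<Y))))
      0≤y-x : + 0 ℤ.≤ y ℤ.- x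
      0≤y-x = ℤ.i≤j⇒0≤j-i (ℤ.≤-trans (i≤∣i∣ x) (ℤ.+≤+ (<⇒≤ ∣x∣<Y)))
      0≤xⁿ : + 0 ℤ.≤ x ℤ.^ n
      0≤xⁿ = subst (+ 0 ℤ.≤_) (sym (ℤ.^-distribˡ-+-* x k k)) (0≤i² (x ℤ.^ k))
      0≤δn : + 0 ℤ.≤ δ n
      0≤δn = ℤ.i≤j⇒0≤j-i (ℤ.≤-trans (i≤∣i∣ (x ℤ.^ n)) (subst (+ ℤ.∣ x ℤ.^ n ∣ ℤ.≤_) (sym (y^ n)) (ℤ.+≤+ (∣x^∣≤ n))))
      identity : ∀ x y a b → (+ 2) ℤ.* (y ℤ.* a ℤ.- x ℤ.* b)
                 ≡ ((y ℤ.+ x) ℤ.* (a ℤ.- b) ℤ.+ (y ℤ.- x) ℤ.* b) ℤ.+ (y ℤ.- x) ℤ.* a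
      identity = ℤ.solve-∀
      bound : + (D 1 * Y ^ n) ℤ.≤ + (2 * D (suc n))
      bound = ℤ.≤-trans (ℤ.≤-reflexive eq₁) (ℤ.≤-trans
        (ℤ.≤-trans (ℤ.≤-reflexive (sym (ℤ.+-identityˡ B)))
          (ℤ.≤-trans (ℤ.+-monoˡ-≤ B (ℤ.+-mono-≤ (0≤i*j 0≤y+x 0≤δn) (0≤i*j 0≤y-x 0≤xⁿ)))
            (ℤ.≤-reflexive (sym (identity x y (y ℤ.^ n) (x ℤ.^ n))))))
        (ℤ.≤-trans (i≤∣i∣ ((+ 2) ℤ.* δ (suc n))) (ℤ.≤-reflexive (cong +_ (ℤ.abs-* (+ 2) (δ (suc n)))))))
        where
        B : ℤ
        B = (y ℤ.- x) ℤ.* y ℤ.^ n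
        eq₁ : + (D 1 * Y ^ n) ≡ (y ℤ.- x) ℤ.* y ℤ.^ n
        eq₁ = trans (ℤ.pos-* (D 1) (Y ^ n)) (cong₂ ℤ._*_
          (trans (cong (λ t → + ℤ.∣ t ∣) (cong₂ ℤ._-_ (ℤ.^-identityʳ y) (ℤ.^-identityʳ x))) (ℤ.0≤i⇒+∣i∣≡i 0≤y-x))
          (sym (y^ n)))

-- Size of the primitive part, with a constant independent of k.

module PrimitivePartSize where

  open PrimitiveParts
  open PowerDifferences
  open import Data.Integer.Base as ℤ using (ℤ)
  open import Data.List.Base using (List; []; _∷_; length; map)
  open import Data.List.Relation.Unary.All as All using (All; []; _∷_)
  open import Data.List.Relation.Unary.AllPairs using ([]; _∷_)
  open import Data.List.Relation.Unary.Unique.Propositional using (Unique)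
  open import Data.Nat.Base
  open import Data.Nat.Coprimality using (Coprime)
  open import Data.Nat.Divisibility
  open import Data.Nat.ListAction using (product)
  open import Data.Nat.Primality
  open import Data.Nat.Properties
  open import Data.Nat.Tactic.RingSolver using (solve-∀)
  open import Data.Product.Base using (_,_)
  open import Relation.Binary.PropositionalEquality
  open import Relation.Nullary using (¬_; yes; no; contradiction)

  n≤2^n : ∀ n → n ≤ 2 ^ n
  n≤2^n zero    = z≤n
  n≤2^n (suc n) = begin
    1 + n ≤⟨ +-mono-≤ (m^n>0 2 n) (n≤2^n n) ⟩
    2 ^ n + 2 ^ n ≡⟨ cong (_+_ (2 ^ n)) (+-identityʳ (2 ^ n)) ⟨
    2 ^ suc n ∎
    where open ≤-Reasoning

  Odd : ℕ → Set
  Odd n = ¬ 2 ∣ n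

  ∏φ : List ℕ → ℕ
  ∏φ S = product (map pred S)

  -- For odd primes this is ∏φ S / 2^|S|. It measures how much exponent remains once the 2^|S| error
  -- factors have been accounted for.
  ∏½ : List ℕ → ℕ
  ∏½ S = product (map ⌊_/2⌋ S)

  pred-odd : ∀ {q} → Odd q → pred q ≡ 2 * ⌊ q /2⌋
  pred-odd {q} q-odd with odd⇒half q q-odd
  ... | k , refl = trans (cong (k +_) (sym (+-identityʳ k))) (cong (2 *_) (sym ⌊1+k+k/2⌋))
    where
    ⌊1+k+k/2⌋ : ⌊ suc (k + k) /2⌋ ≡ k
    ⌊1+k+k/2⌋ = trans (cong (λ t → ⌊ suc t /2⌋) (cong (k +_) (sym (+-identityʳ k)))) (⌊1+2k/2⌋ k)
      where
      ⌊1+2k/2⌋ : ∀ k → ⌊ suc (2 * k) /2⌋ ≡ k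
      ⌊1+2k/2⌋ zero    = refl
      ⌊1+2k/2⌋ (suc k) = trans (cong (λ t → ⌊ suc t /2⌋) (*-suc 2 k)) (cong suc (⌊1+2k/2⌋ k))

  ∏φ≡ : ∀ {S} → All Odd S → ∏φ S ≡ 2 ^ length S * ∏½ S
  ∏φ≡ []                       = refl
  ∏φ≡ {q ∷ S} (q-odd ∷ S-odd) = trans (cong₂ _*_ (pred-odd q-odd) (∏φ≡ S-odd))
    (lemma ⌊ q /2⌋ (2 ^ length S) (∏½ S))
    where
    lemma : ∀ a b c → 2 * a * (b * c) ≡ 2 * b * (a * c)
    lemma = solve-∀

  half≢0 : ∀ {q} → Prime q → Odd q → NonZero ⌊ q /2⌋
  half≢0 {zero}        pq q-odd = contradiction (2 ∣0) q-odd
  half≢0 {suc zero}    pq q-odd = contradiction pq ¬prime[1]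
  half≢0 {suc (suc q)} pq q-odd = _

  ∏½≢0 : ∀ {S} → All Prime S → All Odd S → NonZero (∏½ S)
  ∏½≢0         []        []              = _
  ∏½≢0 {q ∷ S} (pq ∷ pS) (q-odd ∷ S-odd) = *-nonZero ⌊ q /2⌋ {{half≢0 pq q-odd}} (∏½≢0 pS S-odd)

  -- The new factor q is at most 2^q, while the exponent grows by c (⌊q/2⌋ - 1) Q. This is at least
  -- q because q ≤ 6 (⌊q/2⌋ - 1) once q ≥ 4.
  ∏-step : ∀ c q P Q → 6 ≤ c → Prime q → Odd q → ¬ q ≡ 3 → 1 ≤ Q →
           2 * P ≤ 2 ^ (c * Q) → 2 * (q * P) ≤ 2 ^ (c * (⌊ q /2⌋ * Q))
  ∏-step c 0 P Q 6≤c pq q-odd q≢3 1≤Q ih = z≤n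
  ∏-step c 1 P Q 6≤c pq q-odd q≢3 1≤Q ih = contradiction pq ¬prime[1]
  ∏-step c 2 P Q 6≤c pq q-odd q≢3 1≤Q ih = contradiction ∣-refl q-odd
  ∏-step c 3 P Q 6≤c pq q-odd q≢3 1≤Q ih = contradiction refl q≢3
  ∏-step c q@(suc (suc (suc (suc r)))) P Q 6≤c pq q-odd q≢3 1≤Q ih = begin
    2 * (q * P) ≡⟨ swap q P ⟩
    q * (2 * P) ≤⟨ *-mono-≤ (n≤2^n q) ih ⟩
    2 ^ q * 2 ^ (c * Q) ≡⟨ ^-distribˡ-+-* 2 q (c * Q) ⟨
    2 ^ (q + c * Q) ≤⟨ ^-monoʳ-≤ 2 exponent ⟩
    2 ^ (c * (⌊ q /2⌋ * Q)) ∎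
    where
    open ≤-Reasoning
    swap : ∀ q P → 2 * (q * P) ≡ q * (2 * P)
    swap = solve-∀
    s : ℕ
    s = suc ⌊ r /2⌋
    r≤ : ∀ r → r ≤ suc (⌊ r /2⌋ + ⌊ r /2⌋)
    r≤ zero          = z≤n
    r≤ (suc zero)    = s≤s z≤n
    r≤ (suc (suc r)) = s≤s (subst (suc r ≤_) (cong suc (sym (+-suc ⌊ r /2⌋ ⌊ r /2⌋))) (s≤s (r≤ r)))
    lemma : ∀ t → 5 + (t + t) + suc (4 * t) ≡ 6 * suc t
    lemma = solve-∀
    q≤6s : q ≤ 6 * s
    q≤6s = begin
      4 + r ≤⟨ +-monoʳ-≤ 4 (r≤ r) ⟩
      5 + (⌊ r /2⌋ + ⌊ r /2⌋) ≤⟨ m≤m+n _ (suc (4 * ⌊ r /2⌋)) ⟩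
      5 + (⌊ r /2⌋ + ⌊ r /2⌋) + suc (4 * ⌊ r /2⌋) ≡⟨ lemma ⌊ r /2⌋ ⟩
      6 * s ∎
    lemma′ : ∀ c s Q → c * s * Q + c * Q ≡ c * (suc s * Q)
    lemma′ = solve-∀
    exponent : q + c * Q ≤ c * (suc s * Q)
    exponent = begin
      q + c * Q ≤⟨ +-monoˡ-≤ (c * Q) (≤-trans q≤6s (*-monoˡ-≤ s 6≤c)) ⟩
      c * s + c * Q ≤⟨ +-monoˡ-≤ (c * Q) (m≤m*n (c * s) Q {{>-nonZero 1≤Q}}) ⟩
      c * s * Q + c * Q ≡⟨ lemma′ c s Q ⟩
      c * (suc s * Q) ∎

  ∏≤-no3 : ∀ {S} → All Prime S → All Odd S → All (λ q → ¬ q ≡ 3) S → 2 * product S ≤ 2 ^ (6 * ∏½ S)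
  ∏≤-no3 []        []              []           = ≤ᵇ⇒≤ 2 64 _
  ∏≤-no3 {q ∷ S} (pq ∷ pS) (q-odd ∷ S-odd) (q≢3 ∷ S≢3) =
    ∏-step 6 q (product S) (∏½ S) ≤-refl pq q-odd q≢3 (>-nonZero⁻¹ (∏½ S) {{∏½≢0 pS S-odd}}) (∏≤-no3 pS S-odd S≢3)

  -- A new factor q is absorbed by the growth of ∏½ except at q = 3, where ⌊ q /2⌋ = 1; but 3 occurs only once.
  ∏≤ : ∀ {S} → Unique S → All Prime S → All Odd S → 2 * product S ≤ 2 ^ (8 * ∏½ S)
  ∏≤ []                  []        []              = ≤ᵇ⇒≤ 2 256 _
  ∏≤ {q ∷ S} (q∉S ∷ uS) (pq ∷ pS) (q-odd ∷ S-odd) with q ≟ 3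
  ... | no q≢3 = ∏-step 8 q (product S) (∏½ S) (≤ᵇ⇒≤ 6 8 _) pq q-odd q≢3 (>-nonZero⁻¹ (∏½ S) {{∏½≢0 pS S-odd}}) (∏≤ uS pS S-odd)
  ... | yes refl = begin
    2 * (3 * product S) ≡⟨ swap (product S) ⟩
    -- The single factor 3 ≤ 2^2 is paid for by the difference between the exponents 6 ∏½ and 8 ∏½;
    -- the other primes differ from 3, so the sharper bound covers them.
    3 * (2 * product S) ≤⟨ *-mono-≤ (n≤1+n 3) (∏≤-no3 pS S-odd (All.map (λ q≢r r≡q → q≢r (sym r≡q)) q∉S)) ⟩
    2 ^ 2 * 2 ^ (6 * ∏½ S) ≡⟨ ^-distribˡ-+-* 2 2 (6 * ∏½ S) ⟨
    2 ^ (2 + 6 * ∏½ S) ≤⟨ ^-monoʳ-≤ 2 (+-monoˡ-≤ (6 * ∏½ S) (*-monoʳ-≤ 2 (>-nonZero⁻¹ (∏½ S) {{∏½≢0 pS S-odd}}))) ⟩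
    2 ^ (2 * ∏½ S + 6 * ∏½ S) ≡⟨ cong (2 ^_) (lemma (∏½ S)) ⟩
    2 ^ (8 * (1 * ∏½ S)) ∎
    where
    open ≤-Reasoning
    swap : ∀ P → 2 * (3 * P) ≡ 3 * (2 * P)
    swap = solve-∀
    lemma : ∀ Q → 2 * Q + 6 * Q ≡ 8 * (1 * Q)
    lemma = solve-∀

  E : List ℕ → ℕ → ℕ
  E S j = (2 * (j * product S)) ^ (2 ^ length S)

  -- The base is at most 2^(9 j ∏½), with 1 from j ≤ 2^j and 8 from `∏≤`; raising it to the power
  -- 2^|S| turns ∏½ into ∏φ.
  E≤ : ∀ {S} j .{{_ : NonZero j}} → Unique S → All Prime S → All Odd S → E S j ≤ 2 ^ (9 * (j * ∏φ S))
  E≤ {S} j uS pS S-odd = begin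
    (2 * (j * product S)) ^ (2 ^ length S) ≤⟨ ^-monoˡ-≤ (2 ^ length S) base ⟩
    (2 ^ (9 * (j * ∏½ S))) ^ (2 ^ length S) ≡⟨ ^-*-assoc 2 (9 * (j * ∏½ S)) (2 ^ length S) ⟩
    2 ^ (9 * (j * ∏½ S) * 2 ^ length S) ≡⟨ cong (2 ^_) (trans (swap j (∏½ S) (2 ^ length S))
                                                  (cong (λ t → 9 * (j * t)) (sym (∏φ≡ S-odd)))) ⟩
    2 ^ (9 * (j * ∏φ S)) ∎
    where
    open ≤-Reasoning
    swap : ∀ j a b → 9 * (j * a) * b ≡ 9 * (j * (b * a))
    swap = solve-∀
    swap′ : ∀ j P → 2 * (j * P) ≡ j * (2 * P)
    swap′ = solve-∀
    lemma : ∀ j Q → j * Q + 8 * (j * Q) ≡ 9 * (j * Q)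
    lemma = solve-∀
    base : 2 * (j * product S) ≤ 2 ^ (9 * (j * ∏½ S))
    base = begin
      2 * (j * product S) ≡⟨ swap′ j (product S) ⟩
      j * (2 * product S) ≤⟨ *-mono-≤ (n≤2^n j) (∏≤ uS pS S-odd) ⟩
      2 ^ j * 2 ^ (8 * ∏½ S) ≡⟨ ^-distribˡ-+-* 2 j (8 * ∏½ S) ⟨
      2 ^ (j + 8 * ∏½ S) ≤⟨ ^-monoʳ-≤ 2 (+-mono-≤ (m≤m*n j (∏½ S) {{∏½≢0 pS S-odd}}) (*-monoʳ-≤ 8 (m≤n*m (∏½ S) j))) ⟩
      2 ^ (j * ∏½ S + 8 * (j * ∏½ S)) ≡⟨ cong (2 ^_) (lemma j (∏½ S)) ⟩
      2 ^ (9 * (j * ∏½ S)) ∎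

  module Size (Y : ℕ) (x : ℤ) (∣x∣<Y : ℤ.∣ x ∣ < Y) (coprime : Coprime Y ℤ.∣ x ∣) where

    open Difference Y x ∣x∣<Y coprime using (D; D≢0; gcd-D; D-upper; D-lower; Y≢0)
    open PrimitivePart D D≢0 gcd-D using (G; G*L; G-step; G≢0; p∣G)

    -- Says that g is (c₂ / c₁) Y^N up to a factor E in both directions, with the fractions cleared.
    record Approx (c₁ c₂ E N g : ℕ) : Set where
      constructor approx
      field
        upper : c₁ * g ≤ E * (c₂ * Y ^ N)
        lower : c₂ * Y ^ N ≤ E * (c₁ * g)

    approx-mono : ∀ {c₁ c₂ E E′ N g} → E ≤ E′ → Approx c₁ c₂ E N g → Approx c₁ c₂ E′ N g
    approx-mono E≤E′ (approx u l) = approx (≤-trans u (*-monoˡ-≤ _ E≤E′)) (≤-trans l (*-monoˡ-≤ _ E≤E′))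

    -- Division is the reason for two-sided bounds: an upper bound for g₁ / g₀ needs a lower bound
    -- for g₀. The errors multiply and the ratio c₂ / c₁, being common, disappears.
    approx-/ : ∀ {c₁ c₂ E₀ E₁ N₀ N₁ g₀ g₁} N g .{{_ : NonZero c₁}} .{{_ : NonZero c₂}} .{{_ : NonZero g₀}} →
               N₁ ≡ N + N₀ → g * g₀ ≡ g₁ →
               Approx c₁ c₂ E₁ N₁ g₁ → Approx c₁ c₂ E₀ N₀ g₀ → Approx 1 1 (E₁ * E₀) N g
    approx-/ {c₁} {c₂} {E₀} {E₁} {N₀} {N₁} {g₀} {g₁} N g refl refl (approx u₁ l₁) (approx u₀ l₀) = approx
      (*-cancelʳ-≤ _ _ (c₂ * Y ^ N₀) {{*-nonZero c₂ (m^n≢0 Y N₀)}} (begin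
        1 * g * (c₂ * Y ^ N₀) ≤⟨ *-monoʳ-≤ (1 * g) l₀ ⟩
        1 * g * (E₀ * (c₁ * g₀)) ≡⟨ lemma₁ g E₀ c₁ g₀ ⟩
        E₀ * (c₁ * (g * g₀)) ≤⟨ *-monoʳ-≤ E₀ u₁ ⟩
        E₀ * (E₁ * (c₂ * Y ^ (N + N₀))) ≡⟨ cong (λ t → E₀ * (E₁ * (c₂ * t))) (^-distribˡ-+-* Y N N₀) ⟩
        E₀ * (E₁ * (c₂ * (Y ^ N * Y ^ N₀))) ≡⟨ lemma₂ E₀ E₁ c₂ (Y ^ N) (Y ^ N₀) ⟩
        E₁ * E₀ * (1 * Y ^ N) * (c₂ * Y ^ N₀) ∎))
      (*-cancelʳ-≤ _ _ (c₁ * g₀) {{m*n≢0 c₁ g₀}} (begin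
        1 * Y ^ N * (c₁ * g₀) ≤⟨ *-monoʳ-≤ (1 * Y ^ N) u₀ ⟩
        1 * Y ^ N * (E₀ * (c₂ * Y ^ N₀)) ≡⟨ lemma₃ (Y ^ N) E₀ c₂ (Y ^ N₀) ⟩
        E₀ * (c₂ * (Y ^ N * Y ^ N₀)) ≡⟨ cong (λ t → E₀ * (c₂ * t)) (^-distribˡ-+-* Y N N₀) ⟨
        E₀ * (c₂ * Y ^ (N + N₀)) ≤⟨ *-monoʳ-≤ E₀ l₁ ⟩
        E₀ * (E₁ * (c₁ * (g * g₀))) ≡⟨ lemma₂ E₀ E₁ c₁ g g₀ ⟩
        E₁ * E₀ * (1 * g) * (c₁ * g₀) ∎))
      where
      open ≤-Reasoning
      lemma₁ : ∀ g e c h → 1 * g * (e * (c * h)) ≡ e * (c * (g * h))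
      lemma₁ = solve-∀
      lemma₂ : ∀ e f c a b → e * (f * (c * (a * b))) ≡ f * e * (1 * a) * (c * b)
      lemma₂ = solve-∀
      lemma₃ : ∀ a e c b → 1 * a * (e * (c * b)) ≡ e * (c * (a * b))
      lemma₃ = solve-∀

    -- D j is of size Y ^ j * (D 1 / Y); the factor D 1 / Y cancels in the quotients G (q ∷ S).
    c₁ c₂ : List ℕ → ℕ
    c₁ []      = Y
    c₁ (_ ∷ _) = 1
    c₂ []      = D 1
    c₂ (_ ∷ _) = 1

    c₁≢0 : ∀ S → NonZero (c₁ S)
    c₁≢0 []      = Y≢0
    c₁≢0 (_ ∷ _) = _
    c₂≢0 : ∀ S → NonZero (c₂ S)
    c₂≢0 []      = D≢0 1
    c₂≢0 (_ ∷ _) = _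

    G-approx : ∀ S j .{{_ : NonZero j}} (pS : All Prime S) → Unique S → All Odd S → Odd j →
               Approx (c₁ S) (c₂ S) (E S j) (j * ∏φ S) (G S j pS)
    G-approx [] j [] [] [] j-odd = approx
      (begin
        Y * G [] j [] ≡⟨ cong (Y *_) G≡ ⟩
        Y * D j ≤⟨ D-upper j ⟩
        j * (D 1 * Y ^ j) ≤⟨ *-monoˡ-≤ (D 1 * Y ^ j) j≤ ⟩
        E [] j * (D 1 * Y ^ j) ≡⟨ cong (λ t → E [] j * (D 1 * Y ^ t)) (*-identityʳ j) ⟨
        E [] j * (D 1 * Y ^ (j * 1)) ∎)
      (begin
        D 1 * Y ^ (j * 1) ≡⟨ cong (λ t → D 1 * Y ^ t) (*-identityʳ j) ⟩
        D 1 * Y ^ j ≤⟨ D-lower j j-odd ⟩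
        2 * (Y * D j) ≤⟨ *-monoˡ-≤ (Y * D j) 2≤ ⟩
        E [] j * (Y * D j) ≡⟨ cong (λ t → E [] j * (Y * t)) G≡ ⟨
        E [] j * (Y * G [] j []) ∎)
      where
      open ≤-Reasoning
      G≡ : G [] j [] ≡ D j
      G≡ = trans (sym (*-identityʳ _)) (trans (sym (G*L [] j [])) (cong D (*-identityʳ j)))
      E≡ : E [] j ≡ 2 * j
      E≡ = trans (*-identityʳ (2 * (j * 1))) (cong (2 *_) (*-identityʳ j))
      j≤ : j ≤ E [] j
      j≤ = subst (j ≤_) (sym E≡) (m≤n*m j 2)
      2≤ : 2 ≤ E [] j
      2≤ = subst (2 ≤_) (sym E≡) (m≤m*n 2 j)
    G-approx (q ∷ S) j (pq ∷ pS) (q∉S ∷ uS) (q-odd ∷ S-odd) j-odd = approx-mono bound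
      (approx-/ (j * ∏φ (q ∷ S)) (G (q ∷ S) j (pq ∷ pS)) {{c₁≢0 S}} {{c₂≢0 S}} {{G≢0 S j pS}}
        N≡ (G-step q S j pq pS q∉S)
        (G-approx S (j * q) pS uS S-odd (odd-* j-odd q-odd)) (G-approx S j pS uS S-odd j-odd))
      where
      open ≤-Reasoning
      instance
        q≢0 : NonZero q
        q≢0 = prime⇒nonZero pq
        jq≢0 : NonZero (j * q)
        jq≢0 = m*n≢0 j q
      lemma : ∀ j q P → j * suc q * P ≡ j * (q * P) + j * P
      lemma = solve-∀
      N≡ : j * q * ∏φ S ≡ j * (pred q * ∏φ S) + j * ∏φ S
      N≡ = trans (cong (λ t → j * t * ∏φ S) (sym (suc-pred q))) (lemma j (pred q) (∏φ S))
      r : ℕ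
      r = 2 ^ length S
      X : ℕ
      X = 2 * (j * (q * product S))
      -- Both errors have base at most X and exponent r, and the exponent allowed for one more prime
      -- is 2 r.
      bound : E S (j * q) * E S j ≤ E (q ∷ S) j
      bound = begin
        E S (j * q) * E S j ≤⟨ *-mono-≤ (≤-reflexive (cong (λ t → (2 * t) ^ r) (*-assoc j q (product S))))
                                          (^-monoˡ-≤ r (*-monoʳ-≤ 2 (*-monoʳ-≤ j (m≤n*m (product S) q)))) ⟩
        X ^ r * X ^ r ≡⟨ ^-distribˡ-+-* X r r ⟨
        X ^ (r + r) ≡⟨ cong (λ t → X ^ (r + t)) (+-identityʳ r) ⟨
        X ^ (2 * r) ∎

    prime≤ : ∀ {p} q S j .{{_ : NonZero j}} → Prime p → All Prime (q ∷ S) → Unique (q ∷ S) → All Odd (q ∷ S) → Odd j →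
             p ∣ D (j * product (q ∷ S)) → (∀ i .{{_ : NonZero i}} → i < j * product (q ∷ S) → ¬ p ∣ D i) →
             p ≤ (512 * Y) ^ (j * ∏φ (q ∷ S))
    prime≤ {p} q S j pp pS uS S-odd j-odd p∣D p∤D = begin
      p ≤⟨ ∣⇒≤ {{G≢0 (q ∷ S) j pS}} (p∣G (q ∷ S) j pS pp p∣D p∤D) ⟩
      G (q ∷ S) j pS ≡⟨ *-identityˡ _ ⟨
      1 * G (q ∷ S) j pS ≤⟨ Approx.upper (G-approx (q ∷ S) j pS uS S-odd j-odd) ⟩
      E (q ∷ S) j * (1 * Y ^ N) ≤⟨ *-monoˡ-≤ (1 * Y ^ N) (E≤ j uS pS S-odd) ⟩
      -- Here 512 = 2^9 arises from the exponent in `E≤`.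
      2 ^ (9 * N) * (1 * Y ^ N) ≡⟨ cong₂ _*_ (sym (^-*-assoc 2 9 N)) (*-identityˡ (Y ^ N)) ⟩
      512 ^ N * Y ^ N ≡⟨ ^-distribʳ-* N 512 Y ⟨
      (512 * Y) ^ N ∎
      where
      open ≤-Reasoning
      open import Defs using (^-distribʳ-*)
      N : ℕ
      N = j * ∏φ (q ∷ S)

-- Totients by sieving, and the function γ.

module Totients where

  open import Defs using (φ; γ; [1⋯_])
  open PrimitiveParts
  open PowerDifferences
  open PrimitivePartSize
  open import Data.Integer.Base as ℤ using (ℤ)
  open import Data.List.Base using (List; []; _∷_; length; map; filter; applyUpTo)
  open import Data.List.Extrema.Nat using (max≤v⁺; v≤max⁺)
  open import Data.List.Membership.DecPropositional using () renaming (_∈?_ to ∈-dec)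
  open import Data.List.Membership.Propositional using (_∈_; lose)
  open import Data.List.Membership.Propositional.Properties using (∈-filter⁺; ∈-filter⁻; ∈-map⁺; ∈-map⁻; ∈-applyUpTo⁺)
  open import Data.List.Properties using (filter-notAll; length-applyUpTo)
  open import Data.List.Relation.Unary.All as All using (All; []; _∷_)
  open import Data.List.Relation.Unary.All.Properties using (¬Any⇒All¬)
  open import Data.List.Relation.Unary.AllPairs using ([]; _∷_)
  open import Data.List.Relation.Unary.Any using (here; there)
  open import Data.List.Relation.Unary.Unique.Propositional using (Unique)
  open import Data.Empty using (⊥-elim)
  open import Data.Nat.Base
  open import Data.Nat.Coprimality using (Coprime; coprime?)
  open import Data.Nat.Divisibility
  open import Data.Nat.ListAction using (sum; product)
  open import Data.Nat.Primality
  open import Data.Nat.Primality.Factorisation using (factorise; module PrimeFactorisation)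
  open import Data.Nat.Properties
  open import Data.Nat.Tactic.RingSolver using (solve-∀)
  open import Data.Product.Base using (_,_; _×_; ∃-syntax)
  open import Data.Sum.Base using (inj₁; inj₂)
  open import Function.Base using (_∘_)
  open import Relation.Binary.PropositionalEquality
  open import Relation.Unary using (Pred; Decidable)
  open import Relation.Nullary using (¬_; Dec; yes; no; contradiction)
  open import Relation.Nullary.Decidable using (¬?)

  ∑ : (ℕ → ℕ) → ℕ → ℕ
  ∑ f n = sum (applyUpTo f n)

  ∑-cong : ∀ {f g} n → (∀ i → f i ≡ g i) → ∑ f n ≡ ∑ g n
  ∑-cong zero    f≗g = refl
  ∑-cong (suc n) f≗g = cong₂ _+_ (f≗g 0) (∑-cong n (f≗g ∘ suc))

  ∑-+ : ∀ f m n → ∑ f (m + n) ≡ ∑ f m + ∑ (λ i → f (m + i)) n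
  ∑-+ f zero    n = refl
  ∑-+ f (suc m) n = trans (cong (f 0 +_) (∑-+ (f ∘ suc) m n)) (sym (+-assoc (f 0) _ _))

  ∑-distrib : ∀ f g n → ∑ (λ i → f i + g i) n ≡ ∑ f n + ∑ g n
  ∑-distrib f g zero    = refl
  ∑-distrib f g (suc n) = trans (cong (f 0 + g 0 +_) (∑-distrib (f ∘ suc) (g ∘ suc) n))
    (lemma (f 0) (g 0) (∑ (f ∘ suc) n) (∑ (g ∘ suc) n))
    where
    lemma : ∀ a b c d → a + b + (c + d) ≡ a + c + (b + d)
    lemma = solve-∀

  ∑-zero : ∀ f n → (∀ i → i < n → f i ≡ 0) → ∑ f n ≡ 0
  ∑-zero f zero    f≡0 = refl
  ∑-zero f (suc n) f≡0 = cong₂ _+_ (f≡0 0 z<s) (∑-zero (f ∘ suc) n (λ i i<n → f≡0 (suc i) (s<s i<n)))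

  𝟙 : ∀ {a} {A : Set a} → Dec A → ℕ
  𝟙 (yes _) = 1
  𝟙 (no  _) = 0

  𝟙-cong : ∀ {a b} {A : Set a} {B : Set b} (A? : Dec A) (B? : Dec B) → (A → B) → (B → A) → 𝟙 A? ≡ 𝟙 B?
  𝟙-cong (yes a) (yes b) f g = refl
  𝟙-cong (yes a) (no ¬b) f g = contradiction (f a) ¬b
  𝟙-cong (no ¬a) (yes b) f g = contradiction (g b) ¬a
  𝟙-cong (no ¬a) (no ¬b) f g = refl

  ∑-multiples : ∀ q .{{_ : NonZero q}} (f : ℕ → ℕ) n → ∑ (λ i → 𝟙 (q ∣? suc i) * f (suc i)) (q * n) ≡ ∑ (λ i → f (q * suc i)) n
  ∑-multiples q f zero rewrite *-zeroʳ q = refl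
  ∑-multiples q@(suc q′) f (suc n) = begin
    ∑ h (q * suc n) ≡⟨ cong (∑ h) (*-suc q n) ⟩
    ∑ h (q + q * n) ≡⟨ ∑-+ h q (q * n) ⟩
    ∑ h q + ∑ (λ i → h (q + i)) (q * n) ≡⟨ cong₂ _+_ first (trans (∑-cong (q * n) shift) (∑-multiples q (f ∘ (q +_)) n)) ⟩
    f (q * 1) + ∑ (λ i → f (q + q * suc i)) n ≡⟨ cong (f (q * 1) +_) (∑-cong n λ i → cong f (sym (*-suc q (suc i)))) ⟩
    f (q * 1) + ∑ (λ i → f (q * suc (suc i))) n ∎
    where
    open ≡-Reasoning
    h : ℕ → ℕ
    h i = 𝟙 (q ∣? suc i) * f (suc i)
    below : ∀ i → i < q′ → h i ≡ 0
    below i i<q′ with q ∣? suc i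
    ... | yes q∣i = contradiction (∣⇒≤ q∣i) (<⇒≱ (s<s i<q′))
    ... | no  _   = refl
    last : h q′ ≡ f q
    last with q ∣? q
    ... | yes _  = +-identityʳ (f q)
    ... | no q∤q = contradiction ∣-refl q∤q
    first : ∑ h q ≡ f (q * 1)
    first = begin
      ∑ h (suc q′) ≡⟨ cong (∑ h) (+-comm 1 q′) ⟩
      ∑ h (q′ + 1) ≡⟨ ∑-+ h q′ 1 ⟩
      ∑ h q′ + (h (q′ + 0) + 0) ≡⟨ cong₂ _+_ (∑-zero h q′ below) (trans (+-identityʳ _) (trans (cong h (+-identityʳ q′)) last)) ⟩
      f q ≡⟨ cong f (*-identityʳ q) ⟨
      f (q * 1) ∎
    shift : ∀ i → h (q + i) ≡ 𝟙 (q ∣? suc i) * f (q + suc i)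
    shift i = trans (cong (λ t → 𝟙 (q ∣? t) * f t) (sym (+-suc q i)))
      (cong (_* f (q + suc i)) (𝟙-cong (q ∣? (q + suc i)) (q ∣? suc i)
        (λ q∣ → ∣m+n∣m⇒∣n q∣ ∣-refl) (λ q∣i → ∣m∣n⇒∣m+n ∣-refl q∣i)))

  sieve : List ℕ → ℕ → ℕ
  sieve []      i = 1
  sieve (q ∷ S) i = 𝟙 (¬? (q ∣? i)) * sieve S i

  sieve-split : ∀ q S i → sieve (q ∷ S) i + 𝟙 (q ∣? i) * sieve S i ≡ sieve S i
  sieve-split q S i with q ∣? i
  ... | yes _ = +-identityʳ (sieve S i)
  ... | no  _ = trans (+-identityʳ (1 * sieve S i)) (*-identityˡ (sieve S i))

  sieve-* : ∀ {q S} i → Prime q → All Prime S → All (λ r → ¬ q ≡ r) S → sieve S (q * i) ≡ sieve S i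
  sieve-* i pq [] [] = refl
  sieve-* {q} {r ∷ S} i pq (pr ∷ pS) (q≢r ∷ q∉S) = cong₂ _*_
    (𝟙-cong (¬? (r ∣? (q * i))) (¬? (r ∣? i)) (λ r∤qi r∣i → r∤qi (∣n⇒∣m*n q r∣i)) λ r∤i r∣qi → r∤i (divides-i r∣qi))
    (sieve-* i pq pS q∉S)
    where
    divides-i : r ∣ q * i → r ∣ i
    divides-i r∣qi with euclidsLemma q i pr r∣qi
    ... | inj₂ r∣i = r∣i
    ... | inj₁ r∣q with prime⇒irreducible pq r∣q
    ...   | inj₁ refl = contradiction pr ¬prime[1]
    ...   | inj₂ r≡q  = contradiction (sym r≡q) q≢r

  -- Inclusion-exclusion one prime at a time: among 1, ..., q m the multiples of q are q i with i ≤
  -- m, and `sieve S` does not notice the factor q. So a fraction 1/q is removed at each step.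
  ∑-sieve : ∀ {S} j → Unique S → All Prime S → ∑ (sieve S ∘ suc) (j * product S) ≡ j * ∏φ S
  ∑-sieve {[]} j [] [] = trans (cong (∑ (sieve [] ∘ suc)) (*-identityʳ j)) (trans (∑-ones j) (sym (*-identityʳ j)))
    where
    ∑-ones : ∀ n → ∑ (λ _ → 1) n ≡ n
    ∑-ones zero    = refl
    ∑-ones (suc n) = cong suc (∑-ones n)
  ∑-sieve {q ∷ S} j (q∉S ∷ uS) (pq ∷ pS) = +-cancelʳ-≡ (j * ∏φ S) _ _ (begin
    ∑ (sieve (q ∷ S) ∘ suc) n + j * ∏φ S
      ≡⟨ cong₂ _+_ (cong (∑ (sieve (q ∷ S) ∘ suc)) n≡) multiples ⟩
    ∑ (sieve (q ∷ S) ∘ suc) (q * m) + ∑ (λ i → 𝟙 (q ∣? suc i) * sieve S (suc i)) (q * m)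
      ≡⟨ ∑-distrib (sieve (q ∷ S) ∘ suc) _ (q * m) ⟨
    ∑ (λ i → sieve (q ∷ S) (suc i) + 𝟙 (q ∣? suc i) * sieve S (suc i)) (q * m)
      ≡⟨ ∑-cong (q * m) (λ i → sieve-split q S (suc i)) ⟩
    ∑ (sieve S ∘ suc) (q * m)
      ≡⟨ cong (∑ (sieve S ∘ suc)) (sym (*-assoc q j (product S))) ⟩
    ∑ (sieve S ∘ suc) (q * j * product S)
      ≡⟨ ∑-sieve (q * j) uS pS ⟩
    q * j * ∏φ S
      ≡⟨ cong (λ t → t * j * ∏φ S) (sym (suc-pred q {{prime⇒nonZero pq}})) ⟩
    suc (pred q) * j * ∏φ S
      ≡⟨ lemma (pred q) j (∏φ S) ⟩
    j * (pred q * ∏φ S) + j * ∏φ S ∎)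
    where
    open ≡-Reasoning
    m n : ℕ
    m = j * product S
    n = j * (q * product S)
    swap : ∀ j q P → j * (q * P) ≡ q * (j * P)
    swap = solve-∀
    n≡ : n ≡ q * m
    n≡ = swap j q (product S)
    lemma : ∀ q j P → suc q * j * P ≡ j * (q * P) + j * P
    lemma = solve-∀
    multiples : j * ∏φ S ≡ ∑ (λ i → 𝟙 (q ∣? suc i) * sieve S (suc i)) (q * m)
    multiples = trans (sym (∑-sieve j uS pS)) (trans
      (∑-cong m (λ i → sym (sieve-* (suc i) pq pS q∉S)))
      (sym (∑-multiples q {{prime⇒nonZero pq}} (sieve S) m)))

  sieve-∈ : ∀ {S q i} → q ∈ S → q ∣ i → sieve S i ≡ 0
  sieve-∈ {q ∷ S} {_} {i} (here refl) q∣i with q ∣? i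
  ... | yes _  = refl
  ... | no q∤i = contradiction q∣i q∤i
  sieve-∈ {q ∷ S} {_} {i} (there q∈S) q∣i = trans (cong (𝟙 (¬? (q ∣? i)) *_) (sieve-∈ q∈S q∣i)) (*-zeroʳ (𝟙 (¬? (q ∣? i))))

  sieve≤1 : ∀ S i → sieve S i ≤ 1
  sieve≤1 []      i = ≤-refl
  sieve≤1 (q ∷ S) i with q ∣? i
  ... | yes _ = z≤n
  ... | no  _ = subst (_≤ 1) (sym (+-identityʳ (sieve S i))) (sieve≤1 S i)

  prime-divisor : ∀ n .{{_ : NonTrivial n}} → ∃[ p ] Prime p × p ∣ n
  prime-divisor n with factorise n {{nonTrivial⇒nonZero n}}
  ... | record { factors = []     ; isFactorisation = refl } = contradiction refl nonTrivial⇒≢1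
  ... | record { factors = p ∷ ps ; isFactorisation = refl ; factorsPrime = pp ∷ _ } = p , pp , m∣m*n (product ps)

  coprime-by-primes : ∀ {m n} .{{_ : NonZero n}} → (∀ {q} → Prime q → q ∣ n → ¬ q ∣ m) → Coprime m n
  coprime-by-primes {m} {n} no-prime {zero}        (_ , 0∣n) = contradiction (0∣⇒≡0 0∣n) (≢-nonZero⁻¹ n)
  coprime-by-primes         no-prime {suc zero}    _ = refl
  coprime-by-primes         no-prime {suc (suc e)} (e∣m , e∣n) with prime-divisor (suc (suc e))
  ... | q , pq , q∣e = contradiction (∣-trans q∣e e∣m) (no-prime pq (∣-trans q∣e e∣n))

  ∑≤length-filter : ∀ {p} {P : Pred ℕ p} (P? : Decidable P) f g n → (∀ i → f i ≤ 1) → (∀ i → ¬ P i → f i ≡ 0) →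
                    ∑ (f ∘ g) n ≤ length (filter P? (applyUpTo g n))
  ∑≤length-filter P? f g zero    f≤1 f≡0 = z≤n
  ∑≤length-filter P? f g (suc n) f≤1 f≡0 with P? (g 0)
  ... | yes _ = +-mono-≤ (f≤1 (g 0)) (∑≤length-filter P? f (g ∘ suc) n f≤1 f≡0)
  ... | no ¬P rewrite f≡0 (g 0) ¬P = ∑≤length-filter P? f (g ∘ suc) n f≤1 f≡0

  -- A number not coprime to n shares a prime with n; that prime lies in S, so the sieve vanishes
  -- there.
  ∑-sieve≤φ : ∀ {S} n .{{_ : NonZero n}} → (∀ {q} → Prime q → q ∣ n → q ∈ S) → ∑ (sieve S ∘ suc) n ≤ φ n
  ∑-sieve≤φ {S} n ∈S = ∑≤length-filter (λ k → coprime? k n) (sieve S) suc n (sieve≤1 S) zero-off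
    where
    zero-off : ∀ i → ¬ Coprime i n → sieve S i ≡ 0
    zero-off i ¬c with sieve S i ≟ 0
    ... | yes ≡0 = ≡0
    ... | no  ≢0 = ⊥-elim (¬c (coprime-by-primes λ pq q∣n q∣i → ≢0 (sieve-∈ (∈S pq q∣n) q∣i)))

  -- S lists the distinct primes of n, and j collects their repetitions, so that φ n can be compared
  -- with j * ∏φ S.
  record Radical (n : ℕ) : Set where
    field
      S        : List ℕ
      j        : ℕ
      unique   : Unique S
      primes   : All Prime S
      n≡       : n ≡ j * product S
      complete : ∀ {q} → Prime q → q ∣ n → q ∈ S

  radical-product : ∀ {ps} → All Prime ps → Radical (product ps)
  radical-product [] = record
    { S = [] ; j = 1 ; unique = [] ; primes = [] ; n≡ = refl
    ; complete = λ pq q∣1 → contradiction (subst Prime (∣1⇒≡1 q∣1) pq) ¬prime[1] }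
  radical-product {p ∷ ps} (pp ∷ pps) with radical-product pps
  ... | record { S = S ; j = j ; unique = u ; primes = pS ; n≡ = n≡ ; complete = c } with ∈-dec _≟_ p S
  ... | yes p∈S = record
    { S = S ; j = p * j ; unique = u ; primes = pS
    ; n≡ = trans (cong (p *_) n≡) (sym (*-assoc p j (product S)))
    ; complete = λ {q} pq q∣n → case pq (euclidsLemma p (product ps) pq q∣n) }
    where
    case : ∀ {q} → Prime q → _ → q ∈ S
    case pq (inj₂ q∣ps) = c pq q∣ps
    case pq (inj₁ q∣p) with prime⇒irreducible pp q∣p
    ... | inj₁ refl = contradiction pq ¬prime[1]
    ... | inj₂ refl = p∈S
  ... | no p∉S = record
    { S = p ∷ S ; j = j ; unique = ¬Any⇒All¬ S p∉S ∷ u ; primes = pp ∷ pS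
    ; n≡ = trans (cong (p *_) n≡) (swap p j (product S))
    ; complete = λ {q} pq q∣n → case pq (euclidsLemma p (product ps) pq q∣n) }
    where
    swap : ∀ p j P → p * (j * P) ≡ j * (p * P)
    swap = solve-∀
    case : ∀ {q} → Prime q → _ → q ∈ p ∷ S
    case pq (inj₂ q∣ps) = there (c pq q∣ps)
    case pq (inj₁ q∣p) with prime⇒irreducible pp q∣p
    ... | inj₁ refl = contradiction pq ¬prime[1]
    ... | inj₂ refl = here refl

  radical : ∀ n .{{_ : NonZero n}} → Radical n
  radical n = subst Radical (sym (PrimeFactorisation.isFactorisation f)) (radical-product (PrimeFactorisation.factorsPrime f))
    where f = factorise n

  ∏φ≤φ : ∀ {S} j → Unique S → All Prime S → .{{_ : NonZero (j * product S)}} →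
         (∀ {q} → Prime q → q ∣ j * product S → q ∈ S) → j * ∏φ S ≤ φ (j * product S)
  ∏φ≤φ {S} j uS pS ∈S = subst (_≤ φ (j * product S)) (∑-sieve j uS pS) (∑-sieve≤φ (j * product S) ∈S)

  φ<n : ∀ n .{{_ : NonTrivial n}} → φ n < n
  φ<n n@(suc (suc n′)) = subst (φ n <_) (length-applyUpTo suc n)
    (filter-notAll (λ k → coprime? k n) [1⋯ n ] (lose (∈-applyUpTo⁺ suc {suc n′} ≤-refl)
      λ c → contradiction (c {n} (∣-refl , ∣-refl)) λ ()))

  φ≤γ : ∀ {k} d .{{_ : NonZero d}} → k ∣ d → φ k ≤ γ d
  φ≤γ {zero}  d@(suc _) 0∣d = contradiction (0∣⇒≡0 0∣d) λ ()
  φ≤γ {suc k} d k∣d = v≤max⁺ 0 _ (inj₂ (lose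
    (∈-map⁺ φ (∈-filter⁺ (_∣? d) (∈-applyUpTo⁺ suc (∣⇒≤ k∣d)) k∣d)) ≤-refl))

  γ≤d∸1 : ∀ d → 1 < d → γ d ≤ d ∸ 1
  γ≤d∸1 d@(suc d′) 1<d@(s<s 0<d′) = max≤v⁺ z≤n (All.tabulate bound)
    where
    bound : ∀ {v} → v ∈ map φ (filter (_∣? d) [1⋯ d ]) → v ≤ d′
    bound v∈ with ∈-map⁻ φ v∈
    ... | k , k∈ , refl with ∈-filter⁻ (_∣? d) {xs = [1⋯ d ]} k∈
    bound v∈ | 0 , k∈ , refl | _ , 0∣d = contradiction (0∣⇒≡0 0∣d) λ ()
    bound v∈ | 1 , k∈ , refl | _ , _ = 0<d′
    bound v∈ | k@(suc (suc _)) , k∈ , refl | _ , k∣d = s≤s⁻¹ (<-≤-trans (φ<n k) (∣⇒≤ k∣d))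

  γ-prime : ∀ d → Prime d → γ d ≡ d ∸ 1
  γ-prime d pd = ≤-antisym (γ≤d∸1 d (nonTrivial⇒n>1 d {{prime⇒nonTrivial pd}})) (begin
    d ∸ 1 ≡⟨ pred≡ d ⟨
    1 * ∏φ (d ∷ []) ≤⟨ ∏φ≤φ 1 ([] ∷ []) (pd ∷ []) {{subst NonZero (sym eq) (prime⇒nonZero pd)}} complete ⟩
    φ (1 * product (d ∷ [])) ≤⟨ φ≤γ d {{prime⇒nonZero pd}} (∣-reflexive eq) ⟩
    γ d ∎)
    where
    open ≤-Reasoning
    eq : 1 * (d * 1) ≡ d
    eq = trans (*-identityˡ _) (*-identityʳ d)
    pred≡ : ∀ d → 1 * (pred d * 1) ≡ d ∸ 1
    pred≡ zero    = refl
    pred≡ (suc d) = trans (*-identityˡ _) (*-identityʳ d)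
    complete : ∀ {q} → Prime q → q ∣ 1 * (d * 1) → q ∈ d ∷ []
    complete {q} pq q∣ with prime⇒irreducible pd (subst (q ∣_) eq q∣)
    ... | inj₁ refl = contradiction pq ¬prime[1]
    ... | inj₂ refl = here refl

  module _ {Y : ℕ} {x : ℤ} (∣x∣<Y : ℤ.∣ x ∣ < Y) (coprime : Coprime Y ℤ.∣ x ∣) where

    open Difference Y x ∣x∣<Y coprime using (D; Y≢0)
    open Size Y x ∣x∣<Y coprime using (prime≤)

    -- The decomposition of k from `radical` turns the exponent j * ∏φ S of `prime≤` into φ k. Since
    -- k ≠ 1, the list S is nonempty, which is the case in which the factor D 1 / Y has cancelled.
    primitive-prime≤ : ∀ {p} k .{{_ : NonTrivial k}} → Odd k → Prime p → p ∣ D k →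
                       (∀ i .{{_ : NonZero i}} → i < k → ¬ p ∣ D i) → p ≤ (512 * Y) ^ φ k
    primitive-prime≤ {p} k k-odd pp p∣D p∤D with radical k {{nonTrivial⇒nonZero k}}
    ... | record { S = [] ; complete = c } with prime-divisor k
    ...   | q , pq , q∣k = contradiction (c pq q∣k) λ ()
    primitive-prime≤ {p} k k-odd pp p∣D p∤D
        | record { S = q ∷ S ; j = j ; unique = u ; primes = pS ; n≡ = refl ; complete = c } =
      ≤-trans (prime≤ q S j {{odd⇒nonZero j-odd}} pp pS u S-odd j-odd p∣D p∤D)
        (^-monoʳ-≤ (512 * Y) {{m*n≢0 512 Y}} (∏φ≤φ j u pS {{odd⇒nonZero k-odd}} c))
      where
      j-odd : Odd j
      j-odd 2∣j = k-odd (∣m⇒∣m*n _ 2∣j)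
      S-odd : All Odd (q ∷ S)
      S-odd = All.tabulate λ r∈S 2∣r → k-odd (∣n⇒∣m*n j (∣-trans 2∣r (∈⇒∣product r∈S)))
        where open import Data.Nat.ListAction.Properties using (∈⇒∣product)

-- Arithmetic and sums over the residues modulo p.

module Modular where

  open import Algebra.Bundles using (CommutativeMonoid; CommutativeRing)
  open import Data.Fin.Base using (Fin; toℕ; fromℕ<)
  open import Data.Fin.Permutation using (Permutation; permutation)
  open import Data.Fin.Properties using (toℕ<n; toℕ-fromℕ<; toℕ-injective)
  open import Data.Integer.Base
  open import Data.Integer.Divisibility.Signed as ℤ using (_∣_; divides; ∣⇒∣ᵤ; ∣ᵤ⇒∣; ∣m∣n⇒∣m+n; ∣m⇒∣-m; ∣n⇒∣m*n)
  open import Data.Integer.DivMod using (_%ℕ_; _/ℕ_; n%ℕd<d; a≡a%ℕn+[a/ℕn]*n)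
  open import Data.Integer.Properties
  open import Data.Integer.Tactic.RingSolver using (solve-∀)
  open import Data.Nat.Base as ℕ using (ℕ)
  import Data.Nat.Divisibility as ℕ
  import Data.Nat.Properties as ℕ
  open import Data.Nat.Primality using (Prime; euclidsLemma)
  open import Data.Product.Base using (_,_)
  open import Data.Sum.Base using (_⊎_; inj₁; inj₂)
  open import Function.Base using (_∘_)
  open import Level using (0ℓ)
  open import Relation.Binary.PropositionalEquality
  open import Relation.Nullary using (¬_; Dec; contradiction)
  open import Relation.Nullary.Decidable using (map′)

  module Mod (p : ℕ) .{{p≢0 : ℕ.NonZero p}} where

    infix 4 _≈_ _≈?_

    -- A record, so that a and b can be recovered from the type; the difference a - b alone would
    -- not determine them.
    record _≈_ (a b : ℤ) : Set where
      constructor mk≈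
      field
        p∣diff : + p ∣ a - b

    open _≈_ public

    ≡⇒≈ : ∀ {a b} → a ≡ b → a ≈ b
    ≡⇒≈ {a} refl = mk≈ (divides (+ 0) (+-inverseʳ a))

    by : ∀ {a b} c → a - b ≡ c * + p → a ≈ b
    by c eq = mk≈ (divides c eq)

    ≈-sym : ∀ {a b} → a ≈ b → b ≈ a
    ≈-sym {a} {b} (mk≈ d) = mk≈ (subst (+ p ∣_) (lemma a b) (∣m⇒∣-m d))
      where
      lemma : ∀ a b → - (a - b) ≡ b - a
      lemma = solve-∀

    ≈-trans : ∀ {a b c} → a ≈ b → b ≈ c → a ≈ c
    ≈-trans {a} {b} {c} (mk≈ d) (mk≈ e) = mk≈ (subst (+ p ∣_) (lemma a b c) (∣m∣n⇒∣m+n d e))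
      where
      lemma : ∀ a b c → (a - b) + (b - c) ≡ a - c
      lemma = solve-∀

    +-cong-≈ : ∀ {a a′ b b′} → a ≈ a′ → b ≈ b′ → a + b ≈ a′ + b′
    +-cong-≈ {a} {a′} {b} {b′} (mk≈ d) (mk≈ e) = mk≈ (subst (+ p ∣_) (lemma a a′ b b′) (∣m∣n⇒∣m+n d e))
      where
      lemma : ∀ a a′ b b′ → (a - a′) + (b - b′) ≡ a + b - (a′ + b′)
      lemma = solve-∀

    *-cong-≈ : ∀ {a a′ b b′} → a ≈ a′ → b ≈ b′ → a * b ≈ a′ * b′
    *-cong-≈ {a} {a′} {b} {b′} (mk≈ d) (mk≈ e) = mk≈ (subst (+ p ∣_) (lemma a a′ b b′)
      (∣m∣n⇒∣m+n (∣n⇒∣m*n b d) (∣n⇒∣m*n a′ e)))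
      where
      lemma : ∀ a a′ b b′ → b * (a - a′) + a′ * (b - b′) ≡ a * b - a′ * b′
      lemma = solve-∀

    neg-cong-≈ : ∀ {a a′} → a ≈ a′ → - a ≈ - a′
    neg-cong-≈ {a} {a′} (mk≈ d) = mk≈ (subst (+ p ∣_) (lemma a a′) (∣m⇒∣-m d))
      where
      lemma : ∀ a a′ → - (a - a′) ≡ - a - (- a′)
      lemma = solve-∀

    ℤ/p : CommutativeRing 0ℓ 0ℓ
    ℤ/p = record
      { Carrier = ℤ ; _≈_ = _≈_ ; _+_ = _+_ ; _*_ = _*_ ; -_ = -_ ; 0# = + 0 ; 1# = + 1
      ; isCommutativeRing = record
        { isRing = record
          { +-isAbelianGroup = record
            { isGroup = record
              { isMonoid = record
                { isSemigroup = record
                  { isMagma = record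
                    { isEquivalence = record { refl = ≡⇒≈ refl ; sym = ≈-sym ; trans = ≈-trans }
                    ; ∙-cong = +-cong-≈ }
                  ; assoc = λ a b c → ≡⇒≈ (+-assoc a b c) }
                ; identity = (λ a → ≡⇒≈ (+-identityˡ a)) , (λ a → ≡⇒≈ (+-identityʳ a)) }
              ; inverse = (λ a → ≡⇒≈ (+-inverseˡ a)) , (λ a → ≡⇒≈ (+-inverseʳ a))
              ; ⁻¹-cong = neg-cong-≈ }
            ; comm = λ a b → ≡⇒≈ (+-comm a b) }
          ; *-cong = *-cong-≈
          ; *-assoc = λ a b c → ≡⇒≈ (*-assoc a b c)
          ; *-identity = (λ a → ≡⇒≈ (*-identityˡ a)) , (λ a → ≡⇒≈ (*-identityʳ a))
          ; distrib = (λ a b c → ≡⇒≈ (*-distribˡ-+ a b c)) , (λ a b c → ≡⇒≈ (*-distribʳ-+ a b c)) }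
        ; *-comm = λ a b → ≡⇒≈ (*-comm a b) } }

    open CommutativeRing ℤ/p public using (setoid)
      renaming (refl to ≈-refl; *-commutativeMonoid to *-commutativeMonoid-≈)

    *-congˡ-≈ : ∀ c {a b} → a ≈ b → c * a ≈ c * b
    *-congˡ-≈ c a≈b = *-cong-≈ (≈-refl {c}) a≈b

    *-congʳ-≈ : ∀ c {a b} → a ≈ b → a * c ≈ b * c
    *-congʳ-≈ c a≈b = *-cong-≈ a≈b (≈-refl {c})

    +-congʳ-≈ : ∀ c {a b} → a ≈ b → a + c ≈ b + c
    +-congʳ-≈ c a≈b = +-cong-≈ a≈b (≈-refl {c})

    +-congˡ-≈ : ∀ c {a b} → a ≈ b → c + a ≈ c + b
    +-congˡ-≈ c a≈b = +-cong-≈ (≈-refl {c}) a≈b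

    _≈?_ : ∀ a b → Dec (a ≈ b)
    a ≈? b = map′ mk≈ p∣diff (+ p ℤ.∣? (a - b))

    ^-cong-≈ : ∀ {a b} n → a ≈ b → a ^ n ≈ b ^ n
    ^-cong-≈ ℕ.zero    a≈b = ≈-refl
    ^-cong-≈ (ℕ.suc n) a≈b = *-cong-≈ a≈b (^-cong-≈ n a≈b)

    residue : ℤ → ℕ
    residue a = a %ℕ p

    residue<p : ∀ a → residue a ℕ.< p
    residue<p a = n%ℕd<d a p

    residue≈ : ∀ a → + residue a ≈ a
    residue≈ a = by (- (a /ℕ p)) (trans (cong (λ t → + residue a - t) (a≡a%ℕn+[a/ℕn]*n a p)) (lemma (+ residue a) (a /ℕ p) (+ p)))
      where
      lemma : ∀ r q p → r - (r + q * p) ≡ - q * p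
      lemma = solve-∀

    ∣∧<⇒≡0 : ∀ {n} → p ℕ.∣ n → n ℕ.< p → n ≡ 0
    ∣∧<⇒≡0 {ℕ.zero}  p∣n n<p = refl
    ∣∧<⇒≡0 {ℕ.suc n} p∣n n<p = contradiction (ℕ.∣⇒≤ p∣n) (ℕ.<⇒≱ n<p)

    ≈⇒≡ : ∀ {m n} → m ℕ.< p → n ℕ.< p → + m ≈ + n → m ≡ n
    ≈⇒≡ {m} {n} m<p n<p (mk≈ d) = +-injective (i-j≡0⇒i≡j (+ m) (+ n) (∣i∣≡0⇒i≡0 (∣∧<⇒≡0 (∣⇒∣ᵤ d) ∣m-n∣<p)))
      where
      ∣m-n∣<p : ∣ + m - + n ∣ ℕ.< p
      ∣m-n∣<p = subst (ℕ._< p) (sym (trans (cong ∣_∣ (m-n≡m⊖n m n)) (∣m⊖n∣≡ m n))) (ℕ.≤-<-trans (ℕ.∣m-n∣≤m⊔n m n) (ℕ.⊔-lub m<p n<p))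
        where
        ∣m⊖n∣≡ : ∀ m n → ∣ m ⊖ n ∣ ≡ ℕ.∣ m - n ∣
        ∣m⊖n∣≡ m n with ℕ.≤-total m n
        ... | inj₁ m≤n = trans (∣⊖∣-≤ m≤n) (sym (ℕ.m≤n⇒∣m-n∣≡n∸m m≤n))
        ... | inj₂ n≤m = trans (∣m⊖n∣≡∣n⊖m∣ m n) (trans (∣⊖∣-≤ n≤m) (sym (trans (ℕ.∣-∣-comm m n) (ℕ.m≤n⇒∣m-n∣≡n∸m n≤m))))

    residue-cong : ∀ {a b} → a ≈ b → residue a ≡ residue b
    residue-cong {a} {b} a≈b = ≈⇒≡ (residue<p a) (residue<p b) (≈-trans (residue≈ a) (≈-trans a≈b (≈-sym (residue≈ b))))

    residue-< : ∀ {n} → n ℕ.< p → residue (+ n) ≡ n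
    residue-< {n} n<p = ≈⇒≡ (residue<p (+ n)) n<p (residue≈ (+ n))

    private
      toRes : ℤ → Fin p
      toRes a = fromℕ< (residue<p a)

      toRes≈ : ∀ a → + toℕ (toRes a) ≈ a
      toRes≈ a = ≈-trans (≡⇒≈ (cong +_ (toℕ-fromℕ< (residue<p a)))) (residue≈ a)

    -- Over an arbitrary commutative monoid because three instances occur: sums in ℕ, character sums
    -- in ℂ, and products modulo p.
    module Sums {c ℓ} (M : CommutativeMonoid c ℓ) where
      open CommutativeMonoid M using (Carrier) renaming (_≈_ to _≈ᴹ_; trans to transᴹ; sym to symᴹ)
      open import Algebra.Properties.CommutativeMonoid.Sum M using (sum; sum-permute; sum-cong-≋; ∑-comm)

      ∑ₚ : (ℤ → Carrier) → Carrier
      ∑ₚ f = sum {p} (λ i → f (+ toℕ i))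

      Periodic : (ℤ → Carrier) → Set ℓ
      Periodic f = ∀ {a b} → a ≈ b → f a ≈ᴹ f b

      ∑ₚ-cong : ∀ {f g} → (∀ a → f a ≈ᴹ g a) → ∑ₚ f ≈ᴹ ∑ₚ g
      ∑ₚ-cong f≗g = sum-cong-≋ {p} (λ i → f≗g (+ toℕ i))

      ∑ₚ-comm : ∀ (f : ℤ → ℤ → Carrier) → ∑ₚ (λ a → ∑ₚ (f a)) ≈ᴹ ∑ₚ (λ b → ∑ₚ (λ a → f a b))
      ∑ₚ-comm f = ∑-comm {p} {p} (λ i j → f (+ toℕ i) (+ toℕ j))

      ∑ₚ-permute : ∀ {f} → Periodic f → (π ρ : ℤ → ℤ) → (∀ {a b} → a ≈ b → π a ≈ π b) → (∀ {a b} → a ≈ b → ρ a ≈ ρ b) →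
                   (∀ a → π (ρ a) ≈ a) → (∀ a → ρ (π a) ≈ a) → ∑ₚ (f ∘ π) ≈ᴹ ∑ₚ f
      ∑ₚ-permute {f} f-per π ρ π-cong ρ-cong πρ ρπ = transᴹ
        (sum-cong-≋ {p} (λ i → f-per (≈-sym (toRes≈ (π (+ toℕ i))))))
        (symᴹ (sum-permute {p} {p} (λ i → f (+ toℕ i)) perm))
        where
        to from : Fin p → Fin p
        to   i = toRes (π (+ toℕ i))
        from i = toRes (ρ (+ toℕ i))
        cancel : ∀ σ τ → (∀ {a b} → a ≈ b → σ a ≈ σ b) → (∀ a → σ (τ a) ≈ a) →
                 ∀ i → toRes (σ (+ toℕ (toRes (τ (+ toℕ i))))) ≡ i
        cancel σ τ σ-cong στ i = toℕ-injective (≈⇒≡ (toℕ<n (toRes (σ (+ toℕ (toRes (τ (+ toℕ i))))))) (toℕ<n i)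
          (≈-trans (toRes≈ (σ (+ toℕ (toRes (τ (+ toℕ i))))))
            (≈-trans (σ-cong (toRes≈ (τ (+ toℕ i)))) (στ (+ toℕ i)))))
        perm : Permutation p p
        perm = permutation to from (cancel π ρ π-cong πρ) (cancel ρ π ρ-cong ρπ)

      ∑ₚ-shift : ∀ {f} c → Periodic f → ∑ₚ (λ a → f (a + c)) ≈ᴹ ∑ₚ f
      ∑ₚ-shift c f-per = ∑ₚ-permute f-per (_+ c) (_- c) (+-congʳ-≈ c) (+-congʳ-≈ (- c))
        (λ a → ≡⇒≈ (lemma a c)) (λ a → ≡⇒≈ (lemma′ a c))
        where
        lemma : ∀ a c → a - c + c ≡ a
        lemma = solve-∀
        lemma′ : ∀ a c → a + c - c ≡ a
        lemma′ = solve-∀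

      ∑ₚ-scale : ∀ {f} u v → u * v ≈ + 1 → Periodic f → ∑ₚ (λ a → f (u * a)) ≈ᴹ ∑ₚ f
      ∑ₚ-scale u v uv≈1 f-per = ∑ₚ-permute f-per (u *_) (v *_) (*-congˡ-≈ u) (*-congˡ-≈ v)
        (λ a → ≈-trans (≡⇒≈ (sym (*-assoc u v a))) (≈-trans (*-congʳ-≈ a uv≈1) (≡⇒≈ (*-identityˡ a))))
        (λ a → ≈-trans (≡⇒≈ (trans (sym (*-assoc v u a)) (cong (_* a) (*-comm v u)))) (≈-trans (*-congʳ-≈ a uv≈1) (≡⇒≈ (*-identityˡ a))))

    module _ (p-prime : Prime p) where
      prime-cancelˡ : ∀ {a b c} → ¬ a ≈ + 0 → a * b ≈ a * c → b ≈ c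
      prime-cancelˡ {a} {b} {c} a≉0 (mk≈ d) = cases (euclidsLemma ∣ a ∣ ∣ b - c ∣ p-prime
        (subst (p ℕ.∣_) (abs-* a (b - c)) (∣⇒∣ᵤ (subst (+ p ∣_) (lemma a b c) d))))
        where
        lemma : ∀ a b c → a * b - a * c ≡ a * (b - c)
        lemma = solve-∀
        cases : p ℕ.∣ ∣ a ∣ ⊎ p ℕ.∣ ∣ b - c ∣ → b ≈ c
        cases (inj₂ p∣b-c) = mk≈ (∣ᵤ⇒∣ p∣b-c)
        cases (inj₁ p∣a)   = contradiction (mk≈ (∣ᵤ⇒∣ (subst (λ t → p ℕ.∣ ∣ t ∣) (sym (+-identityʳ a)) p∣a))) a≉0

    ≈0-small : ∀ {a} → ∣ a ∣ ℕ.< p → a ≈ + 0 → a ≡ + 0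
    ≈0-small {a} a<p (mk≈ d) = ∣i∣≡0⇒i≡0 (∣∧<⇒≡0 (subst (λ t → p ℕ.∣ ∣ t ∣) (+-identityʳ a) (∣⇒∣ᵤ d)) a<p)

-- Sums of p - max(u, v) along lines modulo p.

module LineSums where

  open Modular
  open import Data.Fin.Base as Fin using (Fin; toℕ)
  open import Data.Fin.Properties using (toℕ<n)
  open import Data.Integer.Base as ℤ using (ℤ; +_; -[1+_])
  import Data.Integer.Properties as ℤ
  import Data.Integer.Tactic.RingSolver as ℤ
  open import Data.Nat.Base
  open import Data.Nat.Properties
  open import Data.Nat.Tactic.RingSolver using (solve-∀)
  open import Function.Base using (_∘_)
  open import Relation.Binary.PropositionalEquality
  open import Algebra.Properties.CommutativeMonoid.Sum +-0-commutativeMonoid using (sum; sum-cong-≗; ∑-distrib-+)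

  sum-mono : ∀ {n} {f g : Fin n → ℕ} → (∀ i → f i ≤ g i) → sum f ≤ sum g
  sum-mono {zero}  f≤g = z≤n
  sum-mono {suc n} f≤g = +-mono-≤ (f≤g Fin.zero) (sum-mono (f≤g ∘ Fin.suc))

  sum-const : ∀ n c → sum {n} (λ _ → c) ≡ n * c
  sum-const zero    c = refl
  sum-const (suc n) c = cong (_+_ c) (sum-const n c)

  ∣+-+∣≤ : ∀ a b c d → ∣ a + b - c + d ∣ ≤ ∣ a - c ∣ + ∣ b - d ∣
  ∣+-+∣≤ a b c d = begin
    ∣ a + b - c + d ∣ ≤⟨ ∣-∣-triangle (a + b) (c + b) (c + d) ⟩
    ∣ a + b - c + b ∣ + ∣ c + b - c + d ∣ ≡⟨ cong₂ _+_ (trans (cong₂ ∣_-_∣ (+-comm a b) (+-comm c b)) (∣m+n-m+o∣≡∣n-o∣ b a c)) (∣m+n-m+o∣≡∣n-o∣ c b d) ⟩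
    ∣ a - c ∣ + ∣ b - d ∣ ∎
    where open ≤-Reasoning

  sum-∣-∣ : ∀ {n} (f g : Fin n → ℕ) → ∣ sum f - sum g ∣ ≤ sum (λ i → ∣ f i - g i ∣)
  sum-∣-∣ {zero}  f g = z≤n
  sum-∣-∣ {suc n} f g = ≤-trans (∣+-+∣≤ (f Fin.zero) _ (g Fin.zero) _)
    (+-monoʳ-≤ ∣ f Fin.zero - g Fin.zero ∣ (sum-∣-∣ (f ∘ Fin.suc) (g ∘ Fin.suc)))

  -- Made for `jump`, which is at most 1 except where the residue falls back from p - 1 to 0.
  sum≤last : ∀ m (f : ℕ → ℕ) → (∀ i → i < m → f i ≤ 1) → sum {suc m} (f ∘ toℕ) ≤ m + f m
  sum≤last zero    f f≤1 = ≤-reflexive (+-identityʳ (f 0))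
  sum≤last (suc m) f f≤1 = +-mono-≤ (f≤1 0 z<s) (sum≤last m (f ∘ suc) (λ i i<m → f≤1 (suc i) (s<s i<m)))

  ∸-lipschitz : ∀ p a b → ∣ p ∸ a - p ∸ b ∣ ≤ ∣ a - b ∣
  ∸-lipschitz zero    a       b       = ≤-trans (≤-reflexive (cong₂ ∣_-_∣ (0∸n≡0 a) (0∸n≡0 b))) z≤n
  ∸-lipschitz (suc p) zero    zero    = ≤-reflexive (∣n-n∣≡0 (suc p))
  ∸-lipschitz (suc p) zero    (suc b) = ≤-trans (≤-reflexive
    (trans (∣-∣-comm (suc p) (p ∸ b)) (m≤n⇒∣m-n∣≡n∸m (≤-trans (m∸n≤m p b) (n≤1+n p)))))
    (m≤n+o⇒m∸n≤o (suc p) (p ∸ b) (≤-trans (s≤s (m≤n+m∸n p b)) (≤-reflexive (trans (+-comm (suc b) (p ∸ b)) refl))))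
  ∸-lipschitz (suc p) (suc a) zero    = subst (_≤ suc a) (∣-∣-comm (suc p) (p ∸ a)) (∸-lipschitz (suc p) zero (suc a))
  ∸-lipschitz (suc p) (suc a) (suc b) = ∸-lipschitz p a b

  ⊔-lipschitz : ∀ a b c → ∣ a ⊔ b - a ⊔ c ∣ ≤ ∣ b - c ∣
  ⊔-lipschitz zero    b       c       = ≤-refl
  ⊔-lipschitz (suc a) zero    zero    = ≤-reflexive (∣n-n∣≡0 (suc a))
  ⊔-lipschitz (suc a) (suc b) zero    = ≤-trans (≤-trans (≤-reflexive (∣-∣-comm (a ⊔ b) a))
    (subst (λ t → ∣ t - a ⊔ b ∣ ≤ b) (⊔-identityʳ a) (⊔-lipschitz a zero b))) (n≤1+n b)
  ⊔-lipschitz (suc a) zero    (suc c) = ≤-trans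
    (subst (λ t → ∣ t - a ⊔ c ∣ ≤ c) (⊔-identityʳ a) (⊔-lipschitz a zero c)) (n≤1+n c)
  ⊔-lipschitz (suc a) (suc b) (suc c) = ⊔-lipschitz a b c

  ∑∸ : ∀ n → 2 * sum {n} (λ b → n ∸ toℕ b) ≡ n * suc n
  ∑∸ zero    = refl
  ∑∸ (suc n) = begin
    2 * (suc n + sum {n} (λ b → n ∸ toℕ b)) ≡⟨ *-distribˡ-+ 2 (suc n) _ ⟩
    2 * suc n + 2 * sum {n} (λ b → n ∸ toℕ b) ≡⟨ cong (_+_ (2 * suc n)) (∑∸ n) ⟩
    2 * suc n + n * suc n ≡⟨ lemma n ⟩
    suc n * suc (suc n) ∎
    where
    open ≡-Reasoning
    lemma : ∀ n → 2 * suc n + n * suc n ≡ suc n * suc (suc n)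
    lemma = solve-∀

  ∑∑∸⊔ : ∀ n → 6 * sum {n} (λ a → sum {n} (λ b → n ∸ (toℕ a ⊔ toℕ b))) ≡ n * (suc n * suc (2 * n))
  ∑∑∸⊔ zero    = refl
  ∑∑∸⊔ (suc n) = begin
    6 * (t (suc n) + sum {n} (λ a → (n ∸ toℕ a) + sum {n} (λ b → n ∸ (toℕ a ⊔ toℕ b))))
      ≡⟨ cong (λ s → 6 * (t (suc n) + s)) (∑-distrib-+ {n} (λ a → n ∸ toℕ a) _) ⟩
    6 * (t (suc n) + (t n + s))
      ≡⟨ regroup (t (suc n)) (t n) s ⟩
    3 * (2 * t (suc n)) + (3 * (2 * t n) + 6 * s)
      ≡⟨ cong₂ (λ a b → 3 * a + b) (∑∸ (suc n)) (cong₂ (λ a b → 3 * a + b) (∑∸ n) (∑∑∸⊔ n)) ⟩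
    3 * (suc n * suc (suc n)) + (3 * (n * suc n) + n * (suc n * suc (2 * n)))
      ≡⟨ lemma n ⟩
    suc n * (suc (suc n) * suc (2 * suc n)) ∎
    where
    open ≡-Reasoning
    t : ℕ → ℕ
    t n = sum {n} (λ b → n ∸ toℕ b)
    s : ℕ
    s = sum {n} (λ a → sum {n} (λ b → n ∸ (toℕ a ⊔ toℕ b)))
    regroup : ∀ a b s → 6 * (a + (b + s)) ≡ 3 * (2 * a) + (3 * (2 * b) + 6 * s)
    regroup = solve-∀
    lemma : ∀ n → 3 * (suc n * suc (suc n)) + (3 * (n * suc n) + n * (suc n * suc (2 * n))) ≡ suc n * (suc (suc n) * suc (2 * suc n))
    lemma = solve-∀

  walk⁺ : ∀ (f : ℤ → ℕ) c K → (∀ e → ∣ f (e ℤ.+ c) - f e ∣ ≤ K) →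
          ∀ n e → ∣ f (+ n ℤ.* c ℤ.+ e) - f e ∣ ≤ K * n
  walk⁺ f c K step zero e = ≤-trans (≤-reflexive (trans (cong (λ t → ∣ f t - f e ∣)
    (trans (cong (ℤ._+ e) (ℤ.*-zeroˡ c)) (ℤ.+-identityˡ e))) (∣n-n∣≡0 (f e)))) z≤n
  walk⁺ f c K step (suc n) e = begin
    ∣ f (+ suc n ℤ.* c ℤ.+ e) - f e ∣ ≡⟨ cong (λ t → ∣ f t - f e ∣) (lemma (+ n) c e) ⟩
    ∣ f (+ n ℤ.* c ℤ.+ e ℤ.+ c) - f e ∣ ≤⟨ ∣-∣-triangle (f (+ n ℤ.* c ℤ.+ e ℤ.+ c)) (f (+ n ℤ.* c ℤ.+ e)) (f e) ⟩
    ∣ f (+ n ℤ.* c ℤ.+ e ℤ.+ c) - f (+ n ℤ.* c ℤ.+ e) ∣ + ∣ f (+ n ℤ.* c ℤ.+ e) - f e ∣ ≤⟨ +-mono-≤ (step _) (walk⁺ f c K step n e) ⟩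
    K + K * n ≡⟨ *-suc K n ⟨
    K * suc n ∎
    where
    open ≤-Reasoning
    lemma : ∀ n c e → (+ 1 ℤ.+ n) ℤ.* c ℤ.+ e ≡ n ℤ.* c ℤ.+ e ℤ.+ c
    lemma = ℤ.solve-∀
  walk : ∀ (f : ℤ → ℕ) c K → (∀ e → ∣ f (e ℤ.+ c) - f e ∣ ≤ K) →
         ∀ n e → ∣ f (n ℤ.* c ℤ.+ e) - f e ∣ ≤ K * ℤ.∣ n ∣
  walk f c K step (+ n)    e = walk⁺ f c K step n e
  walk f c K step -[1+ n ] e = begin
    ∣ f (-[1+ n ] ℤ.* c ℤ.+ e) - f e ∣ ≡⟨ ∣-∣-comm _ (f e) ⟩
    ∣ f e - f e′ ∣ ≡⟨ cong (λ t → ∣ f t - f e′ ∣) (lemma (+ suc n) c e) ⟨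
    ∣ f (+ suc n ℤ.* c ℤ.+ e′) - f e′ ∣ ≤⟨ walk⁺ f c K step (suc n) e′ ⟩
    K * suc n ∎
    where
    open ≤-Reasoning
    e′ : ℤ
    e′ = -[1+ n ] ℤ.* c ℤ.+ e
    lemma : ∀ m c e → m ℤ.* c ℤ.+ ((ℤ.- m) ℤ.* c ℤ.+ e) ≡ e
    lemma = ℤ.solve-∀

  module Equidistribution (p : ℕ) .{{p≢0 : NonZero p}} where
    open Mod p
    open Sums +-0-commutativeMonoid

    -- The number of N < p that are at least both residues, so a pair (n₁, n₂) with equal character
    -- values is counted `weight` times over all N.
    weight : ℤ → ℤ → ℕ
    weight u v = p ∸ (residue u ⊔ residue v)

    weight-cong : ∀ {u u′ v v′} → u ≈ u′ → v ≈ v′ → weight u v ≡ weight u′ v′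
    weight-cong u≈ v≈ = cong₂ (λ a b → p ∸ (a ⊔ b)) (residue-cong u≈) (residue-cong v≈)

    weight-comm : ∀ u v → weight u v ≡ weight v u
    weight-comm u v = cong (p ∸_) (⊔-comm (residue u) (residue v))

    jump : ℤ → ℕ
    jump v = ∣ residue (v ℤ.+ + 1) - residue v ∣

    jump-periodic : Periodic jump
    jump-periodic e = cong₂ ∣_-_∣ (residue-cong (+-congʳ-≈ (+ 1) e)) (residue-cong e)

    ∑jump : ∑ₚ jump ≤ 2 * p
    ∑jump = go p refl
      where
      go : ∀ q → p ≡ q → ∑ₚ jump ≤ 2 * p
      go zero refl = z≤n
      go (suc m) refl = begin
        ∑ₚ jump ≤⟨ sum≤last m (jump ∘ (+_)) small ⟩
        m + jump (+ m) ≤⟨ +-mono-≤ (n≤1+n m) (≤-trans (∣m-n∣≤m⊔n (residue (+ m ℤ.+ + 1)) (residue (+ m)))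
                                     (⊔-lub (<⇒≤ (residue<p (+ m ℤ.+ + 1))) (<⇒≤ (residue<p (+ m))))) ⟩
        suc m + suc m ≡⟨ cong (_+_ (suc m)) (+-identityʳ (suc m)) ⟨
        2 * suc m ∎
        where
        open ≤-Reasoning
        small : ∀ i → i < m → jump (+ i) ≤ 1
        small i i<m = ≤-reflexive (trans (cong₂ ∣_-_∣
          (trans (cong (λ t → residue (+ t)) (+-comm i 1)) (residue-< (s<s i<m)))
          (residue-< (<-trans i<m (n<1+n m))))
          (trans (∣-∣-comm (suc i) i) (trans (m≤n⇒∣m-n∣≡n∸m (n≤1+n i)) (m+n∸n≡m 1 i))))

    weight-step : ∀ u v → ∣ weight u (v ℤ.+ + 1) - weight u v ∣ ≤ jump v
    weight-step u v = ≤-trans (∸-lipschitz p (residue u ⊔ residue (v ℤ.+ + 1)) (residue u ⊔ residue v))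
      (⊔-lipschitz (residue u) (residue (v ℤ.+ + 1)) (residue v))

    module Line (h : ℤ) (h′ : ℤ) (hh′≈1 : h ℤ.* h′ ≈ + 1) where

      line : ℤ → ℕ
      line e = ∑ₚ (λ u → weight u (h ℤ.* u ℤ.+ e))

      line-cong : ∀ {e e′} → e ≈ e′ → line e ≡ line e′
      line-cong e≈e′ = ∑ₚ-cong (λ u → weight-cong (≈-refl {u}) (+-congˡ-≈ (h ℤ.* u) e≈e′))

      -- Moving e by 1 moves v = h u + e by 1 in each term. Since h is invertible, v runs over all
      -- residues, and the total change is at most the total variation of the residue function.
      line-step-1 : ∀ e → ∣ line (e ℤ.+ + 1) - line e ∣ ≤ 2 * p
      line-step-1 e = begin
        ∣ line (e ℤ.+ + 1) - line e ∣ ≤⟨ sum-∣-∣ {p} _ _ ⟩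
        ∑ₚ (λ u → ∣ weight u (h ℤ.* u ℤ.+ (e ℤ.+ + 1)) - weight u (h ℤ.* u ℤ.+ e) ∣)
          ≤⟨ sum-mono {p} (λ i → let u = + toℕ i in
               subst (λ t → ∣ weight u t - weight u (h ℤ.* u ℤ.+ e) ∣ ≤ jump (h ℤ.* u ℤ.+ e))
                 (ℤ.+-assoc (h ℤ.* u) e (+ 1)) (weight-step u (h ℤ.* u ℤ.+ e))) ⟩
        ∑ₚ (λ u → jump (h ℤ.* u ℤ.+ e))
          ≡⟨ ∑ₚ-scale h h′ hh′≈1 (λ {a} {b} a≈b → jump-periodic (+-congʳ-≈ e a≈b)) ⟩
        ∑ₚ (λ v → jump (v ℤ.+ e)) ≡⟨ ∑ₚ-shift e jump-periodic ⟩
        ∑ₚ jump ≤⟨ ∑jump ⟩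
        2 * p ∎
        where open ≤-Reasoning

      -- Adding h to e has the same effect on v as adding 1 to u. After reindexing `line e` by u + 1
      -- the two sums agree in v and differ by 1 in the first coordinate only.
      line-step-h : ∀ e → ∣ line (e ℤ.+ h) - line e ∣ ≤ 2 * p
      line-step-h e = begin
        ∣ line (e ℤ.+ h) - line e ∣
          ≡⟨ cong (λ t → ∣ line (e ℤ.+ h) - t ∣) (sym (∑ₚ-shift (+ 1) (λ {a} {b} a≈b → weight-cong a≈b (+-congʳ-≈ e (*-congˡ-≈ h a≈b))))) ⟩
        ∣ line (e ℤ.+ h) - ∑ₚ (λ u → weight (u ℤ.+ + 1) (h ℤ.* (u ℤ.+ + 1) ℤ.+ e)) ∣
          ≤⟨ sum-∣-∣ {p} _ _ ⟩
        ∑ₚ (λ u → ∣ weight u (h ℤ.* u ℤ.+ (e ℤ.+ h)) - weight (u ℤ.+ + 1) (h ℤ.* (u ℤ.+ + 1) ℤ.+ e) ∣)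
          ≤⟨ sum-mono {p} (λ i → bound (+ toℕ i)) ⟩
        ∑ₚ jump ≤⟨ ∑jump ⟩
        2 * p ∎
        where
        open ≤-Reasoning
        lemma : ∀ h u e → h ℤ.* (u ℤ.+ + 1) ℤ.+ e ≡ h ℤ.* u ℤ.+ (e ℤ.+ h)
        lemma = ℤ.solve-∀
        bound : ∀ u → ∣ weight u (h ℤ.* u ℤ.+ (e ℤ.+ h)) - weight (u ℤ.+ + 1) (h ℤ.* (u ℤ.+ + 1) ℤ.+ e) ∣ ≤ jump u
        bound u = begin
          ∣ weight u v - weight (u ℤ.+ + 1) (h ℤ.* (u ℤ.+ + 1) ℤ.+ e) ∣ ≡⟨ cong (λ t → ∣ weight u v - weight (u ℤ.+ + 1) t ∣) (lemma h u e) ⟩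
          ∣ weight u v - weight (u ℤ.+ + 1) v ∣ ≡⟨ cong₂ ∣_-_∣ (weight-comm u v) (weight-comm (u ℤ.+ + 1) v) ⟩
          ∣ weight v u - weight v (u ℤ.+ + 1) ∣ ≡⟨ ∣-∣-comm (weight v u) _ ⟩
          ∣ weight v (u ℤ.+ + 1) - weight v u ∣ ≤⟨ weight-step v u ⟩
          jump u ∎
          where
          v : ℤ
          v = h ℤ.* u ℤ.+ (e ℤ.+ h)

      line-walk : ∀ {e} z s → e ≈ z ℤ.+ s ℤ.* h → ∣ line e - line (+ 0) ∣ ≤ 2 * p * (ℤ.∣ z ∣ + ℤ.∣ s ∣)
      line-walk {e} z s e≈ = begin
        ∣ line e - line (+ 0) ∣ ≡⟨ cong (λ t → ∣ t - line (+ 0) ∣) (line-cong (≈-trans e≈ (≡⇒≈ (lemma z s h)))) ⟩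
        ∣ line (z ℤ.* + 1 ℤ.+ e₁) - line (+ 0) ∣ ≤⟨ ∣-∣-triangle (line (z ℤ.* + 1 ℤ.+ e₁)) (line e₁) (line (+ 0)) ⟩
        ∣ line (z ℤ.* + 1 ℤ.+ e₁) - line e₁ ∣ + ∣ line e₁ - line (+ 0) ∣
          ≤⟨ +-mono-≤ (walk line (+ 1) (2 * p) line-step-1 z e₁) (walk line h (2 * p) line-step-h s (+ 0)) ⟩
        2 * p * ℤ.∣ z ∣ + 2 * p * ℤ.∣ s ∣ ≡⟨ *-distribˡ-+ (2 * p) ℤ.∣ z ∣ ℤ.∣ s ∣ ⟨
        2 * p * (ℤ.∣ z ∣ + ℤ.∣ s ∣) ∎
        where
        open ≤-Reasoning
        e₁ : ℤ
        e₁ = s ℤ.* h ℤ.+ + 0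
        lemma : ∀ z s h → z ℤ.+ s ℤ.* h ≡ z ℤ.* + 1 ℤ.+ (s ℤ.* h ℤ.+ + 0)
        lemma = ℤ.solve-∀

      -- For fixed u the value h u + e runs over all residues as e does, so every pair (u, v) occurs
      -- exactly once.
      ∑line : 6 * ∑ₚ line ≡ p * (suc p * suc (2 * p))
      ∑line = begin
        6 * ∑ₚ (λ e → ∑ₚ (λ u → weight u (h ℤ.* u ℤ.+ e))) ≡⟨ cong (6 *_) (∑ₚ-comm (λ e u → weight u (h ℤ.* u ℤ.+ e))) ⟩
        6 * ∑ₚ (λ u → ∑ₚ (λ e → weight u (h ℤ.* u ℤ.+ e))) ≡⟨ cong (6 *_) (∑ₚ-cong λ u →
             trans (∑ₚ-cong (λ e → cong (weight u) (ℤ.+-comm (h ℤ.* u) e)))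
                   (∑ₚ-shift (h ℤ.* u) (λ a≈b → weight-cong (≈-refl {u}) a≈b))) ⟩
        6 * ∑ₚ (λ u → ∑ₚ (λ v → weight u v)) ≡⟨ cong (6 *_) (sum-cong-≗ {p} (λ i → sum-cong-≗ {p} (λ j →
             cong₂ (λ a b → p ∸ (a ⊔ b)) (residue-< (toℕ<n i)) (residue-< (toℕ<n j))))) ⟩
        6 * sum {p} (λ a → sum {p} (λ b → p ∸ (toℕ a ⊔ toℕ b))) ≡⟨ ∑∑∸⊔ p ⟩
        p * (suc p * suc (2 * p)) ∎
        where open ≡-Reasoning

      -- By `∑line` the average of `line` is (p + 1)(2p + 1) / 6, and a value within K of all others
      -- is within K of the average. The factor p is carried along so that everything stays in ℕ.
      line-equidistributed : ∀ K → (∀ e → ∣ line e - line (+ 0) ∣ ≤ K) → ∣ 6 * line (+ 0) - suc p * suc (2 * p) ∣ ≤ 6 * K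
      line-equidistributed K close = *-cancelˡ-≤ p (begin
        p * ∣ 6 * l₀ - X ∣ ≡⟨ *-distribˡ-∣-∣ p (6 * l₀) X ⟩
        ∣ p * (6 * l₀) - p * X ∣ ≡⟨ cong₂ ∣_-_∣ (swap p l₀) (sym ∑line) ⟩
        ∣ 6 * (p * l₀) - 6 * ∑ₚ line ∣ ≡⟨ *-distribˡ-∣-∣ 6 (p * l₀) (∑ₚ line) ⟨
        6 * ∣ p * l₀ - ∑ₚ line ∣ ≡⟨ cong (6 *_) (trans (∣-∣-comm (p * l₀) _) (cong (∣ ∑ₚ line -_∣) (sym (sum-const p l₀)))) ⟩
        6 * ∣ ∑ₚ line - sum {p} (λ _ → l₀) ∣ ≤⟨ *-monoʳ-≤ 6 (sum-∣-∣ {p} _ _) ⟩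
        6 * ∑ₚ (λ e → ∣ line e - l₀ ∣) ≤⟨ *-monoʳ-≤ 6 (sum-mono {p} (λ i → close (+ toℕ i))) ⟩
        6 * sum {p} (λ _ → K) ≡⟨ cong (6 *_) (sum-const p K) ⟩
        6 * (p * K) ≡⟨ swap p K ⟨
        p * (6 * K) ∎)
        where
        open ≤-Reasoning
        l₀ X : ℕ
        l₀ = line (+ 0)
        X = suc p * suc (2 * p)
        swap : ∀ p l → p * (6 * l) ≡ 6 * (p * l)
        swap = solve-∀

-- Short vectors of the lattice y ≡ h x and what they cover.

module ShortVectors where

  open import Defs using (φ; ⌊root⌋; ⌊root⌋-lower; ⌊root⌋-upper)
  open PrimitivePartSize using (Odd)
  open Totients using (primitive-prime≤)
  open Modular
  open LineSums
  open import Data.Empty using (⊥; ⊥-elim)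
  open import Data.Fin.Base as Fin using (Fin; toℕ; fromℕ<; remQuot)
  open import Data.Fin.Properties using (pigeonhole; toℕ-injective; toℕ-fromℕ<; combine-remQuot; toℕ≤pred[n])
  open import Data.Integer.Base as ℤ using (ℤ; -[1+_]) renaming (+_ to pos)
  open import Data.Integer.DivMod using (a≡a%ℕn+[a/ℕn]*n; _%ℕ_; _/ℕ_; n%ℕd<d)
  import Data.Integer.Divisibility.Signed as ℤ
  import Data.Integer.Properties as ℤ
  import Data.Integer.Tactic.RingSolver as ℤ
  open import Data.Nat.Base
  open import Data.Nat.Coprimality using (Coprime; coprime-Bézout) renaming (sym to coprime-sym)
  open import Data.Nat.Divisibility
  open import Data.Nat.GCD
  open import Data.Nat.Primality
  open import Data.Nat.Properties
  open import Data.Nat.Tactic.RingSolver using (solve-∀)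
  open import Data.Product.Base using (_,_; _×_; proj₁; proj₂; ∃-syntax; ∃₂)
  open import Data.Sum.Base using (_⊎_; inj₁; inj₂)
  open import Function.Base using (_∘_)
  open import Relation.Binary.Definitions using (tri<; tri≈; tri>)
  open import Relation.Binary.PropositionalEquality hiding (setoid)
  open import Relation.Nullary using (¬_; Dec; yes; no; contradiction)
  open import Relation.Unary using (Pred; Decidable)

  least : ∀ {ℓ} {P : Pred ℕ ℓ} → Decidable P → ∀ n → P n → ∃[ m ] m ≤ n × P m × (∀ i → i < m → ¬ P i)
  least P? zero    Pn = 0 , z≤n , Pn , λ _ ()
  least P? (suc n) Pn with P? 0
  ... | yes P0 = 0 , z≤n , P0 , λ _ ()
  ... | no ¬P0 with least (P? ∘ suc) n Pn
  ...   | m , m≤n , Pm , below = suc m , s≤s m≤n , Pm , λ where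
          zero    _         → ¬P0
          (suc i) (s≤s i<m) → below i i<m

  ∣i∣≡1⇒i≡±1 : ∀ i → ℤ.∣ i ∣ ≡ 1 → i ≡ pos 1 ⊎ i ≡ ℤ.- pos 1
  ∣i∣≡1⇒i≡±1 (pos 1)   refl = inj₁ refl
  ∣i∣≡1⇒i≡±1 -[1+ 0 ] refl = inj₂ refl

  bézout-ℕ : ∀ Y n → Coprime Y n → ∃[ v ] pos Y ℤ.∣ pos n ℤ.* v ℤ.- pos 1
  bézout-ℕ Y n c with coprime-Bézout c
  ... | Bézout.+- u v eq = ℤ.- pos v , ℤ.divides (ℤ.- pos u) (begin
    pos n ℤ.* (ℤ.- pos v) ℤ.- pos 1 ≡⟨ lemma (pos n) (pos v) ⟩
    ℤ.- (pos 1 ℤ.+ pos v ℤ.* pos n) ≡⟨ cong (λ t → ℤ.- (pos 1 ℤ.+ t)) (ℤ.pos-* v n) ⟨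
    ℤ.- pos (1 + v * n) ≡⟨ cong (λ t → ℤ.- pos t) eq ⟩
    ℤ.- pos (u * Y) ≡⟨ cong ℤ.-_ (ℤ.pos-* u Y) ⟩
    ℤ.- (pos u ℤ.* pos Y) ≡⟨ ℤ.neg-distribˡ-* (pos u) (pos Y) ⟩
    (ℤ.- pos u) ℤ.* pos Y ∎)
    where
    open ≡-Reasoning
    lemma : ∀ x v → x ℤ.* (ℤ.- v) ℤ.- pos 1 ≡ ℤ.- (pos 1 ℤ.+ v ℤ.* x)
    lemma = ℤ.solve-∀
  ... | Bézout.-+ u v eq = pos v , ℤ.divides (pos u) (begin
    pos n ℤ.* pos v ℤ.- pos 1 ≡⟨ cong (ℤ._- pos 1) (trans (ℤ.*-comm (pos n) (pos v)) (sym (ℤ.pos-* v n))) ⟩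
    pos (v * n) ℤ.- pos 1 ≡⟨ cong (λ t → pos t ℤ.- pos 1) eq ⟨
    pos (u * Y) ≡⟨ ℤ.pos-* u Y ⟩
    pos u ℤ.* pos Y ∎)
    where open ≡-Reasoning

  bézout-ℤ : ∀ Y x → Coprime Y ℤ.∣ x ∣ → ∃[ v ] pos Y ℤ.∣ x ℤ.* v ℤ.- pos 1
  bézout-ℤ Y x c with bézout-ℕ Y ℤ.∣ x ∣ c | ℤ.+∣i∣≡i⊎+∣i∣≡-i x
  ... | v , Y∣ | inj₁ +x = v , subst (λ t → pos Y ℤ.∣ t ℤ.* v ℤ.- pos 1) +x Y∣
  ... | v , Y∣ | inj₂ -x = ℤ.- v , subst (λ t → pos Y ℤ.∣ t ℤ.- pos 1)
    (trans (cong (ℤ._* v) -x) (lemma x v)) Y∣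
    where
    lemma : ∀ x v → (ℤ.- x) ℤ.* v ≡ x ℤ.* (ℤ.- v)
    lemma = ℤ.solve-∀

  -- With v an inverse of x modulo Y, let s be the residue of -w v, so 0 ≤ s < Y. Then z is
  -- determined by Y z = w + x s, and Y |z| ≤ w + Y Y.
  solve-linear : ∀ Y x w .{{_ : NonZero Y}} → ℤ.∣ x ∣ < Y → Coprime Y ℤ.∣ x ∣ →
                 ∃₂ λ z s → pos Y ℤ.* z ℤ.- x ℤ.* s ≡ pos w × Y * (ℤ.∣ z ∣ + ℤ.∣ s ∣) ≤ w + Y * Y + Y * Y
  solve-linear Y x w ∣x∣<Y c with bézout-ℤ Y x c
  ... | v , ℤ.divides q xv-1≡ = z , pos s , solution , bound
    where
    t : ℤ
    t = ℤ.- (pos w ℤ.* v)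
    s : ℕ
    s = t %ℕ Y
    z : ℤ
    z = ℤ.- (x ℤ.* (t /ℕ Y)) ℤ.- pos w ℤ.* q
    lemma : ∀ x s t Y w v q → Y ℤ.* (ℤ.- (x ℤ.* t) ℤ.- w ℤ.* q) ≡
            x ℤ.* s ℤ.- x ℤ.* (s ℤ.+ t ℤ.* Y) ℤ.- w ℤ.* (q ℤ.* Y)
    lemma = ℤ.solve-∀
    lemma′ : ∀ x s w v → x ℤ.* s ℤ.- x ℤ.* (ℤ.- (w ℤ.* v)) ℤ.- w ℤ.* (x ℤ.* v ℤ.- pos 1) ≡ w ℤ.+ x ℤ.* s
    lemma′ = ℤ.solve-∀
    Yz≡ : pos Y ℤ.* z ≡ pos w ℤ.+ x ℤ.* pos s
    Yz≡ = trans (lemma x (pos s) (t /ℕ Y) (pos Y) (pos w) v q) (trans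
      (cong₂ (λ a b → x ℤ.* pos s ℤ.- x ℤ.* a ℤ.- pos w ℤ.* b) (sym (a≡a%ℕn+[a/ℕn]*n t Y)) (sym xv-1≡))
      (lemma′ x (pos s) (pos w) v))
    cancel : ∀ w a → w ℤ.+ a ℤ.- a ≡ w
    cancel = ℤ.solve-∀
    solution : pos Y ℤ.* z ℤ.- x ℤ.* pos s ≡ pos w
    solution = trans (cong (ℤ._- x ℤ.* pos s) Yz≡) (cancel (pos w) (x ℤ.* pos s))
    s≤Y : s ≤ Y
    s≤Y = <⇒≤ (n%ℕd<d t Y)
    bound : Y * (ℤ.∣ z ∣ + s) ≤ w + Y * Y + Y * Y
    bound = begin
      Y * (ℤ.∣ z ∣ + s) ≡⟨ *-distribˡ-+ Y ℤ.∣ z ∣ s ⟩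
      Y * ℤ.∣ z ∣ + Y * s ≡⟨ cong (_+ Y * s) (ℤ.abs-* (pos Y) z) ⟨
      ℤ.∣ pos Y ℤ.* z ∣ + Y * s ≡⟨ cong (λ t → ℤ.∣ t ∣ + Y * s) Yz≡ ⟩
      ℤ.∣ pos w ℤ.+ x ℤ.* pos s ∣ + Y * s ≤⟨ +-monoˡ-≤ (Y * s) (ℤ.∣i+j∣≤∣i∣+∣j∣ (pos w) (x ℤ.* pos s)) ⟩
      w + ℤ.∣ x ℤ.* pos s ∣ + Y * s ≡⟨ cong (λ t → w + t + Y * s) (ℤ.abs-* x (pos s)) ⟩
      w + ℤ.∣ x ∣ * s + Y * s ≤⟨ +-mono-≤ (+-monoʳ-≤ w (*-mono-≤ (<⇒≤ ∣x∣<Y) s≤Y)) (*-monoʳ-≤ Y s≤Y) ⟩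
      w + Y * Y + Y * Y ∎
      where open ≤-Reasoning

  ^-distribʳ-*-ℤ : ∀ n a b → (a ℤ.* b) ℤ.^ n ≡ a ℤ.^ n ℤ.* b ℤ.^ n
  ^-distribʳ-*-ℤ zero    a b = refl
  ^-distribʳ-*-ℤ (suc n) a b = trans (cong (a ℤ.* b ℤ.*_) (^-distribʳ-*-ℤ n a b)) (lemma a b (a ℤ.^ n) (b ℤ.^ n))
    where
    lemma : ∀ a b c d → a ℤ.* b ℤ.* (c ℤ.* d) ≡ a ℤ.* c ℤ.* (b ℤ.* d)
    lemma = ℤ.solve-∀

  ∣pos-pos∣≤ : ∀ {m n K} → m ≤ K → n ≤ K → ℤ.∣ pos m ℤ.- pos n ∣ ≤ K
  ∣pos-pos∣≤ {m} {n} {K} m≤K n≤K = ≤-trans (≤-reflexive (cong ℤ.∣_∣ (ℤ.m-n≡m⊖n m n)))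
    (≤-trans (ℤ.∣m⊝n∣≤m⊔n m n) (⊔-lub m≤K n≤K))

  module ShortVector (p : ℕ) (p-prime : Prime p) where

    instance
      p≢0 : NonZero p
      p≢0 = prime⇒nonZero p-prime

    open Mod p
    open Equidistribution p

    1<p : 1 < p
    1<p = nonTrivial⇒n>1 p {{prime⇒nonTrivial p-prime}}

    1≉0 : ¬ pos 1 ≈ pos 0
    1≉0 1≈0 = contradiction (≈0-small {pos 1} 1<p 1≈0) λ ()

    *-≉0 : ∀ {a b} → ¬ a ≈ pos 0 → ¬ b ≈ pos 0 → ¬ a ℤ.* b ≈ pos 0
    *-≉0 {a} {b} a≉0 b≉0 ab≈0 = b≉0 (prime-cancelˡ p-prime a≉0 (≈-trans ab≈0 (≡⇒≈ (sym (ℤ.*-zeroʳ a)))))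

    ^-≉0 : ∀ {a} n → ¬ a ≈ pos 0 → ¬ a ℤ.^ n ≈ pos 0
    ^-≉0 zero    a≉0 = 1≉0
    ^-≉0 (suc n) a≉0 = *-≉0 a≉0 (^-≉0 n a≉0)

    K : ℕ
    K = ⌊root⌋ 2 p

    K*K≤p : K * K ≤ p
    K*K≤p = subst (λ t → K * t ≤ p) (*-identityʳ K) (⌊root⌋-lower 2 p)

    p<sucK² : p < suc K * suc K
    p<sucK² = subst (λ t → p < suc K * t) (*-identityʳ (suc K)) (⌊root⌋-upper 2 p)

    n*n≤p⇒n<p : ∀ n → n * n ≤ p → n < p
    n*n≤p⇒n<p 0       _    = <-trans z<s 1<p
    n*n≤p⇒n<p 1       _    = 1<p
    n*n≤p⇒n<p n@(2+ _) n²≤p = <-≤-trans (m<m*n n n (s≤s (s≤s z≤n))) n²≤p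

    -- Thue's lemma: there are (K + 1)^2 > p pairs, so two of them give the same residue of b - h a,
    -- and their difference is the vector.
    thue : ∀ h → ∃₂ λ a b → ℤ.∣ a ∣ ≤ K × ℤ.∣ b ∣ ≤ K × (a ≡ pos 0 → b ≡ pos 0 → ⊥) × b ≈ h ℤ.* a
    thue h = collide (pigeonhole p<sucK² (λ i → fromℕ< (residue<p (value i))))
      where
      fst snd : Fin (suc K * suc K) → Fin (suc K)
      fst i = proj₁ (remQuot {suc K} (suc K) i)
      snd i = proj₂ (remQuot {suc K} (suc K) i)
      value : Fin (suc K * suc K) → ℤ
      value i = pos (toℕ (snd i)) ℤ.- h ℤ.* pos (toℕ (fst i))
      lemma : ∀ h a b c d → (a ℤ.- h ℤ.* b) ℤ.- (c ℤ.- h ℤ.* d) ≡ (a ℤ.- c) ℤ.- h ℤ.* (b ℤ.- d)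
      lemma = ℤ.solve-∀
      collide : (∃₂ λ i j → i Fin.< j × fromℕ< (residue<p (value i)) ≡ fromℕ< (residue<p (value j))) →
                ∃₂ λ a b → ℤ.∣ a ∣ ≤ K × ℤ.∣ b ∣ ≤ K × (a ≡ pos 0 → b ≡ pos 0 → ⊥) × b ≈ h ℤ.* a
      collide (i , j , i<j , eq) =
        pos (toℕ (fst i)) ℤ.- pos (toℕ (fst j)) , pos (toℕ (snd i)) ℤ.- pos (toℕ (snd j)) ,
        ∣pos-pos∣≤ (toℕ≤pred[n] (fst i)) (toℕ≤pred[n] (fst j)) ,
        ∣pos-pos∣≤ (toℕ≤pred[n] (snd i)) (toℕ≤pred[n] (snd j)) ,
        (λ a≡0 b≡0 → <⇒≢ i<j (cong toℕ (trans (sym (combine-remQuot {suc K} (suc K) i))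
          (trans (cong₂ Fin.combine (same (fst i) (fst j) a≡0) (same (snd i) (snd j) b≡0)) (combine-remQuot {suc K} (suc K) j))))) ,
        mk≈ (subst (pos p ℤ.∣_) (lemma h (pos (toℕ (snd i))) (pos (toℕ (fst i))) (pos (toℕ (snd j))) (pos (toℕ (fst j)))) (p∣diff values≈))
        where
        same : ∀ (u v : Fin (suc K)) → pos (toℕ u) ℤ.- pos (toℕ v) ≡ pos 0 → u ≡ v
        same u v eq = toℕ-injective (ℤ.+-injective (ℤ.i-j≡0⇒i≡j (pos (toℕ u)) (pos (toℕ v)) eq))
        values≈ : value i ≈ value j
        values≈ = ≈-trans (≈-sym (residue≈ (value i))) (≈-trans
          (≡⇒≈ (cong pos (trans (sym (toℕ-fromℕ< (residue<p (value i)))) (trans (cong toℕ eq) (toℕ-fromℕ< (residue<p (value j)))))))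
          (residue≈ (value j)))

    -- The vector is oriented so that Y is its larger coordinate and positive, as the size estimates
    -- for |Y^n - x^n| require. Hence `slope` must record whether x / Y is h or its inverse.
    record Short (h : ℤ) : Set where
      field
        Y       : ℕ
        x       : ℤ
        ∣x∣<Y   : ℤ.∣ x ∣ < Y
        coprime : Coprime Y ℤ.∣ x ∣
        Y*Y≤p   : Y * Y ≤ p
        slope   : x ≈ h ℤ.* pos Y ⊎ pos Y ≈ h ℤ.* x

    normalise : ∀ h a b → ¬ h ≈ pos 1 → ¬ h ≈ ℤ.- pos 1 → ℤ.∣ a ∣ ≤ K → ℤ.∣ b ∣ ≤ K →
                Coprime ℤ.∣ a ∣ ℤ.∣ b ∣ → b ≈ h ℤ.* a → Short h
    normalise h a b h≉1 h≉-1 a≤K b≤K c b≈ha with <-cmp ℤ.∣ a ∣ ℤ.∣ b ∣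
    ... | tri< a<b _ _ with ℤ.+∣i∣≡i⊎+∣i∣≡-i b
    ...   | inj₁ +b = record { Y = ℤ.∣ b ∣ ; x = a ; ∣x∣<Y = a<b ; coprime = coprime-sym c
                             ; Y*Y≤p = ≤-trans (*-mono-≤ b≤K b≤K) K*K≤p
                             ; slope = inj₂ (≈-trans (≡⇒≈ +b) b≈ha) }
    ...   | inj₂ -b = record { Y = ℤ.∣ b ∣ ; x = ℤ.- a ; ∣x∣<Y = subst (_< ℤ.∣ b ∣) (sym (ℤ.∣-i∣≡∣i∣ a)) a<b
                             ; coprime = subst (Coprime ℤ.∣ b ∣) (sym (ℤ.∣-i∣≡∣i∣ a)) (coprime-sym c)
                             ; Y*Y≤p = ≤-trans (*-mono-≤ b≤K b≤K) K*K≤p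
                             ; slope = inj₂ (≈-trans (≡⇒≈ -b) (≈-trans (neg-cong-≈ b≈ha) (≡⇒≈ (ℤ.neg-distribʳ-* h a)))) }
    normalise h a b h≉1 h≉-1 a≤K b≤K c b≈ha | tri> _ _ b<a with ℤ.+∣i∣≡i⊎+∣i∣≡-i a
    ...   | inj₁ +a = record { Y = ℤ.∣ a ∣ ; x = b ; ∣x∣<Y = b<a ; coprime = c
                             ; Y*Y≤p = ≤-trans (*-mono-≤ a≤K a≤K) K*K≤p
                             ; slope = inj₁ (≈-trans b≈ha (≡⇒≈ (cong (h ℤ.*_) (sym +a)))) }
    ...   | inj₂ -a = record { Y = ℤ.∣ a ∣ ; x = ℤ.- b ; ∣x∣<Y = subst (_< ℤ.∣ a ∣) (sym (ℤ.∣-i∣≡∣i∣ b)) b<a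
                             ; coprime = subst (Coprime ℤ.∣ a ∣) (sym (ℤ.∣-i∣≡∣i∣ b)) c
                             ; Y*Y≤p = ≤-trans (*-mono-≤ a≤K a≤K) K*K≤p
                             ; slope = inj₁ (≈-trans (neg-cong-≈ b≈ha)
                                 (≡⇒≈ (trans (ℤ.neg-distribʳ-* h a) (cong (h ℤ.*_) (sym -a))))) }
    -- Coprime numbers of equal absolute value are ±1, which would make h ≈ ±1.
    normalise h a b h≉1 h≉-1 a≤K b≤K c b≈ha | tri≈ _ a≡b _ =
      ⊥-elim (cases (∣i∣≡1⇒i≡±1 a (c (∣-refl , subst (ℤ.∣ a ∣ ∣_) a≡b ∣-refl)))
                    (∣i∣≡1⇒i≡±1 b (c (subst (ℤ.∣ b ∣ ∣_) (sym a≡b) ∣-refl , ∣-refl))))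
      where
      h≈ : ∀ {a b} → a ℤ.* a ≡ pos 1 → b ≈ h ℤ.* a → h ≈ b ℤ.* a
      h≈ {a} aa≡1 b≈ha = ≈-sym (≈-trans (*-congʳ-≈ a b≈ha) (≡⇒≈ (trans (ℤ.*-assoc h a a) (trans (cong (h ℤ.*_) aa≡1) (ℤ.*-identityʳ h)))))
      cases : a ≡ pos 1 ⊎ a ≡ ℤ.- pos 1 → b ≡ pos 1 ⊎ b ≡ ℤ.- pos 1 → ⊥
      cases (inj₁ refl) (inj₁ refl) = h≉1  (h≈ {pos 1} {pos 1} refl b≈ha)
      cases (inj₁ refl) (inj₂ refl) = h≉-1 (h≈ {pos 1} {ℤ.- pos 1} refl b≈ha)
      cases (inj₂ refl) (inj₁ refl) = h≉-1 (h≈ {ℤ.- pos 1} {pos 1} refl b≈ha)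
      cases (inj₂ refl) (inj₂ refl) = h≉1  (h≈ {ℤ.- pos 1} {ℤ.- pos 1} refl b≈ha)

    -- Since 0 < g ≤ K < p, the common divisor g is invertible modulo p, and dividing by it
    -- preserves b ≈ h a.
    reduce : ∀ h a b g → ¬ h ≈ pos 1 → ¬ h ≈ ℤ.- pos 1 → ℤ.∣ a ∣ ≤ K → ℤ.∣ b ∣ ≤ K → b ≈ h ℤ.* a →
             NonZero g → g ≤ K → (∀ {e} → e ∣ ℤ.∣ a ∣ → e ∣ ℤ.∣ b ∣ → e ∣ g) → pos g ℤ.∣ a → pos g ℤ.∣ b → Short h
    reduce h a b g h≉1 h≉-1 a≤K b≤K b≈ha g≢0 g≤K greatest (ℤ.divides a′ a≡) (ℤ.divides b′ b≡) =
      normalise h a′ b′ h≉1 h≉-1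
        (≤-trans (≤abs a′ a≡) a≤K) (≤-trans (≤abs b′ b≡) b≤K) coprime′
        (prime-cancelˡ p-prime {pos g} g≉0 (≈-trans (≡⇒≈ (trans (ℤ.*-comm (pos g) b′) (sym b≡)))
          (≈-trans b≈ha (≡⇒≈ (trans (cong (h ℤ.*_) a≡) (lemma h a′ (pos g)))))))
      where
      lemma : ∀ h a g → h ℤ.* (a ℤ.* g) ≡ g ℤ.* (h ℤ.* a)
      lemma = ℤ.solve-∀
      instance
        g≢0′ : NonZero g
        g≢0′ = g≢0
      abs≡ : ∀ {i} i′ → i ≡ i′ ℤ.* pos g → ℤ.∣ i ∣ ≡ ℤ.∣ i′ ∣ * g
      abs≡ i′ refl = ℤ.abs-* i′ (pos g)
      ≤abs : ∀ {i} i′ → i ≡ i′ ℤ.* pos g → ℤ.∣ i′ ∣ ≤ ℤ.∣ i ∣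
      ≤abs i′ i≡ = subst (ℤ.∣ i′ ∣ ≤_) (sym (abs≡ i′ i≡)) (m≤m*n ℤ.∣ i′ ∣ g)
      g≉0 : ¬ pos g ≈ pos 0
      g≉0 g≈0 = ≢-nonZero⁻¹ g (ℤ.+-injective (≈0-small {pos g} (≤-<-trans g≤K (n*n≤p⇒n<p K K*K≤p)) g≈0))
      coprime′ : Coprime ℤ.∣ a′ ∣ ℤ.∣ b′ ∣
      coprime′ {e} (e∣a′ , e∣b′) = ∣1⇒≡1 (*-cancelʳ-∣ g (subst (e * g ∣_) (sym (*-identityˡ g))
        (greatest (subst (e * g ∣_) (sym (abs≡ a′ a≡)) (*-monoˡ-∣ g e∣a′))
                  (subst (e * g ∣_) (sym (abs≡ b′ b≡)) (*-monoˡ-∣ g e∣b′)))))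

    short-vector : ∀ h → ¬ h ≈ pos 1 → ¬ h ≈ ℤ.- pos 1 → Short h
    short-vector h h≉1 h≉-1 = from-thue (thue h)
      where
      from-thue : (∃₂ λ a b → ℤ.∣ a ∣ ≤ K × ℤ.∣ b ∣ ≤ K × (a ≡ pos 0 → b ≡ pos 0 → ⊥) × b ≈ h ℤ.* a) → Short h
      from-thue (a , b , a≤K , b≤K , nonzero , b≈ha) = reduce h a b (gcd ℤ.∣ a ∣ ℤ.∣ b ∣) h≉1 h≉-1 a≤K b≤K b≈ha
        (≢-nonZero λ g≡0 → nonzero (ℤ.∣i∣≡0⇒i≡0 (gcd[m,n]≡0⇒m≡0 g≡0)) (ℤ.∣i∣≡0⇒i≡0 (gcd[m,n]≡0⇒n≡0 ℤ.∣ a ∣ g≡0)))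
        (gcd≤K (ℤ.∣ a ∣ ≟ 0)) gcd-greatest
        (ℤ.∣ᵤ⇒∣ (gcd[m,n]∣m ℤ.∣ a ∣ ℤ.∣ b ∣)) (ℤ.∣ᵤ⇒∣ (gcd[m,n]∣n ℤ.∣ a ∣ ℤ.∣ b ∣))
        where
        gcd≤K : Dec (ℤ.∣ a ∣ ≡ 0) → gcd ℤ.∣ a ∣ ℤ.∣ b ∣ ≤ K
        gcd≤K (no  a≢0) = ≤-trans (∣⇒≤ {{≢-nonZero a≢0}} (gcd[m,n]∣m ℤ.∣ a ∣ ℤ.∣ b ∣)) a≤K
        gcd≤K (yes a≡0) = ≤-trans (∣⇒≤ {{≢-nonZero λ b≡0 → nonzero (ℤ.∣i∣≡0⇒i≡0 a≡0) (ℤ.∣i∣≡0⇒i≡0 b≡0)}} (gcd[m,n]∣n ℤ.∣ a ∣ ℤ.∣ b ∣)) b≤K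

    module _ {h U V : ℤ} (i : ℕ) where
      ratio^ : V ≈ h ℤ.* U → V ℤ.^ i ≈ U ℤ.^ i ℤ.* h ℤ.^ i
      ratio^ V≈hU = ≈-trans (^-cong-≈ i V≈hU) (≡⇒≈ (trans (^-distribʳ-*-ℤ i h U) (ℤ.*-comm (h ℤ.^ i) (U ℤ.^ i))))

      ratio^≈1 : ¬ U ≈ pos 0 → V ≈ h ℤ.* U → U ℤ.^ i ≈ V ℤ.^ i → h ℤ.^ i ≈ pos 1
      ratio^≈1 U≉0 V≈hU e = ≈-sym (prime-cancelˡ p-prime (^-≉0 i U≉0)
        (≈-trans (≡⇒≈ (ℤ.*-identityʳ (U ℤ.^ i))) (≈-trans e (ratio^ V≈hU))))

      ≈ratio^1 : V ≈ h ℤ.* U → h ℤ.^ i ≈ pos 1 → U ℤ.^ i ≈ V ℤ.^ i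
      ≈ratio^1 V≈hU e = ≈-sym (≈-trans (ratio^ V≈hU) (≈-trans (*-congˡ-≈ (U ℤ.^ i) e) (≡⇒≈ (ℤ.*-identityʳ (U ℤ.^ i)))))

    module _ {h : ℤ} (v : Short h) where
      open Short v

      Y≢0 : NonZero Y
      Y≢0 = >-nonZero (≤-<-trans z≤n ∣x∣<Y)

      Y≉0 : ¬ pos Y ≈ pos 0
      Y≉0 Y≈0 = ≢-nonZero⁻¹ Y {{Y≢0}} (ℤ.+-injective (≈0-small {pos Y} (n*n≤p⇒n<p Y Y*Y≤p) Y≈0))

      x≉0 : pos Y ≈ h ℤ.* x → ¬ x ≈ pos 0
      x≉0 Y≈hx x≈0 = Y≉0 (≈-trans Y≈hx (≈-trans (*-congˡ-≈ h x≈0) (≡⇒≈ (ℤ.*-zeroʳ h))))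

      h^≈1 : ∀ i → x ≈ h ℤ.* pos Y ⊎ pos Y ≈ h ℤ.* x → pos Y ℤ.^ i ≈ x ℤ.^ i → h ℤ.^ i ≈ pos 1
      h^≈1 i (inj₁ x≈hY) e = ratio^≈1 i Y≉0 x≈hY e
      h^≈1 i (inj₂ Y≈hx) e = ratio^≈1 i (x≉0 Y≈hx) Y≈hx (≈-sym e)

      ≈h^1 : ∀ i → x ≈ h ℤ.* pos Y ⊎ pos Y ≈ h ℤ.* x → h ℤ.^ i ≈ pos 1 → pos Y ℤ.^ i ≈ x ℤ.^ i
      ≈h^1 i (inj₁ x≈hY) e = ≈ratio^1 i x≈hY e
      ≈h^1 i (inj₂ Y≈hx) e = ≈-sym (≈ratio^1 i Y≈hx e)

      -- Since x / Y is h or its inverse modulo p, p divides Y^i - x^i exactly when h^i ≈ 1.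
      -- Minimality of k therefore makes p a primitive divisor of the k-th difference.
      short-bound : ∀ k .{{_ : NonTrivial k}} → Odd k → h ℤ.^ k ≈ pos 1 →
                    (∀ i .{{_ : NonZero i}} → i < k → ¬ h ℤ.^ i ≈ pos 1) → p ≤ (512 * Y) ^ φ k
      short-bound k k-odd h^k≈1 minimal = primitive-prime≤ ∣x∣<Y coprime k k-odd p-prime
        (ℤ.∣⇒∣ᵤ (p∣diff (≈h^1 k slope h^k≈1)))
        (λ i i<k p∣D → minimal i i<k (h^≈1 i slope (mk≈ (ℤ.∣ᵤ⇒∣ p∣D))))

      ≤3p : ∀ {n} e → n ≤ residue e + Y * Y + Y * Y → n ≤ 3 * p
      ≤3p e n≤ = ≤-trans n≤ (≤-trans (+-mono-≤ (+-mono-≤ (<⇒≤ (residue<p e)) Y*Y≤p) Y*Y≤p) (≤-reflexive (three p)))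
        where
        three : ∀ p → p + p + p ≡ 3 * p
        three = solve-∀

      -- Solving Y z - x s ≡ Y e (or ≡ - x e) modulo p and dividing by Y (or x).
      covering : ∀ e → x ≈ h ℤ.* pos Y ⊎ pos Y ≈ h ℤ.* x → ∃₂ λ z s → e ≈ z ℤ.+ s ℤ.* h × Y * (ℤ.∣ z ∣ + ℤ.∣ s ∣) ≤ 3 * p
      covering e (inj₁ x≈hY) = solved (solve-linear Y x w {{Y≢0}} ∣x∣<Y coprime)
        where
        w : ℕ
        w = residue (pos Y ℤ.* e)
        lemma : ∀ Y z h s → Y ℤ.* z ℤ.- (h ℤ.* Y) ℤ.* s ≡ Y ℤ.* (z ℤ.+ (ℤ.- s) ℤ.* h)
        lemma = ℤ.solve-∀
        solved : (∃₂ λ z s → pos Y ℤ.* z ℤ.- x ℤ.* s ≡ pos w × Y * (ℤ.∣ z ∣ + ℤ.∣ s ∣) ≤ w + Y * Y + Y * Y) →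
                 ∃₂ λ z s → e ≈ z ℤ.+ s ℤ.* h × Y * (ℤ.∣ z ∣ + ℤ.∣ s ∣) ≤ 3 * p
        solved (z , s , eq , bound) = z , ℤ.- s , prime-cancelˡ p-prime Y≉0 Ye≈ ,
          subst (λ t → Y * (ℤ.∣ z ∣ + t) ≤ 3 * p) (sym (ℤ.∣-i∣≡∣i∣ s)) (≤3p (pos Y ℤ.* e) bound)
          where
          Ye≈ : pos Y ℤ.* e ≈ pos Y ℤ.* (z ℤ.+ (ℤ.- s) ℤ.* h)
          Ye≈ = begin
            pos Y ℤ.* e ≈⟨ residue≈ (pos Y ℤ.* e) ⟨
            pos w ≡⟨ eq ⟨
            pos Y ℤ.* z ℤ.- x ℤ.* s ≈⟨ +-congˡ-≈ (pos Y ℤ.* z) (neg-cong-≈ (*-congʳ-≈ s x≈hY)) ⟩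
            pos Y ℤ.* z ℤ.- (h ℤ.* pos Y) ℤ.* s ≡⟨ lemma (pos Y) z h s ⟩
            pos Y ℤ.* (z ℤ.+ (ℤ.- s) ℤ.* h) ∎
            where open import Relation.Binary.Reasoning.Setoid setoid
      covering e (inj₂ Y≈hx) = solved (solve-linear Y x w {{Y≢0}} ∣x∣<Y coprime)
        where
        w : ℕ
        w = residue (ℤ.- (x ℤ.* e))
        lemma : ∀ x z h s → ℤ.- (h ℤ.* x ℤ.* z ℤ.- x ℤ.* s) ≡ x ℤ.* (s ℤ.+ (ℤ.- z) ℤ.* h)
        lemma = ℤ.solve-∀
        solved : (∃₂ λ z s → pos Y ℤ.* z ℤ.- x ℤ.* s ≡ pos w × Y * (ℤ.∣ z ∣ + ℤ.∣ s ∣) ≤ w + Y * Y + Y * Y) →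
                 ∃₂ λ z s → e ≈ z ℤ.+ s ℤ.* h × Y * (ℤ.∣ z ∣ + ℤ.∣ s ∣) ≤ 3 * p
        solved (z , s , eq , bound) = s , ℤ.- z , prime-cancelˡ p-prime (x≉0 Y≈hx) xe≈ ,
          subst (λ t → Y * (ℤ.∣ s ∣ + t) ≤ 3 * p) (sym (ℤ.∣-i∣≡∣i∣ z))
            (subst (λ t → Y * t ≤ 3 * p) (+-comm ℤ.∣ z ∣ ℤ.∣ s ∣) (≤3p (ℤ.- (x ℤ.* e)) bound))
          where
          xe≈ : x ℤ.* e ≈ x ℤ.* (s ℤ.+ (ℤ.- z) ℤ.* h)
          xe≈ = begin
            x ℤ.* e ≡⟨ ℤ.neg-involutive (x ℤ.* e) ⟨
            ℤ.- (ℤ.- (x ℤ.* e)) ≈⟨ neg-cong-≈ (residue≈ (ℤ.- (x ℤ.* e))) ⟨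
            ℤ.- pos w ≡⟨ cong ℤ.-_ eq ⟨
            ℤ.- (pos Y ℤ.* z ℤ.- x ℤ.* s) ≈⟨ neg-cong-≈ (+-congʳ-≈ (ℤ.- (x ℤ.* s)) (*-congʳ-≈ z Y≈hx)) ⟩
            ℤ.- (h ℤ.* x ℤ.* z ℤ.- x ℤ.* s) ≡⟨ lemma x z h s ⟩
            x ℤ.* (s ℤ.+ (ℤ.- z) ℤ.* h) ∎
            where open import Relation.Binary.Reasoning.Setoid setoid

-- Line sums for elements h ≠ 1 with h^d = 1.

module SubgroupLines where

  open import Defs using (γ; γ-nonZero; ⌊root⌋; ⌊root⌋-upper; ⌊root⌋-max; ^-distribʳ-*)
  open PrimitiveParts using (odd⇒nonZero)
  open PowerDifferences using (odd⇒half)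
  open PrimitivePartSize using (Odd)
  open Totients using (φ≤γ)
  open Modular
  open LineSums
  open ShortVectors
  open import Data.Integer.Base as ℤ using (ℤ) renaming (+_ to pos)
  import Data.Integer.Divisibility.Signed as ℤ
  import Data.Integer.Properties as ℤ
  open import Data.Nat.Base
  open import Data.Nat.Divisibility
  open import Data.Nat.DivMod using (m≡m%n+[m/n]*n; m%n<n; _%_; _/_)
  open import Data.Nat.Primality
  open import Data.Nat.Properties
  open import Data.Nat.Tactic.RingSolver using (solve-∀)
  open import Data.Product.Base using (_,_; _×_; ∃-syntax; ∃₂)
  open import Relation.Binary.PropositionalEquality hiding (setoid)
  open import Relation.Nullary using (¬_; contradiction)

  -1^odd : ∀ n → Odd n → (ℤ.- pos 1) ℤ.^ n ≡ ℤ.- pos 1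
  -1^odd n n-odd with odd⇒half n n-odd
  ... | k , refl = cong ((ℤ.- pos 1) ℤ.*_) (trans (ℤ.^-distribˡ-+-* (ℤ.- pos 1) k k) (square k))
    where
    square : ∀ k → (ℤ.- pos 1) ℤ.^ k ℤ.* (ℤ.- pos 1) ℤ.^ k ≡ pos 1
    square k = trans (sym (^-distribʳ-*-ℤ k (ℤ.- pos 1) (ℤ.- pos 1))) (ℤ.^-zeroˡ k)

  -- Abstract, since conversion checking would otherwise unfold the multiplication by the literal.
  abstract
    C₀ : ℕ
    C₀ = 36864

    C₀≡ : C₀ ≡ 6 * 6144
    C₀≡ = refl

  module Subgroup (p : ℕ) (p-prime : Prime p) (2<p : 2 < p) (d : ℕ) (d-odd : Odd d) where

    open ShortVector p p-prime
    open Mod p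
    open Equidistribution p

    instance
      d≢0 : NonZero d
      d≢0 = odd⇒nonZero d-odd
      γ≢0 : NonZero (γ d)
      γ≢0 = γ-nonZero d

    -- The integer part of p^(1 - 1/γ(d)), in which the error is expressed until real numbers enter.
    j : ℕ
    j = ⌊root⌋ (γ d) (p ^ (γ d ∸ 1))

    p^γ : p ^ γ d ≡ p * p ^ (γ d ∸ 1)
    p^γ = cong (p ^_) (sym (suc-pred (γ d)))

    1≤j : 1 ≤ j
    1≤j = ⌊root⌋-max (γ d) (p ^ (γ d ∸ 1)) 1 (subst (_≤ p ^ (γ d ∸ 1)) (sym (^-zeroˡ (γ d))) (m^n>0 p (γ d ∸ 1)))

    -- From p^(1/γ) ≤ c and p^(1 - 1/γ) < j + 1, multiplied together. The proof compares γ(d)-th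
    -- powers instead of roots.
    p≤C*Y*suc-j : ∀ c → p ≤ c ^ γ d → p ≤ c * suc j
    p≤C*Y*suc-j c p≤c^γ = ≮⇒≥ λ small → <⇒≱ (begin-strict
      p ^ γ d ≡⟨ p^γ ⟩
      p * p ^ (γ d ∸ 1) <⟨ *-monoʳ-< p (⌊root⌋-upper (γ d) (p ^ (γ d ∸ 1))) ⟩
      p * suc j ^ γ d ≤⟨ *-monoˡ-≤ (suc j ^ γ d) p≤c^γ ⟩
      c ^ γ d * suc j ^ γ d ≡⟨ ^-distribʳ-* (γ d) c (suc j) ⟨
      (c * suc j) ^ γ d ∎) (^-monoˡ-≤ (γ d) (<⇒≤ small))
      where open ≤-Reasoning

    module Element (h : ℤ) (h^d≈1 : h ℤ.^ d ≈ pos 1) (h≉1 : ¬ h ≈ pos 1) where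

      h≉-1 : ¬ h ≈ ℤ.- pos 1
      h≉-1 h≈-1 = <⇒≱ 2<p (∣⇒≤ (ℤ.∣⇒∣ᵤ (p∣diff 1≈-1)))
        where
        1≈-1 : pos 1 ≈ ℤ.- pos 1
        1≈-1 = ≈-trans (≈-sym h^d≈1) (≈-trans (^-cong-≈ d h≈-1) (≡⇒≈ (-1^odd d d-odd)))

      h⁻¹ : ℤ
      h⁻¹ = h ℤ.^ (d ∸ 1)

      hh⁻¹≈1 : h ℤ.* h⁻¹ ≈ pos 1
      hh⁻¹≈1 = ≈-trans (≡⇒≈ (cong (h ℤ.^_) (suc-pred d))) h^d≈1

      open Line h h⁻¹ hh⁻¹≈1

      -- The order of h is `suc m`: the shift keeps the exponent 0 out of the search for the least
      -- one.
      IsOrder : ℕ → Set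
      IsOrder m = m ≤ d ∸ 1 × h ℤ.^ suc m ≈ pos 1 × (∀ i → i < m → ¬ h ℤ.^ suc i ≈ pos 1)

      order : ∃[ m ] IsOrder m
      order = least (λ m → h ℤ.^ suc m ≈? pos 1) (d ∸ 1) hh⁻¹≈1

      order∣d : ∀ {m} → IsOrder m → suc m ∣ d
      order∣d {m} (_ , h^k≈1 , minimal) = m%n≡0⇒n∣m d k (remainder (d % k) refl)
        where
        k : ℕ
        k = suc m
        h^r≈1 : h ℤ.^ (d % k) ≈ pos 1
        h^r≈1 = ≈-sym (≈-trans (≈-sym h^d≈1) (≈-trans (≡⇒≈ (trans (cong (h ℤ.^_) (m≡m%n+[m/n]*n d k))
          (trans (ℤ.^-distribˡ-+-* h (d % k) (d / k * k)) (cong (h ℤ.^ (d % k) ℤ.*_)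
            (trans (cong (h ℤ.^_) (*-comm (d / k) k)) (sym (ℤ.^-*-assoc h k (d / k))))))))
          (≈-trans (*-congˡ-≈ (h ℤ.^ (d % k)) (≈-trans (^-cong-≈ (d / k) h^k≈1) (≡⇒≈ (ℤ.^-zeroˡ (d / k)))))
            (≡⇒≈ (ℤ.*-identityʳ _)))))
        remainder : ∀ r → d % k ≡ r → d % k ≡ 0
        remainder zero    eq = eq
        remainder (suc r) eq = contradiction (subst (λ t → h ℤ.^ t ≈ pos 1) eq h^r≈1)
          (minimal r (s<s⁻¹ (subst (_< k) eq (m%n<n d k))))

      p≤ : ∀ (v : Short h) → p ≤ 512 * Short.Y v * suc j
      p≤ v = p≤C*Y*suc-j (512 * Y) (from-order order)
        where
        open Short v
        from-order : ∃[ m ] IsOrder m → p ≤ (512 * Y) ^ γ d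
        from-order (zero  , _ , h^1≈1 , _) = contradiction (≈-trans (≡⇒≈ (sym (ℤ.*-identityʳ h))) h^1≈1) h≉1
        from-order (m@(suc _) , o@(_ , h^k≈1 , minimal)) = ≤-trans
          (short-bound v (suc m) (λ 2∣k → d-odd (∣-trans 2∣k (order∣d o))) h^k≈1 minimal′)
          (^-monoʳ-≤ (512 * Y) {{m*n≢0 512 Y {{_}} {{Y≢0 v}}}} (φ≤γ d (order∣d o)))
          where
          minimal′ : ∀ i .{{_ : NonZero i}} → i < suc m → ¬ h ℤ.^ i ≈ pos 1
          minimal′ (suc i) (s<s i<m) = minimal i i<m

      -- Every e is reached in n steps with Y n ≤ 3p, each costing 2p. Using p ≤ 512 Y (j + 1) ≤ 512
      -- Y · 2j for one factor p, the Y cancels and 2 · 3 · 512 · 2 = 6144 remains.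
      line-close : ∀ e → ∣ line e - line (pos 0) ∣ ≤ 6144 * (p * j)
      line-close e = close (short-vector h h≉1 h≉-1)
        where
        open ≤-Reasoning
        close : Short h → ∣ line e - line (pos 0) ∣ ≤ 6144 * (p * j)
        close v = covered (covering v e slope)
          where
          open Short v
          lemma₁ : ∀ Y p n → Y * (2 * p * n) ≡ 2 * p * (Y * n)
          lemma₁ = solve-∀
          lemma₂ : ∀ Y p j → 2 * p * (3 * (512 * Y * (2 * j))) ≡ Y * (6144 * (p * j))
          lemma₂ = solve-∀
          suc-j≤ : suc j ≤ 2 * j
          suc-j≤ = subst (suc j ≤_) (cong (_+_ j) (sym (+-identityʳ j))) (+-monoˡ-≤ j 1≤j)
          covered : (∃₂ λ z s → e ≈ z ℤ.+ s ℤ.* h × Y * (ℤ.∣ z ∣ + ℤ.∣ s ∣) ≤ 3 * p) → ∣ line e - line (pos 0) ∣ ≤ 6144 * (p * j)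
          covered (z , s , e≈ , bound) = *-cancelˡ-≤ Y {{Y≢0 v}} (begin
            Y * ∣ line e - line (pos 0) ∣ ≤⟨ *-monoʳ-≤ Y (line-walk z s e≈) ⟩
            Y * (2 * p * (ℤ.∣ z ∣ + ℤ.∣ s ∣)) ≡⟨ lemma₁ Y p _ ⟩
            2 * p * (Y * (ℤ.∣ z ∣ + ℤ.∣ s ∣)) ≤⟨ *-monoʳ-≤ (2 * p) bound ⟩
            2 * p * (3 * p) ≤⟨ *-monoʳ-≤ (2 * p) (*-monoʳ-≤ 3 (≤-trans (p≤ v) (*-monoʳ-≤ (512 * Y) suc-j≤))) ⟩
            2 * p * (3 * (512 * Y * (2 * j))) ≡⟨ lemma₂ Y p j ⟩
            Y * (6144 * (p * j)) ∎)

      line-error : ∣ 6 * line (pos 0) - suc p * suc (2 * p) ∣ ≤ C₀ * (p * j)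
      line-error = subst (∣ 6 * line (pos 0) - suc p * suc (2 * p) ∣ ≤_)
        (trans (sym (*-assoc 6 6144 (p * j))) (cong (_* (p * j)) (sym C₀≡)))
        (line-equidistributed (6144 * (p * j)) line-close)

-- Power sums of complex roots of unity, constructively.

module RootsOfUnity where

  open import Defs
  open import Algebra.Bundles using (CommutativeRing)
  open import Data.Fin.Base as Fin using (toℕ)
  open import Data.Nat.Base as ℕ using (ℕ; zero; suc; NonZero)
  import Data.Nat.Properties as ℕ
  open import Data.Product.Base using (_,_)
  open import Data.Rational.Base as ℚ using (ℚ; 0ℚ; 1ℚ)
  import Data.Rational.Properties as ℚ
  open import Data.Sum.Base using (_⊎_; inj₁; inj₂)
  open import Function.Base using (_∘_)
  open import Relation.Binary.PropositionalEquality as ≡ using (_≡_)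
  open import Relation.Nullary using (¬_; contradiction)

  open CommutativeRing ℂ-commutativeRing
  open import Algebra.Properties.Monoid.Mult +-monoid using (×-congʳ) renaming (_×_ to _·_)
  open import Algebra.Properties.Semiring.Mult semiring using (×-comm-*)
  open import Algebra.Properties.Semiring.Exp semiring using (^-congˡ)
  open import Algebra.Properties.Semiring.Sum semiring using (sum; sum-cong-≋; sum-replicate; sum-replicate-zero; *-distribʳ-sum; *-distribˡ-sum)
  open import Algebra.Properties.Ring ring using (x∙y⁻¹≈ε⇒x≈y; +-cancelˡ; -‿distribʳ-*; -1*x≈-x)
  open import Relation.Binary.Reasoning.Setoid setoid

  seq-re-· : ∀ k n → ℝ.seq (ℂ.re (k · 1#)) n ≡ fromℕ k
  seq-re-· zero    n = ≡.refl
  seq-re-· (suc k) n = ≡.trans (≡.cong (1ℚ ℚ.+_) (seq-re-· k n)) (≡.sym (fromℕ-suc k))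

  1≤fromℕ : ∀ k .{{_ : NonZero k}} → 1ℚ ℚ.≤ fromℕ k
  1≤fromℕ (suc k) = fromℕ-mono {1} {suc k} (ℕ.s≤s ℕ.z≤n)

  0<re· : ∀ k .{{_ : NonZero k}} → fromℚ 0ℚ <ᴿ ℂ.re (k · 1#)
  0<re· k = 1ℚ , ℚ.positive⁻¹ 1ℚ , 0 , λ n _ → ≡.subst₂ ℚ._≤_ (≡.sym (ℚ.+-identityˡ 1ℚ)) (≡.sym (seq-re-· k n)) (1≤fromℕ k)

  x·k≈0⇒x≈0 : ∀ k .{{_ : NonZero k}} {x} → k · x ≈ 0# → x ≈ 0#
  x·k≈0⇒x≈0 k {x} kx≈0 = *ᶜ-cancel-0 x (k · 1#) (0<re· k) (trans (×-comm-* k x 1#) (trans (×-congʳ k (*-identityʳ x)) kx≈0))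

  ·1-injective : ∀ m n → m · 1# ≈ n · 1# → m ≡ n
  ·1-injective zero    zero    eq = ≡.refl
  ·1-injective zero    (suc n) eq = contradiction (x·k≈0⇒x≈0 (suc n) (sym eq)) (ℂ-roots.0≄1 ∘ sym)
  ·1-injective (suc m) zero    eq = contradiction (x·k≈0⇒x≈0 (suc m) eq) (ℂ-roots.0≄1 ∘ sym)
  ·1-injective (suc m) (suc n) eq = ≡.cong suc (·1-injective m n (+-cancelˡ 1# _ _ eq))

  1^ : ∀ n → 1# ^ᶜ n ≈ 1#
  1^ zero    = refl
  1^ (suc n) = trans (*-identityˡ (1# ^ᶜ n)) (1^ n)

  -- z + z² + ⋯ + zⁿ; starting from z makes it vanish at z = 0.
  powerSum : ℕ → ℂ → ℂ
  powerSum n z = sum {n} (λ j → z ^ᶜ suc (toℕ j))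

  powerSum-0 : ∀ n {z} → z ≈ 0# → powerSum n z ≈ 0#
  powerSum-0 n {z} z≈0 = trans (sum-cong-≋ {n} (λ j → trans (*-congʳ z≈0) (zeroˡ _))) (sum-replicate-zero n)

  powerSum-1 : ∀ n {z} → z ≈ 1# → powerSum n z ≈ n · 1#
  powerSum-1 n {z} z≈1 = trans (sum-cong-≋ {n} (λ j → trans (^-congˡ (suc (toℕ j)) z≈1) (1^ (suc (toℕ j))))) (sum-replicate n)

  powerSum-suc : ∀ n z → powerSum (suc n) z ≈ z + z * powerSum n z
  powerSum-suc n z = +-cong (*-identityʳ z) (sym (*-distribˡ-sum {n} z _))

  -- Both sides are z + z² + ⋯ + z^(n+1), with the first or the last term split off.
  powerSum-shift : ∀ n z → z + z * powerSum n z ≈ powerSum n z + z * z ^ᶜ n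
  powerSum-shift zero    z = trans (+-comm z _) (+-cong (zeroʳ z) (sym (*-identityʳ z)))
  powerSum-shift (suc n) z = begin
    z + z * powerSum (suc n) z ≈⟨ +-congˡ (*-congˡ (trans (powerSum-suc n z) (powerSum-shift n z))) ⟩
    z + z * (powerSum n z + z * z ^ᶜ n) ≈⟨ +-congˡ (distribˡ z _ _) ⟩
    z + (z * powerSum n z + z * (z * z ^ᶜ n)) ≈⟨ +-assoc z _ _ ⟨
    z + z * powerSum n z + z * z ^ᶜ suc n ≈⟨ +-congʳ (powerSum-suc n z) ⟨
    powerSum (suc n) z + z * z ^ᶜ suc n ∎

  fixed-^ : ∀ {z u} → z * u ≈ u → ∀ j → z ^ᶜ j * u ≈ u
  fixed-^ zu≈u zero    = *-identityˡ _
  fixed-^ {z} {u} zu≈u (suc j) = trans (*-assoc z (z ^ᶜ j) u) (trans (*-congˡ (fixed-^ zu≈u j)) zu≈u)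

  powerSum-fixed : ∀ n {z u} → z * u ≈ u → powerSum n z * u ≈ n · u
  powerSum-fixed n {z} {u} zu≈u = trans (*-distribʳ-sum {n} u _)
    (trans (sum-cong-≋ {n} (λ j → fixed-^ {z} {u} zu≈u (suc (toℕ j)))) (sum-replicate n))

  module _ (m : ℕ) .{{_ : NonZero m}} {z : ℂ} (z^m≈1 : z ^ᶜ m ≈ 1#) where

    S : ℂ
    S = powerSum m z

    zS≈S : z * S ≈ S
    zS≈S = +-cancelˡ z (z * S) S (trans (powerSum-shift m z)
      (trans (+-congˡ (trans (*-congˡ z^m≈1) (*-identityʳ z))) (+-comm S z)))

    -- S is 0 or m, as S (m - S) = 0; whichever factor has positive real part can be cancelled.
    powerSum-root : ¬ z ≈ 1# → S ≈ 0#
    powerSum-root z≉1 = decide (0<⊎<1 (ℂ.re S))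
      where
      decide : (fromℚ 0ℚ <ᴿ ℂ.re S) ⊎ (ℂ.re S <ᴿ fromℚ 1ℚ) → S ≈ 0#
      decide (inj₁ 0<S) = contradiction (x∙y⁻¹≈ε⇒x≈y z 1# (*ᶜ-cancel-0 (z - 1#) S 0<S (begin
        (z - 1#) * S ≈⟨ distribʳ S z (- 1#) ⟩
        z * S + - 1# * S ≈⟨ +-cong zS≈S (-1*x≈-x S) ⟩
        S + - S ≈⟨ -‿inverseʳ S ⟩
        0# ∎))) z≉1
      decide (inj₂ (δ , 0<δ , N , S+δ≤1)) = *ᶜ-cancel-0 S (m · 1# - S)
        (δ , 0<δ , N , λ n N≤n → ≡.subst₂ ℚ._≤_ (≡.sym (ℚ.+-identityˡ δ))
          (≡.cong (ℚ._+ ℚ.- ℝ.seq (ℂ.re S) n) (≡.sym (seq-re-· m n)))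
          (ℚ.≤-trans (ℚ.≤-reflexive (cancel (ℝ.seq (ℂ.re S) n) δ))
            (ℚ.+-monoˡ-≤ (ℚ.- ℝ.seq (ℂ.re S) n) (ℚ.≤-trans (S+δ≤1 n N≤n) (1≤fromℕ m)))))
        (begin
          S * (m · 1# - S) ≈⟨ distribˡ S (m · 1#) (- S) ⟩
          S * (m · 1#) + S * - S ≈⟨ +-cong (trans (×-comm-* m S 1#) (×-congʳ m (*-identityʳ S)))
                                              (trans (sym (-‿distribʳ-* S S)) (-‿cong (powerSum-fixed m zS≈S))) ⟩
          m · S + - (m · S) ≈⟨ -‿inverseʳ (m · S) ⟩
          0# ∎)
        where
        open import Data.Rational.Solver using (module +-*-Solver)
        open +-*-Solver
        cancel : ∀ s δ → δ ≡ s ℚ.+ δ ℚ.+ ℚ.- s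
        cancel = solve 2 (λ s δ → δ := s :+ δ :+ :- s) ≡.refl

    -- The negation ¬ z ≈ 1 gives no apartness with which to cancel z - 1. Instead every power of z
    -- fixes u, so m u = S u = 0, and the positive integer m can be cancelled.
    fixed≈0 : ¬ z ≈ 1# → ∀ {u} → z * u ≈ u → u ≈ 0#
    fixed≈0 z≉1 {u} zu≈u = x·k≈0⇒x≈0 m (trans (sym (powerSum-fixed m zu≈u)) (trans (*-congʳ (powerSum-root z≉1)) (zeroˡ u)))

-- The kernel of a character and its size.

module CharacterKernel where

  open import Defs
  open Totients using (𝟙; 𝟙-cong)
  open Modular
  open ShortVectors using (bézout-ℤ; module ShortVector)
  open RootsOfUnity
  open import Algebra.Bundles using (CommutativeRing)
  open import Data.Fin.Base as Fin using (Fin; toℕ; fromℕ<)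
  open import Data.Fin.Properties using (toℕ-fromℕ<; ¬∀⟶∃¬; toℕ<n)
  open import Data.Integer.Base as ℤ using (ℤ; -[1+_]) renaming (+_ to pos)
  open import Data.Integer.Coprimality using (Coprime)
  import Data.Integer.Divisibility.Signed as ℤ
  import Data.Integer.Properties as ℤ
  import Data.Integer.Tactic.RingSolver as ℤ
  open import Data.Nat.Base as ℕ using (ℕ; zero; suc; NonZero)
  open import Data.Nat.Primality using (Prime; prime⇒irreducible)
  import Data.Nat.Properties as ℕ
  open import Data.Product.Base using (_,_; ∃-syntax; _×_; proj₁; proj₂; map₂)
  open import Data.Sum.Base using (_⊎_; inj₁; inj₂)
  open import Function.Base using (_∘_)
  open import Relation.Binary.PropositionalEquality as ≡ using (_≡_)
  open import Relation.Nullary using (¬_; Dec; yes; no; contradiction)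
  open import Relation.Nullary.Decidable using (map′)

  open CommutativeRing ℂ-commutativeRing using (_+_; _*_; 0#; 1#; refl; sym; trans; *-congˡ; *-congʳ; *-assoc; *-comm;
    *-identityˡ; *-identityʳ; zeroˡ; zeroʳ; +-commutativeMonoid; +-monoid; semiring; commutativeSemiring; setoid)
  open import Algebra.Properties.Monoid.Mult +-monoid using (×-homo-+; ×-congˡ) renaming (_×_ to _·_)
  open import Algebra.Properties.Semiring.Exp semiring using (^-congˡ; ^-congʳ; ^-assocʳ)
  open import Algebra.Properties.CommutativeSemiring.Exp commutativeSemiring using (^-distrib-*)
  open import Algebra.Properties.Semiring.Sum semiring using (sum; sum-cong-≋; sum-replicate; *-distribˡ-sum; ∑-comm)
  import Algebra.Properties.CommutativeMonoid.Sum ℕ.+-0-commutativeMonoid as ℕSum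
  open import Relation.Binary.Reasoning.Setoid setoid

  ·1-sum : ∀ {n} (f : Fin n → ℕ) → sum (λ i → f i · 1#) ≃ᶜ ℕSum.sum f · 1#
  ·1-sum {zero}  f = refl
  ·1-sum {suc n} f = trans (CommutativeRing.+-congˡ ℂ-commutativeRing (·1-sum (f ∘ Fin.suc)))
    (sym (×-homo-+ 1# (f Fin.zero) (ℕSum.sum (f ∘ Fin.suc))))

  module Kernel {p : ℕ} (p-prime : Prime p) (X : DirichletCharacter p) {m : ℕ} (ord : HasOrder X m) where

    open ShortVector p p-prime using (p≢0; 1<p)
    open Mod p
    open HasOrder ord renaming (nonZero to m≢0)

    c : ℤ → ℂ
    c = χ X

    periodic* : ∀ n a → c (a ℤ.+ pos n ℤ.* pos p) ≃ᶜ c a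
    periodic* zero    a = ≡.subst (λ t → c t ≃ᶜ c a) (≡.sym (≡.trans (≡.cong (λ t → a ℤ.+ t) (ℤ.*-zeroˡ (pos p))) (ℤ.+-identityʳ a))) refl
    periodic* (suc n) a = trans (≡.subst (λ t → c t ≃ᶜ c (a ℤ.+ pos n ℤ.* pos p)) (lemma a (pos n) (pos p))
      (periodic X (a ℤ.+ pos n ℤ.* pos p))) (periodic* n a)
      where
      lemma : ∀ a n p → a ℤ.+ n ℤ.* p ℤ.+ p ≡ a ℤ.+ (pos 1 ℤ.+ n) ℤ.* p
      lemma = ℤ.solve-∀

    c-cong : ∀ {a b} → a ≈ b → c a ≃ᶜ c b
    c-cong {a} {b} (mk≈ (ℤ.divides (pos n) eq)) = ≡.subst (λ t → c t ≃ᶜ c b)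
      (≡.trans (≡.cong (λ t → b ℤ.+ t) (≡.sym eq)) (lemma a b)) (periodic* n b)
      where
      lemma : ∀ a b → b ℤ.+ (a ℤ.- b) ≡ a
      lemma = ℤ.solve-∀
    c-cong {a} {b} (mk≈ (ℤ.divides -[1+ n ] eq)) = sym (≡.subst (λ t → c t ≃ᶜ c a)
      (≡.trans (≡.cong (λ t → a ℤ.+ t) (≡.trans (≡.sym (neg -[1+ n ] (pos p))) (≡.cong ℤ.-_ (≡.sym eq)))) (lemma a b)) (periodic* (suc n) a))
      where
      neg : ∀ i p → ℤ.- (i ℤ.* p) ≡ (ℤ.- i) ℤ.* p
      neg = ℤ.solve-∀
      lemma : ∀ a b → a ℤ.+ ℤ.- (a ℤ.- b) ≡ b
      lemma = ℤ.solve-∀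

    Unit : ℤ → Set
    Unit a = ¬ a ≈ pos 0

    unit⇒coprime : ∀ {a} → Unit a → Coprime a (pos p)
    unit⇒coprime {a} a≉0 (e∣a , e∣p) with prime⇒irreducible p-prime e∣p
    ... | inj₁ e≡1    = e≡1
    ... | inj₂ ≡.refl = contradiction (mk≈ (≡.subst (pos p ℤ.∣_) (≡.sym (ℤ.+-identityʳ a)) (ℤ.∣ᵤ⇒∣ e∣a))) a≉0

    coprime⇒unit : ∀ {a} → Coprime a (pos p) → Unit a
    coprime⇒unit {a} cop (mk≈ p∣a) = ℕ.<⇒≢ 1<p (≡.sym (cop
      (ℤ.∣⇒∣ᵤ (≡.subst (pos p ℤ.∣_) (ℤ.+-identityʳ a) p∣a) , ℤ.∣⇒∣ᵤ (ℤ.∣-refl {pos p}))))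

    c-nonunit : ∀ {a} → a ≈ pos 0 → c a ≃ᶜ 0#
    c-nonunit a≈0 = vanishes X _ (λ cop → coprime⇒unit cop a≈0)

    c-unit : ∀ {a} → Unit a → c a ^ᶜ m ≃ᶜ 1#
    c-unit a≉0 = principal _ (unit⇒coprime a≉0)

    unit-inverse : ∀ {a} → Unit a → ∃[ b ] a ℤ.* b ≈ pos 1
    unit-inverse {a} a≉0 = map₂ mk≈ (bézout-ℤ p a (λ (e∣p , e∣a) → unit⇒coprime a≉0 (e∣a , e∣p)))

    c-cancel : ∀ {a b} → Unit a → c (b ℤ.* a) ≃ᶜ c a → c b ≃ᶜ 1#
    c-cancel {a} {b} a≉0 eq = begin
      c b ≈⟨ *-identityʳ (c b) ⟨
      c b * 1# ≈⟨ *-congˡ cacv≈1 ⟨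
      c b * (c a * c v) ≈⟨ *-assoc (c b) (c a) (c v) ⟨
      c b * c a * c v ≈⟨ *-congʳ (trans (sym (χ-* X b a)) eq) ⟩
      c a * c v ≈⟨ cacv≈1 ⟩
      1# ∎
      where
      v : ℤ
      v = proj₁ (unit-inverse a≉0)
      cacv≈1 : c a * c v ≃ᶜ 1#
      cacv≈1 = trans (sym (χ-* X a v)) (trans (c-cong (proj₂ (unit-inverse a≉0))) (χ-1 X))

    -- Compared with the value at 1 rather than with the number 1, because `χ-≟` decides equality
    -- between two values of the character.
    H : ℤ → Set
    H a = c a ≃ᶜ c (pos 1)

    H? : ∀ a → Dec (H a)
    H? a = χ-≟ X ord a (pos 1)

    H-cong : ∀ {a b} → a ≈ b → H a → H b
    H-cong a≈b Ha = trans (c-cong (≈-sym a≈b)) Ha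

    H⇒unit : ∀ {a} → H a → Unit a
    H⇒unit Ha a≈0 = ℂ-roots.0≄1 (trans (sym (c-nonunit a≈0)) (trans Ha (χ-1 X)))

    𝟙H : ℤ → ℕ
    𝟙H a = 𝟙 (H? a)

    𝟙H-cong : ∀ {a b} → a ≈ b → 𝟙H a ≡ 𝟙H b
    𝟙H-cong {a} {b} a≈b = 𝟙-cong (H? a) (H? b) (H-cong a≈b) (H-cong (≈-sym a≈b))

    ∣H∣ : ℕ
    ∣H∣ = ℕSum.sum {p} (λ i → 𝟙H (pos (toℕ i)))

    open Sums +-commutativeMonoid using (∑ₚ; ∑ₚ-scale; ∑ₚ-cong)

    -- Orthogonality at a single a. On H all powers are 1. Off H the value is either 0, where it
    -- matters that the sum starts at exponent 1, or an m-th root of unity other than 1.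
    powerSum-c : ∀ a → powerSum m (c a) ≃ᶜ (𝟙H a ℕ.* m) · 1#
    powerSum-c a = cases (H? a) (a ≈? pos 0)
      where
      cases : (Ha? : Dec (H a)) → Dec (a ≈ pos 0) → powerSum m (c a) ≃ᶜ (𝟙 Ha? ℕ.* m) · 1#
      cases (yes Ha) _         = trans (powerSum-1 m (trans Ha (χ-1 X))) (sym (×-congˡ (ℕ.+-identityʳ m)))
      cases (no ¬Ha) (yes a≈0) = powerSum-0 m (c-nonunit a≈0)
      cases (no ¬Ha) (no  a≉0) = powerSum-root m (c-unit a≉0) (λ ca≈1 → ¬Ha (trans ca≈1 (sym (χ-1 X))))

    -- Nonunits are counted as trivial, so that if this holds at all p residues then the k-th power
    -- is principal. Being decidable, it lets a finite search produce a counterexample when that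
    -- power is not principal.
    IsTrivialAt : ℕ → ℤ → Set
    IsTrivialAt k a = a ≈ pos 0 ⊎ c a ^ᶜ k ≃ᶜ 1#

    c^-root : ∀ k {a} → Unit a → (c a ^ᶜ k) ^ᶜ m ≃ᶜ 1#
    c^-root k {a} a≉0 = trans (^-assocʳ (c a) k m) (trans (^-congʳ (c a) (ℕ.*-comm k m))
      (trans (sym (^-assocʳ (c a) m k)) (trans (^-congˡ k (c-unit a≉0)) (1^ k))))

    IsTrivialAt? : ∀ k a → Dec (IsTrivialAt k a)
    IsTrivialAt? k a = cases (a ≈? pos 0)
      where
      cases : Dec (a ≈ pos 0) → Dec (IsTrivialAt k a)
      cases (yes a≈0) = yes (inj₁ a≈0)
      cases (no  a≉0) = map′ inj₂ (λ { (inj₁ a≈0) → contradiction a≈0 a≉0 ; (inj₂ eq) → eq })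
        (ℂ-roots.roots-≟ m (c^-root k a≉0) (1^ m))

    nontrivial-at : ∀ k → ¬ IsPrincipal^ X k → ∃[ a ] Unit a × ¬ c a ^ᶜ k ≃ᶜ 1#
    nontrivial-at k not-principal = found (¬∀⟶∃¬ p (λ i → IsTrivialAt k (pos (toℕ i))) (λ i → IsTrivialAt? k (pos (toℕ i)))
      (λ all → not-principal λ a cop → trivial a (coprime⇒unit cop) (all (fromℕ< (residue<p a)))))
      where
      trivial : ∀ a → Unit a → IsTrivialAt k (pos (toℕ (fromℕ< (residue<p a)))) → c a ^ᶜ k ≃ᶜ 1#
      trivial a a≉0 = λ { (inj₁ r≈0) → contradiction (≈-trans (≈-sym r≈a) r≈0) a≉0
                        ; (inj₂ eq)  → trans (^-congˡ k (c-cong (≈-sym r≈a))) eq }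
        where
        r≈a : pos (toℕ (fromℕ< (residue<p a))) ≈ a
        r≈a = ≈-trans (≡⇒≈ (≡.cong pos (toℕ-fromℕ< (residue<p a)))) (residue≈ a)
      found : (∃[ i ] ¬ IsTrivialAt k (pos (toℕ {p} i))) → ∃[ a ] Unit a × ¬ c a ^ᶜ k ≃ᶜ 1#
      found (i , ¬trivial) = pos (toℕ i) , ¬trivial ∘ inj₁ , ¬trivial ∘ inj₂

    characterSum : ℕ → ℂ
    characterSum k = ∑ₚ (λ a → c a ^ᶜ k)

    -- Multiplication by a unit a₀ permutes the residues, so c(a₀)^k fixes the sum. For an a₀ with
    -- c(a₀)^k ≠ 1, `fixed≈0` makes the sum vanish.
    characterSum-nontrivial : ∀ k → ¬ IsPrincipal^ X k → characterSum k ≃ᶜ 0#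
    characterSum-nontrivial k not-principal = vanish (nontrivial-at k not-principal)
      where
      vanish : ∃[ a ] Unit a × ¬ c a ^ᶜ k ≃ᶜ 1# → characterSum k ≃ᶜ 0#
      vanish (a₀ , a₀≉0 , ≄1) = fixed≈0 m (c^-root k a₀≉0) ≄1 (begin
        c a₀ ^ᶜ k * characterSum k ≈⟨ *-distribˡ-sum {p} (c a₀ ^ᶜ k) (λ i → c (pos (toℕ i)) ^ᶜ k) ⟩
        ∑ₚ (λ a → c a₀ ^ᶜ k * c a ^ᶜ k) ≈⟨ ∑ₚ-cong (λ a → trans (sym (^-distrib-* (c a₀) (c a) k)) (^-congˡ k (sym (χ-* X a₀ a)))) ⟩
        ∑ₚ (λ a → c (a₀ ℤ.* a) ^ᶜ k) ≈⟨ ∑ₚ-scale a₀ (proj₁ inverse) (proj₂ inverse) (λ a≈b → ^-congˡ k (c-cong a≈b)) ⟩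
        characterSum k ∎)
        where
        inverse : ∃[ v ] a₀ ℤ.* v ≈ pos 1
        inverse = unit-inverse a₀≉0

    characterSum-principal : characterSum m ≃ᶜ (p ℕ.∸ 1) · 1#
    characterSum-principal = go p ≡.refl
      where
      go : ∀ q → q ≡ p → characterSum m ≃ᶜ (q ℕ.∸ 1) · 1#
      go zero    0≡p    = contradiction (≡.sym 0≡p) (ℕ.≢-nonZero⁻¹ p)
      go (suc q) ≡.refl = trans (CommutativeRing.+-cong ℂ-commutativeRing
          (trans (^-congˡ m (c-nonunit (≈-refl {pos 0}))) (0^ m))
          (trans (sum-cong-≋ {q} (λ i → c-unit (unit i))) (sum-replicate q)))
        (CommutativeRing.+-identityˡ ℂ-commutativeRing (q · 1#))
        where
        0^ : ∀ m .{{_ : NonZero m}} → 0# ^ᶜ m ≃ᶜ 0#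
        0^ (suc m) = zeroˡ (0# ^ᶜ m)
        unit : ∀ (i : Fin q) → Unit (pos (suc (toℕ i)))
        unit i i≈0 = contradiction (ℤ.+-injective (≈0-small {pos (suc (toℕ i))} (ℕ.s<s (toℕ<n i)) i≈0)) λ ()

    -- Orthogonality: Σ_a Σ_{1≤j≤m} χ(a)^j, summed in both orders.
    ∣H∣*m≡p∸1 : ∣H∣ ℕ.* m ≡ p ℕ.∸ 1
    ∣H∣*m≡p∸1 = ·1-injective _ _ (begin
      (∣H∣ ℕ.* m) · 1# ≈⟨ ×-congˡ (ℕ.*-comm ∣H∣ m) ⟩
      (m ℕ.* ∣H∣) · 1# ≈⟨ ×-congˡ (m*sum {p} (λ i → 𝟙H (pos (toℕ i)))) ⟩
      ℕSum.sum {p} (λ i → 𝟙H (pos (toℕ i)) ℕ.* m) · 1# ≈⟨ ·1-sum {p} (λ i → 𝟙H (pos (toℕ i)) ℕ.* m) ⟨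
      ∑ₚ (λ a → (𝟙H a ℕ.* m) · 1#) ≈⟨ ∑ₚ-cong powerSum-c ⟨
      ∑ₚ (λ a → powerSum m (c a)) ≈⟨ ∑-comm {p} {m} (λ i j → c (pos (toℕ i)) ^ᶜ suc (toℕ j)) ⟩
      sum {m} (λ j → characterSum (suc (toℕ j))) ≈⟨ last-only m ≡.refl ⟩
      (p ℕ.∸ 1) · 1# ∎)
      where
      m*sum : ∀ {n} (f : Fin n → ℕ) → m ℕ.* ℕSum.sum f ≡ ℕSum.sum (λ i → f i ℕ.* m)
      m*sum {zero}  f = ℕ.*-zeroʳ m
      m*sum {suc n} f = ≡.trans (ℕ.*-distribˡ-+ m (f Fin.zero) _) (≡.cong₂ ℕ._+_ (ℕ.*-comm m (f Fin.zero)) (m*sum (f ∘ Fin.suc)))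
      sum-last : ∀ n (f : ℕ → ℂ) → (∀ i → i ℕ.< n → f i ≃ᶜ 0#) → sum {suc n} (f ∘ toℕ) ≃ᶜ f n
      sum-last zero    f f≈0 = CommutativeRing.+-identityʳ ℂ-commutativeRing (f 0)
      sum-last (suc n) f f≈0 = trans (CommutativeRing.+-cong ℂ-commutativeRing (f≈0 0 ℕ.z<s)
        (sum-last n (f ∘ suc) (λ i i<n → f≈0 (suc i) (ℕ.s<s i<n)))) (CommutativeRing.+-identityˡ ℂ-commutativeRing (f (suc n)))
      last-only : ∀ n → n ≡ m → sum {m} (λ j → characterSum (suc (toℕ j))) ≃ᶜ (p ℕ.∸ 1) · 1#
      last-only zero    0≡m    = contradiction (≡.sym 0≡m) (ℕ.≢-nonZero⁻¹ m)
      last-only (suc n) ≡.refl = trans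
        (sum-last n (characterSum ∘ suc) (λ i i<n → characterSum-nontrivial (suc i) (minimal (suc i) ℕ.z<s (ℕ.s<s i<n))))
        characterSum-principal

-- Agreement counts as sums over the lines of the kernel.

module AgreementCounts where

  open import Defs using (DirichletCharacter; χ-*; χ-1; HasOrder; χ-≟; agreements; [1⋯_]; _≃ᶜ_; module ℂ-roots; ℂ-commutativeRing)
  open import Algebra.Bundles using (CommutativeRing)
  open PrimitivePartSize using (Odd)
  open Totients using (𝟙; 𝟙-cong)
  open Modular
  open LineSums
  open ShortVectors using (^-distribʳ-*-ℤ; module ShortVector)
  open SubgroupLines
  open CharacterKernel
  open import Data.Fin.Base as Fin using (Fin; toℕ)
  open import Data.Fin.Properties using (toℕ<n)
  open import Data.Integer.Base as ℤ using (ℤ) renaming (+_ to pos)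
  import Data.Integer.Properties as ℤ
  open import Data.List.Base using (List; []; _∷_; length; map; filter; applyUpTo; cartesianProduct)
  open import Data.List.Properties using (length-++; filter-++)
  open import Data.Nat.Base
  open import Data.Nat.Divisibility using (_∣_; ∣⇒≤; ∣-trans; n∣m*n)
  open import Data.Nat.DivMod using (_/_; m/n*n≡m)
  import Data.Nat.ListAction as List
  open import Data.Nat.Primality
  open import Data.Nat.Properties
  open import Data.Nat.Tactic.RingSolver using (solve-∀)
  open import Data.Product.Base using (_,_; _×_; proj₁; proj₂)
  open import Function.Base using (_∘_)
  open import Relation.Binary.PropositionalEquality hiding (setoid; J)
  open import Relation.Nullary using (¬_; Dec; yes; no; contradiction)
  open import Relation.Unary using (Pred; Decidable)
  open import Algebra.Properties.CommutativeMonoid.Sum +-0-commutativeMonoid using (sum; sum-cong-≗; ∑-distrib-+; ∑-comm)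
  open import Algebra.Properties.Semiring.Sum +-*-semiring using (*-distribˡ-sum; *-distribʳ-sum)
  import Algebra.Properties.CommutativeMonoid.Sum as Sum

  length-filter-cartesianProduct : ∀ {a b p} {A : Set a} {B : Set b} {P : Pred (A × B) p} (P? : Decidable P) xs ys →
    length (filter P? (cartesianProduct xs ys)) ≡ List.sum (map (λ x → List.sum (map (λ y → 𝟙 (P? (x , y))) ys)) xs)
  length-filter-cartesianProduct P? []       ys = refl
  length-filter-cartesianProduct P? (x ∷ xs) ys = trans
    (cong length (filter-++ P? (map (x ,_) ys) (cartesianProduct xs ys)))
    (trans (length-++ (filter P? (map (x ,_) ys)))
      (cong₂ _+_ (row ys) (length-filter-cartesianProduct P? xs ys)))
    where
    row : ∀ ys → length (filter P? (map (x ,_) ys)) ≡ List.sum (map (λ y → 𝟙 (P? (x , y))) ys)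
    row []       = refl
    row (y ∷ ys) with P? (x , y)
    ... | yes _ = cong suc (row ys)
    ... | no  _ = row ys

  sum-map-applyUpTo : ∀ g (f : ℕ → ℕ) n → List.sum (map g (applyUpTo f n)) ≡ sum {n} (λ i → g (f (toℕ i)))
  sum-map-applyUpTo g f zero    = refl
  sum-map-applyUpTo g f (suc n) = cong (_+_ (g (f 0))) (sum-map-applyUpTo g (f ∘ suc) n)

  sum-snoc : ∀ n (f : ℕ → ℕ) → sum {suc n} (f ∘ toℕ) ≡ sum {n} (f ∘ toℕ) + f n
  sum-snoc zero    f = +-identityʳ (f 0)
  sum-snoc (suc n) f = trans (cong (_+_ (f 0)) (sum-snoc n (f ∘ suc))) (sym (+-assoc (f 0) _ _))

  sum-zero : ∀ {n} {f : Fin n → ℕ} → (∀ i → f i ≡ 0) → sum f ≡ 0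
  sum-zero {zero}  f≡0 = refl
  sum-zero {suc n} f≡0 = cong₂ _+_ (f≡0 Fin.zero) (sum-zero (f≡0 ∘ Fin.suc))

  sum² : ℕ → (ℕ → ℕ → ℕ) → ℕ
  sum² n g = sum {n} (λ i → sum {n} (λ j → g (toℕ i) (toℕ j)))

  sum²-shrink : ∀ n g → (∀ j → g n j ≡ 0) → (∀ i → g i n ≡ 0) → sum² (suc n) g ≡ sum² n g
  sum²-shrink n g last-row last-column = begin
    sum² (suc n) g
      ≡⟨ sum-snoc n (λ i → sum {suc n} (λ j → g i (toℕ j))) ⟩
    sum {n} (λ i → sum {suc n} (λ j → g (toℕ i) (toℕ j))) + sum {suc n} (λ j → g n (toℕ j))
      ≡⟨ cong₂ _+_ (sum-cong-≗ {n} (λ i → trans (sum-snoc n (g (toℕ i))) (trans (cong (_+_ _) (last-column (toℕ i))) (+-identityʳ _))))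
                   (sum-zero {suc n} (λ j → last-row (toℕ j))) ⟩
    sum² n g + 0
      ≡⟨ +-identityʳ (sum² n g) ⟩
    sum² n g ∎
    where open ≡-Reasoning

  -- Interchange of summation: (i, j) lies in the square for N exactly when N ≥ max(i, j), which
  -- happens for q - max(i, j) values of N < q.
  sum²-triangle : ∀ q g → sum {q} (λ N → sum² (suc (toℕ N)) g) ≡ sum² q (λ i j → (q ∸ (i ⊔ j)) * g i j)
  sum²-triangle zero    g = refl
  sum²-triangle (suc q) g = begin
    sum {suc q} (λ N → sum² (suc (toℕ N)) g)
      ≡⟨ sum-snoc q (λ N → sum² (suc N) g) ⟩
    sum {q} (λ N → sum² (suc (toℕ N)) g) + sum² (suc q) g
      ≡⟨ cong (_+ sum² (suc q) g) (sum²-triangle q g) ⟩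
    sum² q w + sum² (suc q) g
      ≡⟨ cong (_+ sum² (suc q) g) (sum²-shrink q w
           (λ j → cong (_* g q j) (m≤n⇒m∸n≡0 (m≤m⊔n q j)))
           (λ i → cong (_* g i q) (m≤n⇒m∸n≡0 (m≤n⊔m i q)))) ⟨
    sum² (suc q) w + sum² (suc q) g
      ≡⟨ ∑-distrib-+ {suc q} (λ i → sum {suc q} (λ j → w (toℕ i) (toℕ j)))
           (λ i → sum {suc q} (λ j → g (toℕ i) (toℕ j))) ⟨
    sum {suc q} (λ i → sum {suc q} (λ j → w (toℕ i) (toℕ j)) + sum {suc q} (λ j → g (toℕ i) (toℕ j)))
      ≡⟨ sum-cong-≗ {suc q} (λ i → trans (sym (∑-distrib-+ {suc q} (λ j → w (toℕ i) (toℕ j)) (λ j → g (toℕ i) (toℕ j))))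
           (sum-cong-≗ {suc q} (λ j → merge (toℕ i) (toℕ j) (s≤s⁻¹ (toℕ<n i)) (s≤s⁻¹ (toℕ<n j))))) ⟩
    sum² (suc q) (λ i j → (suc q ∸ (i ⊔ j)) * g i j) ∎
    where
    open ≡-Reasoning
    w : ℕ → ℕ → ℕ
    w i j = (q ∸ (i ⊔ j)) * g i j
    merge : ∀ i j → i ≤ q → j ≤ q → w i j + g i j ≡ (suc q ∸ (i ⊔ j)) * g i j
    merge i j i≤q j≤q = trans (+-comm (w i j) (g i j)) (cong (_* g i j) (sym (+-∸-assoc 1 (⊔-lub i≤q j≤q))))

  module Count {p : ℕ} (p-prime : Prime p) (X : DirichletCharacter p) {m : ℕ} (ord : HasOrder X m) where

    open ShortVector p p-prime using (p≢0; 1≉0; 1<p; *-≉0; ^-≉0)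
    open Mod p
    open Equidistribution p using (weight; weight-cong)
    open Kernel p-prime X ord
    open HasOrder ord using (nonZero)
    open CommutativeRing ℂ-commutativeRing using () renaming (refl to ≃-refl; sym to ≃-sym; trans to ≃-trans; *-congʳ to ≃-*-congʳ; *-identityˡ to ≃-*-identityˡ)

    module _ {h : ℤ} (Hh : H h) where

      c-H : ∀ a → c (h ℤ.* a) ≃ᶜ c a
      c-H a = ≃-trans (χ-* X h a) (≃-trans (≃-*-congʳ (≃-trans Hh (χ-1 X))) (≃-*-identityˡ (c a)))

      -- h permutes H, so h ^ ∣H∣ fixes the product of all elements of H.
      h^∣H∣≈1 : h ℤ.^ ∣H∣ ≈ pos 1
      h^∣H∣≈1 = prime-cancelˡ p-prime (∏-≉0 {p} F-≉0) (≈-trans (≡⇒≈ (ℤ.*-comm P (h ℤ.^ ∣H∣)))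
        (≈-trans h^∣H∣P≈P (≡⇒≈ (sym (ℤ.*-identityʳ P)))))
        where
        open Sum *-commutativeMonoid-≈ using () renaming (sum to ∏; ∑-distrib-+ to ∏-distrib-*; sum-cong-≋ to ∏-cong)
        open Sums *-commutativeMonoid-≈ using (∑ₚ-scale)
        -- Membership written as an exponent: F is a on H and 1 elsewhere, so a product over all
        -- residues is the product over H.
        F : ℤ → ℤ
        F a = a ℤ.^ 𝟙H a
        F-cong : ∀ {a b} → a ≈ b → F a ≈ F b
        F-cong {a} {b} a≈b = ≈-trans (^-cong-≈ (𝟙H a) a≈b) (≡⇒≈ (cong (b ℤ.^_) (𝟙H-cong a≈b)))
        P : ℤ
        P = ∏ {p} (λ i → F (pos (toℕ i)))
        power-≉0 : ∀ {a} (Ha? : Dec (H a)) → ¬ a ℤ.^ 𝟙 Ha? ≈ pos 0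
        power-≉0 (yes Ha) = ^-≉0 1 (H⇒unit Ha)
        power-≉0 (no  _)  = 1≉0
        F-≉0 : ∀ (i : Fin p) → ¬ F (pos (toℕ i)) ≈ pos 0
        F-≉0 i = power-≉0 (H? (pos (toℕ i)))
        ∏-≉0 : ∀ {n} {f : Fin n → ℤ} → (∀ i → ¬ f i ≈ pos 0) → ¬ ∏ f ≈ pos 0
        ∏-≉0 {zero}  f≉0 = 1≉0
        ∏-≉0 {suc n} f≉0 = *-≉0 (f≉0 Fin.zero) (∏-≉0 (f≉0 ∘ Fin.suc))
        ∏-^ : ∀ {n} (e : Fin n → ℕ) → ∏ (λ i → h ℤ.^ e i) ≈ h ℤ.^ sum e
        ∏-^ {zero}  e = ≈-refl
        ∏-^ {suc n} e = ≈-trans (*-congˡ-≈ (h ℤ.^ e Fin.zero) (∏-^ (e ∘ Fin.suc)))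
          (≡⇒≈ (sym (ℤ.^-distribˡ-+-* h (e Fin.zero) (sum (e ∘ Fin.suc)))))
        F-* : ∀ a → h ℤ.^ 𝟙H a ℤ.* F a ≈ F (h ℤ.* a)
        F-* a = ≡⇒≈ (trans (sym (^-distribʳ-*-ℤ (𝟙H a) h a)) (cong ((h ℤ.* a) ℤ.^_)
          (𝟙-cong (H? a) (H? (h ℤ.* a)) (≃-trans (c-H a)) (≃-trans (≃-sym (c-H a))))))
        h^∣H∣P≈P : h ℤ.^ ∣H∣ ℤ.* P ≈ P
        h^∣H∣P≈P = begin
          h ℤ.^ ∣H∣ ℤ.* P ≈⟨ *-congʳ-≈ P (∏-^ {p} (λ i → 𝟙H (pos (toℕ i)))) ⟨
          ∏ {p} (λ i → h ℤ.^ 𝟙H (pos (toℕ i))) ℤ.* P ≈⟨ ∏-distrib-* {p} (λ i → h ℤ.^ 𝟙H (pos (toℕ i))) (λ i → F (pos (toℕ i))) ⟨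
          ∏ {p} (λ i → h ℤ.^ 𝟙H (pos (toℕ i)) ℤ.* F (pos (toℕ i))) ≈⟨ ∏-cong {p} (λ i → F-* (pos (toℕ i))) ⟩
          ∏ {p} (λ i → F (h ℤ.* pos (toℕ i))) ≈⟨ ∑ₚ-scale h (proj₁ (unit-inverse (H⇒unit Hh))) (proj₂ (unit-inverse (H⇒unit Hh))) F-cong ⟩
          P ∎
          where open import Relation.Binary.Reasoning.Setoid setoid

    open Sums +-0-commutativeMonoid using (∑ₚ; ∑ₚ-scale; ∑ₚ-cong)

    J : ℤ → ℤ → ℕ
    J a b = 𝟙 (χ-≟ X ord a b)

    J-cong : ∀ a {b b′} → b ≈ b′ → J a b ≡ J a b′
    J-cong a {b} {b′} b≈b′ = 𝟙-cong (χ-≟ X ord a b) (χ-≟ X ord a b′)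
      (λ e → ≃-trans e (c-cong b≈b′)) (λ e → ≃-trans e (c-cong (≈-sym b≈b′)))

    J-unit : ∀ {a} h → Unit a → J a (a ℤ.* h) ≡ 𝟙H h
    J-unit {a} h a≉0 = 𝟙-cong (χ-≟ X ord a (a ℤ.* h)) (H? h)
      (λ e → ≃-trans (c-cancel a≉0 (≃-sym (subst (λ t → c a ≃ᶜ c t) (ℤ.*-comm a h) e))) (≃-sym (χ-1 X)))
      (λ Hh → ≃-sym (subst (λ t → c t ≃ᶜ c a) (ℤ.*-comm h a) (c-H Hh a)))

    J-0 : ∀ {a} → Unit a → J a (pos 0) ≡ 0
    J-0 {a} a≉0 = is-no (χ-≟ X ord a (pos 0))
      where
      is-no : (e? : Dec (c a ≃ᶜ c (pos 0))) → 𝟙 e? ≡ 0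
      is-no (yes e) = contradiction e (ℂ-roots.root≄0 m (c-unit a≉0) (c-nonunit ≈-refl))
      is-no (no  _) = refl

    total : ℕ
    total = List.sum (map (agreements X ord) [1⋯ p ∸ 1 ])

    agreements≡ : ∀ N → agreements X ord N ≡ sum² N (λ i j → J (pos (suc i)) (pos (suc j)))
    agreements≡ N = trans (length-filter-cartesianProduct (λ (n₁ , n₂) → χ-≟ X ord (pos n₁) (pos n₂)) [1⋯ N ] [1⋯ N ])
      (trans (sum-map-applyUpTo (λ x → List.sum (map (λ y → J (pos x) (pos y)) [1⋯ N ])) suc N)
        (sum-cong-≗ {N} (λ i → sum-map-applyUpTo (λ y → J (pos (suc (toℕ i))) (pos y)) suc N)))

    total≡ : ∀ q → p ≡ suc q →
      total ≡ sum {q} (λ i → sum {q} (λ j → (q ∸ (toℕ i ⊔ toℕ j)) * J (pos (suc (toℕ i))) (pos (suc (toℕ j)))))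
    total≡ q refl = trans (sum-map-applyUpTo (agreements X ord) suc q)
      (trans (sum-cong-≗ {q} (λ N → agreements≡ (suc (toℕ N)))) (sum²-triangle q (λ i j → J (pos (suc i)) (pos (suc j)))))

    unit-suc : ∀ {q} → p ≡ suc q → ∀ (i : Fin q) → Unit (pos (suc (toℕ i)))
    unit-suc refl i i≈0 = contradiction (ℤ.+-injective (≈0-small {pos (suc (toℕ i))} (s<s (toℕ<n i)) i≈0)) λ ()

    slice : ℤ → ℕ
    slice a = ∑ₚ (λ b → weight a b * J a b)

    -- Passing to all residues adds only b = 0, where J vanishes. Counting from 1 instead of 0
    -- raises both q and the maximum by 1, so the difference is unchanged.
    slice-suc : ∀ q → p ≡ suc q → ∀ (i : Fin q) →
      sum {q} (λ j → (q ∸ (toℕ i ⊔ toℕ j)) * J (pos (suc (toℕ i))) (pos (suc (toℕ j)))) ≡ slice (pos (suc (toℕ i)))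
    slice-suc q refl i = sym (cong₂ _+_
      (trans (cong (_*_ (weight a (pos 0))) (J-0 (unit-suc refl i))) (*-zeroʳ (weight a (pos 0))))
      (sum-cong-≗ {q} (λ j → cong (_* J a (pos (suc (toℕ j))))
        (cong₂ (λ u v → suc q ∸ (u ⊔ v)) (residue-< (s<s (toℕ<n i))) (residue-< (s<s (toℕ<n j)))))))
      where
      a : ℤ
      a = pos (suc (toℕ i))

    -- The summand + 0 makes the sum over a definitionally the `line (pos 0)` of the slope h.
    lineWeight : ℤ → ℤ → ℕ
    lineWeight h a = weight a (h ℤ.* a ℤ.+ pos 0)

    slice-unit : ∀ {a} → Unit a → slice a ≡ ∑ₚ (λ h → lineWeight h a * 𝟙H h)
    slice-unit {a} a≉0 = trans
      (sym (∑ₚ-scale a (proj₁ (unit-inverse a≉0)) (proj₂ (unit-inverse a≉0))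
        (λ b≈b′ → cong₂ _*_ (weight-cong (≈-refl {a}) b≈b′) (J-cong a b≈b′))))
      (∑ₚ-cong (λ h → cong₂ _*_ (cong (weight a) (trans (ℤ.*-comm a h) (sym (ℤ.+-identityʳ (h ℤ.* a))))) (J-unit h a≉0)))

    line₀ : ℤ → ℕ
    line₀ h = ∑ₚ (lineWeight h)

    lineWeight-0 : ∀ h → lineWeight h (pos 0) ≡ p
    lineWeight-0 h = trans (cong (weight (pos 0)) (trans (ℤ.+-identityʳ _) (ℤ.*-zeroʳ h)))
      (cong₂ (λ u v → p ∸ (u ⊔ v)) r0 r0)
      where
      r0 : residue (pos 0) ≡ 0
      r0 = residue-< (>-nonZero⁻¹ p)

    -- Substituting n₂ = h n₁ sorts the pairs by h ∈ H. A full line also contains the point n₁ = 0,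
    -- which has weight p, and p * ∣H∣ accounts for these points.
    total-by-lines : p * ∣H∣ + total ≡ ∑ₚ (λ h → line₀ h * 𝟙H h)
    total-by-lines = go (p ∸ 1) (sym (suc-pred p))
      where
      open ≡-Reasoning
      go : ∀ q → p ≡ suc q → p * ∣H∣ + total ≡ ∑ₚ (λ h → line₀ h * 𝟙H h)
      go q eq = begin
        p * ∣H∣ + total
          ≡⟨ cong₂ _+_ (*-distribˡ-sum {p} p _) (trans (total≡ q eq) (sum-cong-≗ {q} (λ i → trans (slice-suc q eq i) (slice-unit (unit-suc eq i))))) ⟩
        ∑ₚ (λ h → p * 𝟙H h) + sum {q} (λ i → ∑ₚ (λ h → lineWeight h (pos (suc (toℕ i))) * 𝟙H h))
          ≡⟨ cong (_+_ _) (∑-comm {q} {p} (λ i h → lineWeight (pos (toℕ h)) (pos (suc (toℕ i))) * 𝟙H (pos (toℕ h)))) ⟩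
        ∑ₚ (λ h → p * 𝟙H h) + ∑ₚ (λ h → sum {q} (λ i → lineWeight h (pos (suc (toℕ i))) * 𝟙H h))
          ≡⟨ ∑-distrib-+ {p} (λ h → p * 𝟙H (pos (toℕ h))) _ ⟨
        ∑ₚ (λ h → p * 𝟙H h + sum {q} (λ i → lineWeight h (pos (suc (toℕ i))) * 𝟙H h))
          ≡⟨ ∑ₚ-cong (λ h → trans (cong (_+_ (p * 𝟙H h)) (sym (*-distribʳ-sum {q} (𝟙H h) _)))
               (trans (sym (*-distribʳ-+ (𝟙H h) p _)) (cong (_* 𝟙H h) (merge q eq h)))) ⟩
        ∑ₚ (λ h → line₀ h * 𝟙H h) ∎
        where
        merge : ∀ q → p ≡ suc q → ∀ h → p + sum {q} (λ i → lineWeight h (pos (suc (toℕ i)))) ≡ line₀ h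
        merge q refl h = cong (_+ sum {q} (λ i → lineWeight h (pos (suc (toℕ i))))) (sym (lineWeight-0 h))

    line₀-1 : 2 * line₀ (pos 1) ≡ p * suc p
    line₀-1 = trans (cong (2 *_) (sum-cong-≗ {p} (λ i → trans
      (cong (weight (pos (toℕ i))) (trans (ℤ.+-identityʳ _) (ℤ.*-identityˡ (pos (toℕ i)))))
      (trans (cong (p ∸_) (⊔-idem (residue (pos (toℕ i))))) (cong (p ∸_) (residue-< (toℕ<n i))))))) (∑∸ p)

    𝟙H-1 : 𝟙H (pos 1) ≡ 1
    𝟙H-1 = is-yes (H? (pos 1))
      where
      is-yes : (e? : Dec (H (pos 1))) → 𝟙 e? ≡ 1
      is-yes (yes _) = refl
      is-yes (no ¬e) = contradiction ≃-refl ¬e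

    𝟙H-0 : 𝟙H (pos 0) ≡ 0
    𝟙H-0 = is-no (H? (pos 0))
      where
      is-no : (e? : Dec (H (pos 0))) → 𝟙 e? ≡ 0
      is-no (yes e) = contradiction (≈-refl {pos 0}) (H⇒unit e)
      is-no (no  _) = refl

    c₀ : ℕ
    c₀ = suc p * suc (2 * p)

    module _ {d : ℕ} (2≤p : 2 ≤ p) (∣H∣≡d : ∣H∣ ≡ d) (E : ℕ)
             (line₀-close : ∀ h → H h → ¬ h ≈ pos 1 → ∣ 6 * line₀ h - c₀ ∣ ≤ E) where

      line₀-error : ∀ h → ¬ h ≈ pos 1 → ∣ 6 * line₀ h * 𝟙H h - c₀ * 𝟙H h ∣ ≤ E * 𝟙H h
      line₀-error h h≉1 = cases (H? h)
        where
        cases : (Hh? : Dec (H h)) → ∣ 6 * line₀ h * 𝟙 Hh? - c₀ * 𝟙 Hh? ∣ ≤ E * 𝟙 Hh?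
        cases (no  _)  = ≤-trans (≤-reflexive (cong₂ ∣_-_∣ (*-zeroʳ (6 * line₀ h)) (*-zeroʳ c₀))) z≤n
        cases (yes Hh) = subst₂ _≤_ (sym (cong₂ ∣_-_∣ (*-identityʳ (6 * line₀ h)) (*-identityʳ c₀))) (sym (*-identityʳ E))
          (line₀-close h Hh h≉1)

      -- Writing p = 2 + q separates the residues 0, outside H, and 1, whose line sum is exact, from
      -- the other D = d - 1 elements of H, whose line sums are c₀ / 6 up to E / 6.
      total-error : ∣ 6 * total - suc (2 * d) * (p * (p ∸ 1)) ∣ ≤ d * (E + p)
      total-error = go (p ∸ 2) (sym (m+[n∸m]≡n 2≤p))
        where
        go : ∀ q → p ≡ 2 + q → ∣ 6 * total - suc (2 * d) * (p * (p ∸ 1)) ∣ ≤ d * (E + p)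
        go q refl = begin
          ∣ 6 * total - Z ∣ ≡⟨ ∣m+n-m+o∣≡∣n-o∣ (6 * (p * d)) (6 * total) Z ⟨
          ∣ 6 * (p * d) + 6 * total - 6 * (p * d) + Z ∣ ≡⟨ cong₂ ∣_-_∣ lhs rhs ⟩
          ∣ T + R - T + (D * c₀ + D * suc q) ∣ ≡⟨ ∣m+n-m+o∣≡∣n-o∣ T R _ ⟩
          ∣ R - (D * c₀ + D * suc q) ∣ ≤⟨ ∣-∣-triangle R (D * c₀) _ ⟩
          ∣ R - D * c₀ ∣ + ∣ D * c₀ - (D * c₀ + D * suc q) ∣
            ≤⟨ +-mono-≤ R-error (≤-reflexive (trans (m≤n⇒∣m-n∣≡n∸m (m≤m+n (D * c₀) _)) (m+n∸m≡n (D * c₀) _))) ⟩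
          D * E + D * suc q ≡⟨ *-distribˡ-+ D E (suc q) ⟨
          D * (E + suc q) ≤⟨ *-mono-≤ D≤d (+-monoʳ-≤ E (n≤1+n (suc q))) ⟩
          d * (E + p) ∎
          where
          open ≤-Reasoning
          D R T Z : ℕ
          D = sum {q} (λ i → 𝟙H (pos (2 + toℕ i)))
          R = sum {q} (λ i → 6 * line₀ (pos (2 + toℕ i)) * 𝟙H (pos (2 + toℕ i)))
          T = 3 * (p * suc p)
          Z = suc (2 * d) * (p * (p ∸ 1))
          d≡ : d ≡ suc D
          d≡ = trans (sym ∣H∣≡d) (cong₂ (λ a b → a + (b + D)) 𝟙H-0 𝟙H-1)
          D≤d : D ≤ d
          D≤d = subst (D ≤_) (sym d≡) (n≤1+n D)
          lhs : 6 * (p * d) + 6 * total ≡ T + R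
          lhs = trans (sym (*-distribˡ-+ 6 (p * d) total)) (trans
            (cong (λ t → 6 * (p * t + total)) (sym ∣H∣≡d)) (trans (cong (6 *_) total-by-lines)
            (trans (cong (λ t → 6 * t) (cong₂ (λ a b → a + (b + rest))
                (trans (cong (line₀ (pos 0) *_) 𝟙H-0) (*-zeroʳ (line₀ (pos 0))))
                (trans (cong (line₀ (pos 1) *_) 𝟙H-1) (*-identityʳ (line₀ (pos 1))))))
              (trans (*-distribˡ-+ 6 (line₀ (pos 1)) rest)
                (cong₂ _+_ (trans (*-assoc 3 2 (line₀ (pos 1))) (cong (3 *_) line₀-1))
                  (trans (*-distribˡ-sum {q} 6 _) (sum-cong-≗ {q} (λ i → sym (*-assoc 6 (line₀ (pos (2 + toℕ i))) _)))))))))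
            where
            rest : ℕ
            rest = sum {q} (λ i → line₀ (pos (2 + toℕ i)) * 𝟙H (pos (2 + toℕ i)))
          -- The expected values 3p(p + 1) for h = 1 and c₀ for every other h add up to the main
          -- term plus 6pd, short of it by D (p - 1); this discrepancy is the summand p of the
          -- error.
          identity : ∀ D q → 6 * ((2 + q) * suc D) + suc (2 * suc D) * ((2 + q) * suc q)
                   ≡ 3 * ((2 + q) * (3 + q)) + (D * ((3 + q) * suc (2 * (2 + q))) + D * suc q)
          identity = solve-∀
          rhs : 6 * (p * d) + Z ≡ T + (D * c₀ + D * suc q)
          rhs = trans (cong (λ t → 6 * (p * t) + suc (2 * t) * (p * suc q)) d≡) (identity D q)
          R-error : ∣ R - D * c₀ ∣ ≤ D * E
          R-error = begin
            ∣ R - D * c₀ ∣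
              ≡⟨ cong (∣ R -_∣) (trans (*-comm D c₀) (*-distribˡ-sum {q} c₀ _)) ⟩
            ∣ R - sum {q} (λ i → c₀ * 𝟙H (pos (2 + toℕ i))) ∣
              ≤⟨ sum-∣-∣ {q} _ _ ⟩
            sum {q} (λ i → ∣ 6 * line₀ (pos (2 + toℕ i)) * 𝟙H (pos (2 + toℕ i)) - c₀ * 𝟙H (pos (2 + toℕ i)) ∣)
              ≤⟨ sum-mono {q} (λ i → line₀-error (pos (2 + toℕ i)) (λ e →
                   contradiction (≈⇒≡ (s<s (s<s (toℕ<n i))) 1<p e) λ ())) ⟩
            sum {q} (λ i → E * 𝟙H (pos (2 + toℕ i)))
              ≡⟨ trans (sym (*-distribˡ-sum {q} E _)) (*-comm E D) ⟩
            D * E ∎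

  2d∣p∸1⇒2<p : ∀ {d p} .{{_ : NonZero d}} → Prime p → 2 * d ∣ p ∸ 1 → 2 < p
  2d∣p∸1⇒2<p {d} {p} p-prime 2d∣p∸1 = ≤-<-trans (m≤m*n 2 d)
    (subst (2 * d <_) (suc-pred p {{prime⇒nonZero p-prime}}) (s≤s (∣⇒≤ {{>-nonZero 0<p∸1}} 2d∣p∸1)))
    where
    0<p∸1 : 0 < p ∸ 1
    0<p∸1 = m<n⇒0<n∸m (nonTrivial⇒n>1 p {{prime⇒nonTrivial p-prime}})

  module _ {d p : ℕ} .{{_ : NonZero d}} (d-odd : Odd d) (p-prime : Prime p) (2d∣p∸1 : 2 * d ∣ p ∸ 1)
           (X : DirichletCharacter p) (ord : HasOrder X ((p ∸ 1) / d)) where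

    private
      2<p : 2 < p
      2<p = 2d∣p∸1⇒2<p p-prime 2d∣p∸1

    open HasOrder ord using (nonZero)

    ∣H∣≡d : Kernel.∣H∣ p-prime X ord ≡ d
    ∣H∣≡d = *-cancelʳ-≡ _ d ((p ∸ 1) / d) (trans (Kernel.∣H∣*m≡p∸1 p-prime X ord)
      (trans (sym (m/n*n≡m (∣-trans (n∣m*n 2) 2d∣p∸1))) (*-comm ((p ∸ 1) / d) d)))

    open Subgroup p p-prime 2<p d d-odd using (j; module Element)

    sum-agreements-error :
      ∣ 6 * List.sum (map (agreements X ord) [1⋯ p ∸ 1 ]) - suc (2 * d) * (p * (p ∸ 1)) ∣ ≤ d * (C₀ * (p * j) + p)
    sum-agreements-error = total-error (<⇒≤ 2<p) ∣H∣≡d (C₀ * (p * j)) close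
      where
      open Mod p {{prime⇒nonZero p-prime}} using (_≈_)
      open Kernel p-prime X ord using (H)
      open Count p-prime X ord using (total-error; line₀; c₀; h^∣H∣≈1)
      close : ∀ h → H h → ¬ h ≈ pos 1 → ∣ 6 * line₀ h - c₀ ∣ ≤ C₀ * (p * j)
      close h Hh = Element.line-error h (subst (λ t → h ℤ.^ t ≈ pos 1) ∣H∣≡d (h^∣H∣≈1 Hh))

-- Two-sided bounds for the Riemann sums that define log.

module LogBounds where

  open import Defs
  open import Data.Nat.Base as ℕ using (ℕ; zero; suc)
  import Data.Nat.Properties as ℕ
  open import Data.Product.Base using (_,_)
  open import Data.Rational.Base using (ℚ; 0ℚ; 1ℚ; ½; _+_; _*_; _-_; -_; _⊔_; _≤_)
  import Data.Rational.Base as ℚ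
  import Data.Rational.Properties as ℚ
  open import Data.Rational.Solver using (module +-*-Solver)
  open import Relation.Binary.PropositionalEquality
  open import Relation.Nullary using (¬_; Dec; yes; no; contradiction)

  open +-*-Solver

  0≤- : ∀ {a b} → a ≤ b → 0ℚ ≤ b - a
  0≤- {a} {b} a≤b = subst (_≤ b - a) (ℚ.+-inverseʳ a) (ℚ.+-monoˡ-≤ (- a) a≤b)

  -≤0⇒≤ : ∀ {a b} → 0ℚ ≤ b - a → a ≤ b
  -≤0⇒≤ {a} {b} 0≤b-a = subst₂ _≤_ (ℚ.+-identityˡ a) (solve 2 (λ a b → b :- a :+ a := b) refl a b) (ℚ.+-monoˡ-≤ a 0≤b-a)

  -- Comparisons are reduced to 0 ≤ e by exhibiting b - a as a sum of products of nonnegative terms.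
  by-difference : ∀ {a b} e → 0ℚ ≤ e → b - a ≡ e → a ≤ b
  by-difference e 0≤e eq = -≤0⇒≤ (subst (0ℚ ≤_) (sym eq) 0≤e)

  1≤½* : ∀ {t} → ¬ t ≤ 2ℚ → 1ℚ ≤ ½ * t
  1≤½* t≰2 = ℚ.*-monoˡ-≤-nonNeg ½ (ℚ.<⇒≤ (ℚ.≰⇒> t≰2))

  -- A piecewise linear version of log₂, with slope 2⁻ⁱ on [2ⁱ , 2ⁱ⁺¹] and constant from 2ˢ on.
  log₂ : ℕ → ℚ → ℚ
  log₂ zero    t = 0ℚ
  log₂ (suc s) t = piece (t ℚ.≤? 2ℚ)
    where
    piece : Dec (t ≤ 2ℚ) → ℚ
    piece (yes _) = t - 1ℚ
    piece (no  _) = 1ℚ + log₂ s (½ * t)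

  log₂-1 : ∀ s → log₂ s 1ℚ ≡ 0ℚ
  log₂-1 zero    = refl
  log₂-1 (suc s) = refl

  0≤log₂ : ∀ s {t} → 1ℚ ≤ t → 0ℚ ≤ log₂ s t
  0≤log₂ zero    1≤t = ℚ.≤-refl
  0≤log₂ (suc s) {t} 1≤t with t ℚ.≤? 2ℚ
  ... | yes _   = 0≤- 1≤t
  ... | no  t≰2 = 0≤+ 0≤1 (0≤log₂ s (1≤½* t≰2))

  log₂≤ : ∀ s {t} → log₂ s t ≤ fromℕ s
  log₂≤ zero    = ℚ.≤-refl
  log₂≤ (suc s) {t} with t ℚ.≤? 2ℚ
  ... | yes t≤2 = ℚ.≤-trans (ℚ.+-monoˡ-≤ (- 1ℚ) t≤2) (fromℕ-mono {1} {suc s} (ℕ.s≤s ℕ.z≤n))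
  ... | no  _   = ℚ.≤-trans (ℚ.+-monoʳ-≤ 1ℚ (log₂≤ s)) (ℚ.≤-reflexive (sym (fromℕ-suc s)))

  log₂-2^ : ∀ s {t} → fromℕ (2 ℕ.^ s) ≤ t → fromℕ s ≤ log₂ s t
  log₂-2^ zero    _ = ℚ.≤-refl
  log₂-2^ (suc s) {t} 2^≤t with t ℚ.≤? 2ℚ
  ... | no _ = ℚ.≤-trans (ℚ.≤-reflexive (fromℕ-suc s)) (ℚ.+-monoʳ-≤ 1ℚ (log₂-2^ s
    (ℚ.≤-trans (ℚ.≤-reflexive (trans (solve 1 (λ x → x := con ½ :* (con (fromℕ 2) :* x)) refl (fromℕ (2 ℕ.^ s)))
      (cong (½ *_) (sym (fromℕ-* 2 (2 ℕ.^ s)))))) (ℚ.*-monoˡ-≤-nonNeg ½ 2^≤t))))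
  ... | yes t≤2 = ℚ.≤-trans (fromℕ-mono 1+s≤1) (ℚ.+-monoˡ-≤ (- 1ℚ) (ℚ.≤-trans (fromℕ-mono {2} 2≤) 2^≤t))
    where
    2≤ : 2 ℕ.≤ 2 ℕ.^ suc s
    2≤ = ℕ.*-monoʳ-≤ 2 (ℕ.m^n>0 2 s)
    1+s≤1 : suc s ℕ.≤ 1
    1+s≤1 = ℕ.≮⇒≥ λ 1<1+s → ℚ.≤⇒≤ᵇ {fromℕ 4} {2ℚ}
      (ℚ.≤-trans (fromℕ-mono {4} (ℕ.^-monoʳ-≤ 2 1<1+s)) (ℚ.≤-trans 2^≤t t≤2))

  -- On [2ⁱ , 2ⁱ⁺¹] the slope 2⁻ⁱ is at most 2/t, hence at most 2/a to the right of a. The induction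
  -- halves both arguments until one of them is at most 2.
  log₂-slope≤ : ∀ s {a b} → 1ℚ ≤ a → a ≤ b → a * (log₂ s b - log₂ s a) ≤ 2ℚ * (b - a)
  log₂-slope≤ zero {a} {b} 1≤a a≤b = subst (_≤ 2ℚ * (b - a)) (sym (ℚ.*-zeroʳ a)) (0≤* (ℚ.nonNegative⁻¹ 2ℚ) (0≤- a≤b))
  log₂-slope≤ (suc s) {a} {b} 1≤a a≤b with a ℚ.≤? 2ℚ | b ℚ.≤? 2ℚ
  ... | yes a≤2 | yes b≤2 = by-difference ((2ℚ - a) * (b - a)) (0≤* (0≤- a≤2) (0≤- a≤b))
    (solve 2 (λ a b → con 2ℚ :* (b :- a) :- a :* ((b :- con 1ℚ) :- (a :- con 1ℚ)) := (con 2ℚ :- a) :* (b :- a)) refl a b)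
  ... | no a≰2  | yes b≤2 = contradiction (ℚ.≤-trans a≤b b≤2) a≰2
  -- The interval straddles the breakpoint 2: the part beyond it becomes [1 , b/2] after halving,
  -- where `log₂ s` starts from 0.
  ... | yes a≤2 | no b≰2  = by-difference
      ((2ℚ - a) * ((2ℚ - a) + g) + 2ℚ * (2ℚ * (½ * b - 1ℚ) - 1ℚ * (g - 0ℚ)))
      (0≤+ (0≤* (0≤- a≤2) (0≤+ (0≤- a≤2) (0≤log₂ s 1≤½b)))
           (0≤* (ℚ.nonNegative⁻¹ 2ℚ) (0≤- (subst (λ z → 1ℚ * (g - z) ≤ 2ℚ * (½ * b - 1ℚ)) (log₂-1 s) (log₂-slope≤ s ℚ.≤-refl 1≤½b)))))
      (solve 3 (λ a b g → con 2ℚ :* (b :- a) :- a :* ((con 1ℚ :+ g) :- (a :- con 1ℚ))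
        := (con 2ℚ :- a) :* ((con 2ℚ :- a) :+ g) :+ con 2ℚ :* (con 2ℚ :* (con ½ :* b :- con 1ℚ) :- con 1ℚ :* (g :- con 0ℚ))) refl a b g)
    where
    g : ℚ
    g = log₂ s (½ * b)
    1≤½b : 1ℚ ≤ ½ * b
    1≤½b = 1≤½* b≰2
  ... | no a≰2  | no b≰2  = by-difference (2ℚ * (2ℚ * (½ * b - ½ * a) - ½ * a * (g - f)))
      (0≤* (ℚ.nonNegative⁻¹ 2ℚ) (0≤- (log₂-slope≤ s (1≤½* a≰2) (ℚ.*-monoˡ-≤-nonNeg ½ a≤b))))
      (solve 4 (λ a b g f → con 2ℚ :* (b :- a) :- a :* ((con 1ℚ :+ g) :- (con 1ℚ :+ f))
        := con 2ℚ :* (con 2ℚ :* (con ½ :* b :- con ½ :* a) :- con ½ :* a :* (g :- f))) refl a b g f)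
    where
    f g : ℚ
    f = log₂ s (½ * a)
    g = log₂ s (½ * b)

  ½*≤2^ : ∀ s {b} → b ≤ fromℕ (2 ℕ.^ suc s) → ½ * b ≤ fromℕ (2 ℕ.^ s)
  ½*≤2^ s b≤ = ℚ.≤-trans (ℚ.*-monoˡ-≤-nonNeg ½ b≤) (ℚ.≤-reflexive (trans (cong (½ *_) (fromℕ-* 2 (2 ℕ.^ s)))
    (solve 1 (λ x → con ½ :* (con (fromℕ 2) :* x) := x) refl (fromℕ (2 ℕ.^ s)))))

  -- On [2ⁱ , 2ⁱ⁺¹] the slope 2⁻ⁱ is at least 1/t, hence at least 1/b to the left of b. The bound on
  -- b stays below 2ˢ, from where on `log₂ s` is constant.
  slope≤log₂ : ∀ s {a b} → 1ℚ ≤ a → a ≤ b → b ≤ fromℕ (2 ℕ.^ s) → b - a ≤ b * (log₂ s b - log₂ s a)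
  slope≤log₂ zero {a} {b} 1≤a a≤b b≤1 = ℚ.≤-trans
    (subst (b - a ≤_) (ℚ.+-inverseʳ 1ℚ) (ℚ.+-mono-≤ b≤1 (ℚ.neg-antimono-≤ 1≤a))) (ℚ.≤-reflexive (sym (ℚ.*-zeroʳ b)))
  slope≤log₂ (suc s) {a} {b} 1≤a a≤b b≤2^ with a ℚ.≤? 2ℚ | b ℚ.≤? 2ℚ
  ... | yes a≤2 | yes b≤2 = by-difference ((b - 1ℚ) * (b - a)) (0≤* (0≤- (ℚ.≤-trans 1≤a a≤b)) (0≤- a≤b))
    (solve 2 (λ a b → b :* ((b :- con 1ℚ) :- (a :- con 1ℚ)) :- (b :- a) := (b :- con 1ℚ) :* (b :- a)) refl a b)
  ... | no a≰2  | yes b≤2 = contradiction (ℚ.≤-trans a≤b b≤2) a≰2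
  ... | yes a≤2 | no b≰2  = by-difference
      ((b - 1ℚ) * (2ℚ - a) + 2ℚ * (½ * b * (g - 0ℚ) - (½ * b - 1ℚ)))
      (0≤+ (0≤* (0≤- (ℚ.≤-trans 1≤a a≤b)) (0≤- a≤2))
           (0≤* (ℚ.nonNegative⁻¹ 2ℚ) (0≤- (subst (λ z → ½ * b - 1ℚ ≤ ½ * b * (g - z)) (log₂-1 s)
             (slope≤log₂ s ℚ.≤-refl (1≤½* b≰2) (½*≤2^ s b≤2^))))))
      (solve 3 (λ a b g → b :* ((con 1ℚ :+ g) :- (a :- con 1ℚ)) :- (b :- a)
        := (b :- con 1ℚ) :* (con 2ℚ :- a) :+ con 2ℚ :* (con ½ :* b :* (g :- con 0ℚ) :- (con ½ :* b :- con 1ℚ))) refl a b g)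
    where
    g : ℚ
    g = log₂ s (½ * b)
  ... | no a≰2  | no b≰2  = by-difference (2ℚ * (½ * b * (g - f) - (½ * b - ½ * a)))
      (0≤* (ℚ.nonNegative⁻¹ 2ℚ) (0≤- (slope≤log₂ s (1≤½* a≰2) (ℚ.*-monoˡ-≤-nonNeg ½ a≤b) (½*≤2^ s b≤2^))))
      (solve 4 (λ a b g f → b :* ((con 1ℚ :+ g) :- (con 1ℚ :+ f)) :- (b :- a)
        := con 2ℚ :* (con ½ :* b :* (g :- f) :- (con ½ :* b :- con ½ :* a))) refl a b g f)
    where
    f g : ℚ
    f = log₂ s (½ * a)
    g = log₂ s (½ * b)

  *inv : ∀ {a} x → 1ℚ ≤ a → a * x * inv a ≡ x
  *inv {a} x 1≤a = trans (solve 3 (λ a x i → a :* x :* i := a :* i :* x) refl a x (inv a))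
    (trans (cong (_* x) (inv-inverse 1≤a)) (ℚ.*-identityˡ x))

  ≤+ : ∀ {a w} → 0ℚ ≤ w → a ≤ a + w
  ≤+ {a} {w} 0≤w = subst (_≤ a + w) (ℚ.+-identityʳ a) (ℚ.+-monoʳ-≤ a 0≤w)

  midpoint : ∀ a w → a + ½ * w + ½ * w ≡ a + w
  midpoint = solve 2 (λ a w → a :+ con ½ :* w :+ con ½ :* w := a :+ w) refl

  -- On one subinterval the left sum w / a is at least half the increment of `log₂`, by the slope
  -- bound 2/a. The increments telescope under bisection.
  riemann-lower : ∀ s n {a w} → 1ℚ ≤ a → 0ℚ ≤ w → ½ * (log₂ s (a + w) - log₂ s a) ≤ riemann n a w
  riemann-lower s zero {a} {w} 1≤a 0≤w = ℚR.begin
    ½ * Δ ℚR.≡⟨ cong (½ *_) (*inv Δ 1≤a) ⟨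
    ½ * (a * Δ * inv a) ℚR.≤⟨ ℚ.*-monoˡ-≤-nonNeg ½ (ℚ.*-monoʳ-≤-nonNeg (inv a) {{ℚ.nonNegative (0≤inv a)}}
                                  (log₂-slope≤ s 1≤a (≤+ 0≤w))) ⟩
    ½ * (2ℚ * (a + w - a) * inv a) ℚR.≡⟨ solve 3 (λ a w i → con ½ :* (con 2ℚ :* (a :+ w :- a) :* i) := w :* i) refl a w (inv a) ⟩
    w * inv a ℚR.∎
    where
    Δ : ℚ
    Δ = log₂ s (a + w) - log₂ s a
  riemann-lower s (suc n) {a} {w} 1≤a 0≤w = ℚR.begin
    ½ * (log₂ s (a + w) - log₂ s a)
      ℚR.≡⟨ cong (λ t → ½ * (log₂ s t - log₂ s a)) (midpoint a w) ⟨
    ½ * (log₂ s (a + v + v) - log₂ s a)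
      ℚR.≡⟨ solve 3 (λ x y z → con ½ :* (x :- z) := con ½ :* (y :- z) :+ con ½ :* (x :- y)) refl (log₂ s (a + v + v)) (log₂ s (a + v)) (log₂ s a) ⟩
    ½ * (log₂ s (a + v) - log₂ s a) + ½ * (log₂ s (a + v + v) - log₂ s (a + v))
      ℚR.≤⟨ ℚ.+-mono-≤ (riemann-lower s n 1≤a (0≤½* 0≤w)) (riemann-lower s n (1≤+ 1≤a (0≤½* 0≤w)) (0≤½* 0≤w)) ⟩
    riemann n a v + riemann n (a + v) v ℚR.∎
    where
    v : ℚ
    v = ½ * w

  -- The left sum exceeds the right sum, which is below the increment of log₂, by w 2⁻ⁿ (1/a - 1/(a+w)).
  riemann-upper : ∀ s n {a w} → 1ℚ ≤ a → 0ℚ ≤ w → a + w ≤ fromℕ (2 ℕ.^ s) →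
                  riemann n a w ≤ log₂ s (a + w) - log₂ s a + w * 2⁻ n * (inv a - inv (a + w))
  riemann-upper s zero {a} {w} 1≤a 0≤w b≤ = by-difference ((b * Δ - (b - a)) * inv b)
    (0≤* (0≤- (slope≤log₂ s 1≤a (≤+ 0≤w) b≤)) (0≤inv b))
    (trans (cong (λ t → t + w * 1ℚ * (inv a - inv b) - w * inv a) (sym (*inv Δ (1≤+ 1≤a 0≤w))))
      (solve 5 (λ a w D i k → (a :+ w) :* D :* k :+ w :* con 1ℚ :* (i :- k) :- w :* i := ((a :+ w) :* D :- (a :+ w :- a)) :* k)
        refl a w Δ (inv a) (inv b)))
    where
    b Δ : ℚ
    b = a + w
    Δ = log₂ s b - log₂ s a
  riemann-upper s (suc n) {a} {w} 1≤a 0≤w b≤ = ℚR.begin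
    riemann n a v + riemann n (a + v) v
      ℚR.≤⟨ ℚ.+-mono-≤ (riemann-upper s n 1≤a 0≤v (ℚ.≤-trans (≤+ 0≤v) b≤′)) (riemann-upper s n (1≤+ 1≤a 0≤v) 0≤v b≤′) ⟩
    (log₂ s (a + v) - log₂ s a + v * 2⁻ n * (inv a - inv (a + v))) +
    (log₂ s (a + v + v) - log₂ s (a + v) + v * 2⁻ n * (inv (a + v) - inv (a + v + v)))
      ℚR.≡⟨ solve 8 (λ w h x y z i j k →
               (y :- x :+ con ½ :* w :* h :* (i :- j)) :+ (z :- y :+ con ½ :* w :* h :* (j :- k))
               := z :- x :+ w :* (con ½ :* h) :* (i :- k)) refl
               w (2⁻ n) (log₂ s a) (log₂ s (a + v)) (log₂ s (a + v + v)) (inv a) (inv (a + v)) (inv (a + v + v)) ⟩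
    log₂ s (a + v + v) - log₂ s a + w * 2⁻ (suc n) * (inv a - inv (a + v + v))
      ℚR.≡⟨ cong (λ t → log₂ s t - log₂ s a + w * 2⁻ (suc n) * (inv a - inv t)) (midpoint a w) ⟩
    log₂ s (a + w) - log₂ s a + w * 2⁻ (suc n) * (inv a - inv (a + w)) ℚR.∎
    where
    v : ℚ
    v = ½ * w
    0≤v : 0ℚ ≤ v
    0≤v = 0≤½* 0≤w
    b≤′ : a + v + v ≤ fromℕ (2 ℕ.^ s)
    b≤′ = subst (_≤ fromℕ (2 ℕ.^ s)) (sym (midpoint a w)) b≤

  module _ (x : ℝ) (n : ℕ) where
    open Log x

    private
      1+width : 1ℚ + width n ≡ seq x n ⊔ 1ℚ
      1+width = solve 1 (λ t → con 1ℚ :+ (t :- con 1ℚ) := t) refl (seq x n ⊔ 1ℚ)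

    log-lower : ∀ s → fromℕ (2 ℕ.^ s) ≤ seq x n → ½ * fromℕ s ≤ seq (log x) n
    log-lower s 2^s≤x = ℚ.≤-trans
      (ℚ.*-monoˡ-≤-nonNeg ½ (ℚ.≤-trans (log₂-2^ s (ℚ.≤-trans 2^s≤x (ℚ.≤-trans (ℚ.p≤p⊔q (seq x n) 1ℚ) (ℚ.≤-reflexive (sym 1+width)))))
        (ℚ.≤-reflexive (trans (sym (ℚ.+-identityʳ _)) (cong (λ z → log₂ s (1ℚ + width n) - z) (sym (log₂-1 s)))))))
      (riemann-lower s n ℚ.≤-refl (0≤width n))

    0≤log : 0ℚ ≤ seq (log x) n
    0≤log = riemann-lower 0 n ℚ.≤-refl (0≤width n)

    -- The condition s ≤ n makes the mesh w 2⁻ⁿ at most 1, so the left sum exceeds the increment of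
    -- `log₂` by at most 1.
    log-upper : ∀ s → s ℕ.≤ n → seq x n ≤ fromℕ (2 ℕ.^ s) → seq (log x) n ≤ fromℕ s + 1ℚ
    log-upper s s≤n x≤2^s = ℚR.begin
      riemann n 1ℚ w ℚR.≤⟨ riemann-upper s n ℚ.≤-refl (0≤width n) b≤ ⟩
      log₂ s (1ℚ + w) - log₂ s 1ℚ + w * 2⁻ n * (inv 1ℚ - inv (1ℚ + w)) ℚR.≤⟨ ℚ.+-mono-≤ main error ⟩
      fromℕ s + 1ℚ ℚR.∎
      where
      w : ℚ
      w = width n
      b≤ : 1ℚ + w ≤ fromℕ (2 ℕ.^ s)
      b≤ = ℚ.≤-trans (ℚ.≤-reflexive 1+width) (ℚ.⊔-lub x≤2^s (fromℕ-mono {1} (ℕ.m^n>0 2 s)))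
      main : log₂ s (1ℚ + w) - log₂ s 1ℚ ≤ fromℕ s
      main = ℚ.≤-trans (ℚ.≤-reflexive (trans (cong (λ z → log₂ s (1ℚ + w) - z) (log₂-1 s)) (ℚ.+-identityʳ _))) (log₂≤ s)
      w≤ : w ≤ fromℕ (2 ℕ.^ s)
      w≤ = ℚ.≤-trans (ℚ.≤-trans (≤+ 0≤1) (ℚ.≤-reflexive (ℚ.+-comm w 1ℚ))) b≤
      w2⁻ⁿ≤1 : w * 2⁻ n ≤ 1ℚ
      w2⁻ⁿ≤1 = ℚ.≤-trans (ℚ.*-monoʳ-≤-nonNeg (2⁻ n) {{ℚ.nonNegative (0≤2⁻ n)}} w≤)
        (subst (λ n → fromℕ (2 ℕ.^ s) * 2⁻ n ≤ 1ℚ) (ℕ.m+[n∸m]≡n s≤n)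
          (ℚ.≤-trans (ℚ.≤-reflexive (2⁻-cancel (n ℕ.∸ s) s)) (2⁻≤1 (n ℕ.∸ s))))
      error : w * 2⁻ n * (inv 1ℚ - inv (1ℚ + w)) ≤ 1ℚ
      error = ℚ.≤-trans (*-mono (0≤* (0≤width n) (0≤2⁻ n)) 0≤1 w2⁻ⁿ≤1
        (ℚ.≤-trans (ℚ.+-monoʳ-≤ (inv 1ℚ) (ℚ.neg-antimono-≤ (0≤inv (1ℚ + w))))
          (ℚ.≤-trans (ℚ.≤-reflexive (ℚ.+-identityʳ (inv 1ℚ))) (inv≤1 ℚ.≤-refl)))) ℚ.≤-refl

-- The error in ℚ and ℝ, and the range d log log p ≤ c log p.

module ErrorBounds where

  open import Defs
  open PrimitivePartSize using (Odd)
  open Totients using (γ≤d∸1)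
  open SubgroupLines using (C₀; module Subgroup)
  open AgreementCounts
  open LogBounds
  open import Data.Integer.Base as ℤ using (+_)
  import Data.Integer.Properties as ℤ
  open import Data.List.Base using (map)
  open import Data.Nat.Base as ℕ using (ℕ; zero; suc; NonZero)
  open import Data.Nat.DivMod using (_/_)
  open import Data.Nat.Divisibility using (_∣_)
  open import Data.Nat.ListAction using (sum)
  open import Data.Nat.Primality using (Prime; prime⇒nonZero)
  import Data.Nat.Properties as ℕ
  import Data.Nat.Tactic.RingSolver as ℕ
  open import Data.Product.Base using (∃-syntax; _×_; _,_; proj₁; proj₂)
  open import Data.Rational.Base as ℚ using (ℚ; 0ℚ; 1ℚ; ½; _+_; _*_; _-_; -_; ∣_∣; _≤_; _<_)
  import Data.Rational.Properties as ℚ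
  open import Data.Rational.Solver using (module +-*-Solver)
  import Data.Rational.Unnormalised.Base as ℚᵘ
  import Data.Rational.Unnormalised.Properties as ℚᵘ
  open import Data.Sum.Base using (inj₁; inj₂)
  open import Relation.Binary.PropositionalEquality
  open import Relation.Nullary using (¬_)

  open +-*-Solver

  fromℕ-+ : ∀ m n → fromℕ (m ℕ.+ n) ≡ fromℕ m + fromℕ n
  fromℕ-+ zero    n = sym (ℚ.+-identityˡ (fromℕ n))
  fromℕ-+ (suc m) n = trans (fromℕ-suc (m ℕ.+ n)) (trans (cong (_+_ 1ℚ) (fromℕ-+ m n))
    (trans (sym (ℚ.+-assoc 1ℚ (fromℕ m) (fromℕ n))) (cong (_+ fromℕ n) (sym (fromℕ-suc m)))))

  fromℕ-∸ : ∀ {m n} → m ℕ.≤ n → fromℕ n - fromℕ m ≡ fromℕ (n ℕ.∸ m)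
  fromℕ-∸ {m} {n} m≤n = trans (cong (λ t → fromℕ t - fromℕ m) (sym (ℕ.m+[n∸m]≡n m≤n)))
    (trans (cong (_- fromℕ m) (fromℕ-+ m (n ℕ.∸ m)))
      (solve 2 (λ m k → m :+ k :- m := k) refl (fromℕ m) (fromℕ (n ℕ.∸ m))))

  fromℕ-∣-∣ : ∀ m n → ∣ fromℕ m - fromℕ n ∣ ≡ fromℕ ℕ.∣ m - n ∣
  fromℕ-∣-∣ m n with ℕ.≤-total m n
  ... | inj₁ m≤n = trans (∣-∣-swap (fromℕ m) (fromℕ n)) (trans (cong ∣_∣ (fromℕ-∸ m≤n))
    (trans (ℚ.0≤p⇒∣p∣≡p (0≤fromℕ (n ℕ.∸ m))) (cong fromℕ (sym (ℕ.m≤n⇒∣m-n∣≡n∸m m≤n)))))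
  ... | inj₂ n≤m = trans (cong ∣_∣ (fromℕ-∸ n≤m)) (trans (ℚ.0≤p⇒∣p∣≡p (0≤fromℕ (m ℕ.∸ n)))
    (cong fromℕ (sym (trans (ℕ.∣-∣-comm m n) (ℕ.m≤n⇒∣m-n∣≡n∸m n≤m)))))

  /-* : ∀ a n .{{_ : NonZero n}} → (+ a ℚ./ n) * fromℕ n ≡ fromℕ a
  /-* a n@(suc n-1) = ℚ.toℚᵘ-injective (begin
    ℚ.toℚᵘ ((+ a ℚ./ n) * fromℕ n) ≈⟨ ℚ.toℚᵘ-homo-* (+ a ℚ./ n) (fromℕ n) ⟩
    ℚ.toℚᵘ (+ a ℚ./ n) ℚᵘ.* ℚ.toℚᵘ (fromℕ n) ≈⟨ ℚᵘ.*-cong (ℚ.toℚᵘ-fromℚᵘ (ℚᵘ.mkℚᵘ (+ a) n-1)) (ℚ.toℚᵘ-fromℚᵘ (ℚᵘ.mkℚᵘ (+ n) 0)) ⟩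
    ℚᵘ.mkℚᵘ (+ a) n-1 ℚᵘ.* ℚᵘ.mkℚᵘ (+ n) 0 ≈⟨ ℚᵘ.*≡* (trans (cong (ℤ._* + 1) (sym (ℤ.pos-* a n)))
                                                        (trans (sym (ℤ.pos-* (a ℕ.* n) 1)) (trans (cong +_ (ℕ.*-assoc a n 1)) (ℤ.pos-* a (n ℕ.* 1))))) ⟩
    ℚᵘ.mkℚᵘ (+ a) 0 ≈⟨ ℚ.toℚᵘ-fromℚᵘ (ℚᵘ.mkℚᵘ (+ a) 0) ⟨
    ℚ.toℚᵘ (fromℕ a) ∎)
    where
    open ℚᵘ.≃-Reasoning

  ratio-error : ∀ W d p q B .{{_ : NonZero q}} → ℕ.∣ 6 ℕ.* W - suc (2 ℕ.* d) ℕ.* (p ℕ.* q) ∣ ℕ.≤ 6 ℕ.* q ℕ.* B →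
                ∣ (+ W ℚ./ q) - mainTerm p d ∣ ≤ fromℕ B
  ratio-error W d p q B bound = ℚ.*-cancelˡ-≤-pos k {{ℚ.positive 0<k}} (ℚR.begin
    k * ∣ w - mainTerm p d ∣ ℚR.≡⟨ cong (_* ∣ w - mainTerm p d ∣) (ℚ.0≤p⇒∣p∣≡p (ℚ.<⇒≤ 0<k)) ⟨
    ∣ k ∣ * ∣ w - mainTerm p d ∣ ℚR.≡⟨ ℚ.∣p*q∣≡∣p∣*∣q∣ k (w - mainTerm p d) ⟨
    ∣ k * (w - mainTerm p d) ∣ ℚR.≡⟨ cong ∣_∣ scaled ⟩
    ∣ fromℕ (6 ℕ.* W) - fromℕ (suc (2 ℕ.* d) ℕ.* (p ℕ.* q)) ∣ ℚR.≡⟨ fromℕ-∣-∣ (6 ℕ.* W) _ ⟩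
    fromℕ ℕ.∣ 6 ℕ.* W - suc (2 ℕ.* d) ℕ.* (p ℕ.* q) ∣ ℚR.≤⟨ fromℕ-mono bound ⟩
    fromℕ (6 ℕ.* q ℕ.* B) ℚR.≡⟨ fromℕ-* (6 ℕ.* q) B ⟩
    k * fromℕ B ℚR.∎)
    where
    k w c : ℚ
    k = fromℕ (6 ℕ.* q)
    w = + W ℚ./ q
    c = + (2 ℕ.* d ℕ.+ 1) ℚ./ 6
    0<k : 0ℚ < k
    0<k = ℚ.<-≤-trans (ℚ.positive⁻¹ 1ℚ) (fromℕ-mono {1} (ℕ.>-nonZero⁻¹ (6 ℕ.* q) {{ℕ.m*n≢0 6 q}}))
    scaled : k * (w - c * fromℕ p) ≡ fromℕ (6 ℕ.* W) - fromℕ (suc (2 ℕ.* d) ℕ.* (p ℕ.* q))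
    scaled = trans (cong (_* (w - c * fromℕ p)) (fromℕ-* 6 q)) (trans
      (solve 5 (λ s q w c p → s :* q :* (w :- c :* p) := s :* (w :* q) :- (c :* s) :* (p :* q)) refl (fromℕ 6) (fromℕ q) w c (fromℕ p))
      (cong₂ _-_
        (trans (cong (fromℕ 6 *_) (/-* W q)) (sym (fromℕ-* 6 W)))
        (trans (cong₂ _*_ (trans (/-* (2 ℕ.* d ℕ.+ 1) 6) (cong fromℕ (ℕ.+-comm (2 ℕ.* d) 1))) (sym (fromℕ-* p q)))
          (sym (fromℕ-* (suc (2 ℕ.* d)) (p ℕ.* q))))))

  -- The extra 1 absorbs the summand d p of the error, since p ≤ p j.
  C₁ : ℕ
  C₁ = suc C₀

  module _ {d p : ℕ} .{{_ : NonZero d}} (d-odd : Odd d) (p-prime : Prime p) (2d∣p∸1 : 2 ℕ.* d ∣ p ℕ.∸ 1) where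

    open Subgroup p p-prime (2d∣p∸1⇒2<p p-prime 2d∣p∸1) d d-odd using (j; 1≤j)

    private
      instance
        γ≢0 : NonZero (γ d)
        γ≢0 = γ-nonZero d

      root : ℝ
      root = p ^[ γ d ℕ.∸ 1 / γ d ]

      logp : ℝ
      logp = log (fromℚ (fromℕ p))

    𝒜-error : (X : DirichletCharacter p) (ord : HasOrder X ((p ℕ.∸ 1) / d)) →
              ∣ 𝒜 p-prime X ord - mainTerm p d ∣ ≤ fromℕ (C₁ ℕ.* (d ℕ.* j))
    𝒜-error X ord = ratio-error (sum (map (agreements X ord) [1⋯ p ℕ.∸ 1 ])) d p (p ℕ.∸ 1) (C₁ ℕ.* (d ℕ.* j)) {{ℕ.>-nonZero 0<p∸1}}
      (ℕ.≤-trans (sum-agreements-error d-odd p-prime 2d∣p∸1 X ord) (estimate C₀))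
      where
      0<p∸1 : 0 ℕ.< p ℕ.∸ 1
      0<p∸1 = ℕ.m<n⇒0<n∸m (ℕ.<-trans (ℕ.s<s ℕ.z<s) (2d∣p∸1⇒2<p p-prime 2d∣p∸1))
      lemma : ∀ C d p j → d ℕ.* (C ℕ.* (p ℕ.* j) ℕ.+ p ℕ.* j) ≡ p ℕ.* (suc C ℕ.* (d ℕ.* j))
      lemma = ℕ.solve-∀
      p≤6[p∸1] : p ℕ.≤ 6 ℕ.* (p ℕ.∸ 1)
      p≤6[p∸1] = subst (ℕ._≤ 6 ℕ.* (p ℕ.∸ 1)) (ℕ.suc-pred p {{prime⇒nonZero p-prime}})
        (ℕ.+-mono-≤ 0<p∸1 (ℕ.m≤m+n (p ℕ.∸ 1) _))
      estimate : ∀ C → d ℕ.* (C ℕ.* (p ℕ.* j) ℕ.+ p) ℕ.≤ 6 ℕ.* (p ℕ.∸ 1) ℕ.* (suc C ℕ.* (d ℕ.* j))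
      estimate C = begin
        d ℕ.* (C ℕ.* (p ℕ.* j) ℕ.+ p) ≤⟨ ℕ.*-monoʳ-≤ d (ℕ.+-monoʳ-≤ (C ℕ.* (p ℕ.* j)) (ℕ.m≤m*n p j {{ℕ.>-nonZero 1≤j}})) ⟩
        d ℕ.* (C ℕ.* (p ℕ.* j) ℕ.+ p ℕ.* j) ≡⟨ lemma C d p j ⟩
        p ℕ.* (suc C ℕ.* (d ℕ.* j)) ≤⟨ ℕ.*-monoˡ-≤ (suc C ℕ.* (d ℕ.* j)) p≤6[p∸1] ⟩
        6 ℕ.* (p ℕ.∸ 1) ℕ.* (suc C ℕ.* (d ℕ.* j)) ∎
        where open ℕ.≤-Reasoning

    -- The n = 0 term of p ^ ((γ d - 1) / γ d) is its integer part, and the sequence is nondecreasing.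
    j≤root : ∀ n → fromℕ j ≤ seq root n
    j≤root n = ℚ.≤-trans (ℚ.≤-reflexive x₀≡) (subst (λ k → Root.x (γ d) N 0 ≤ Root.x (γ d) N k) (ℕ.+-identityʳ n) (Root.x-lower (γ d) N 0 n))
      where
      N : ℕ
      N = p ℕ.^ (γ d ℕ.∸ 1)
      x₀≡ : fromℕ j ≡ Root.x (γ d) N 0
      x₀≡ = sym (trans (ℚ.*-identityʳ _) (cong (λ t → fromℕ (⌊root⌋ (γ d) t))
        (trans (cong (N ℕ.*_) (ℕ.^-zeroˡ (γ d))) (ℕ.*-identityʳ N))))

    ½≤log : ∀ n → ½ ≤ seq logp n
    ½≤log n = log-lower (fromℚ (fromℕ p)) n 1 (fromℕ-mono {2} (ℕ.<⇒≤ (2d∣p∸1⇒2<p p-prime 2d∣p∸1)))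

    -- Since log p ≥ ½, the factor 4 (log p)² is at least 1, and j is at most every term
    -- approximating the root.
    error≤ : ∀ n → fromℕ (C₁ ℕ.* (d ℕ.* j)) ≤
             fromℕ (4 ℕ.* C₁) * fromℕ d * (seq logp n * seq logp n)
               * seq root n
    error≤ n = ℚR.begin
      fromℕ (C₁ ℕ.* (d ℕ.* j))
        ℚR.≡⟨ trans (fromℕ-* C₁ (d ℕ.* j)) (cong (fromℕ C₁ *_) (fromℕ-* d j)) ⟩
      fromℕ C₁ * (fromℕ d * fromℕ j)
        ℚR.≡⟨ solve 3 (λ c d j → c :* (d :* j) := con (fromℕ 4) :* c :* d :* (con ½ :* con ½) :* j) refl (fromℕ C₁) (fromℕ d) (fromℕ j) ⟩
      fromℕ 4 * fromℕ C₁ * fromℕ d * (½ * ½) * fromℕ j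
        ℚR.≡⟨ cong (λ t → t * fromℕ d * (½ * ½) * fromℕ j) (fromℕ-* 4 C₁) ⟨
      A * (½ * ½) * fromℕ j
        ℚR.≤⟨ *-mono (0≤* 0≤A (0≤* 0≤½ 0≤½)) (ℚ.≤-trans (0≤fromℕ j) (j≤root n))
               (ℚ.*-monoˡ-≤-nonNeg A {{ℚ.nonNegative 0≤A}} (*-mono 0≤½ (ℚ.≤-trans 0≤½ (½≤log n)) (½≤log n) (½≤log n))) (j≤root n) ⟩
      A * (l * l) * seq root n ℚR.∎
      where
      A l : ℚ
      A = fromℕ (4 ℕ.* C₁) * fromℕ d
      l = seq logp n
      0≤A : 0ℚ ≤ A
      0≤A = 0≤* (0≤fromℕ (4 ℕ.* C₁)) (0≤fromℕ d)

    γ≤d : γ d ℕ.≤ d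
    γ≤d with ℕ.m≤n⇒m<n∨m≡n (ℕ.>-nonZero⁻¹ d)
    ... | inj₁ 1<d  = ℕ.≤-trans (γ≤d∸1 d 1<d) (ℕ.m∸n≤m d 1)
    ... | inj₂ refl = ℕ.≤-refl

    -- By γ(d) ≤ d one has p^(1/γ(d)) ≥ p^(1/d) ≥ 2^T, so j ≤ p^(1 - 1/γ(d)) is at most p / 2^T.
    -- Stated through γ(d)-th powers.
    2^T*j≤p : ∀ T → 2 ℕ.^ (T ℕ.* d) ℕ.≤ p → 2 ℕ.^ T ℕ.* j ℕ.≤ p
    2^T*j≤p T 2^Td≤p = ℕ.≮⇒≥ λ p< → ℕ.<⇒≱ (ℕ.^-monoˡ-< (γ d) p<) (begin
      (2 ℕ.^ T ℕ.* j) ℕ.^ γ d ≡⟨ ^-distribʳ-* (γ d) (2 ℕ.^ T) j ⟩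
      (2 ℕ.^ T) ℕ.^ γ d ℕ.* j ℕ.^ γ d ≡⟨ cong (ℕ._* j ℕ.^ γ d) (ℕ.^-*-assoc 2 T (γ d)) ⟩
      2 ℕ.^ (T ℕ.* γ d) ℕ.* j ℕ.^ γ d ≤⟨ ℕ.*-mono-≤ (ℕ.≤-trans (ℕ.^-monoʳ-≤ 2 (ℕ.*-monoʳ-≤ T γ≤d)) 2^Td≤p)
                                                          (⌊root⌋-lower (γ d) (p ℕ.^ (γ d ℕ.∸ 1))) ⟩
      p ℕ.* p ℕ.^ (γ d ℕ.∸ 1) ≡⟨ cong (p ℕ.^_) (ℕ.suc-pred (γ d)) ⟩
      p ℕ.^ γ d ∎)
      where
      open ℕ.≤-Reasoning

    -- The main term is at least d p / 3 and the error at most C₁ d p / M, so M ≥ 3 C₁ / ε suffices.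
    small-error : ∀ ε M T → 0ℚ < ε → fromℕ 3 * fromℕ C₁ ≤ fromℕ M * ε → M ℕ.≤ 2 ℕ.^ T → 2 ℕ.^ (T ℕ.* d) ℕ.≤ p →
                  fromℕ (C₁ ℕ.* (d ℕ.* j)) ≤ ε * mainTerm p d
    small-error ε M T 0<ε 3C₁≤Mε M≤2^T 2^Td≤p = ℚ.*-cancelˡ-≤-pos (fromℕ 3) (ℚR.begin
      fromℕ 3 * fromℕ (C₁ ℕ.* (d ℕ.* j))
        ℚR.≡⟨ cong (fromℕ 3 *_) (trans (fromℕ-* C₁ (d ℕ.* j)) (cong (fromℕ C₁ *_) (fromℕ-* d j))) ⟩
      fromℕ 3 * (fromℕ C₁ * (fromℕ d * fromℕ j))
        ℚR.≡⟨ solve 4 (λ t c d j → t :* (c :* (d :* j)) := t :* c :* (d :* j)) refl (fromℕ 3) (fromℕ C₁) (fromℕ d) (fromℕ j) ⟩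
      fromℕ 3 * fromℕ C₁ * (fromℕ d * fromℕ j)
        ℚR.≤⟨ ℚ.*-monoʳ-≤-nonNeg (fromℕ d * fromℕ j) {{ℚ.nonNegative (0≤* (0≤fromℕ d) (0≤fromℕ j))}} 3C₁≤Mε ⟩
      fromℕ M * ε * (fromℕ d * fromℕ j)
        ℚR.≡⟨ solve 4 (λ m e d j → m :* e :* (d :* j) := e :* (d :* (m :* j))) refl (fromℕ M) ε (fromℕ d) (fromℕ j) ⟩
      ε * (fromℕ d * (fromℕ M * fromℕ j))
        ℚR.≤⟨ ℚ.*-monoˡ-≤-nonNeg ε {{ε≥0}} (ℚ.*-monoˡ-≤-nonNeg (fromℕ d) {{ℚ.nonNegative (0≤fromℕ d)}}
               (ℚ.≤-trans (ℚ.≤-reflexive (sym (fromℕ-* M j))) (fromℕ-mono (ℕ.≤-trans (ℕ.*-monoˡ-≤ j M≤2^T) (2^T*j≤p T 2^Td≤p))))) ⟩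
      ε * (fromℕ d * fromℕ p)
        ℚR.≤⟨ ℚ.*-monoˡ-≤-nonNeg ε {{ε≥0}} (ℚ.*-monoʳ-≤-nonNeg (fromℕ p) {{ℚ.nonNegative (0≤fromℕ p)}} d≤3c) ⟩
      ε * (fromℕ 3 * c * fromℕ p)
        ℚR.≡⟨ solve 4 (λ e t c p → e :* (t :* c :* p) := t :* (e :* (c :* p))) refl ε (fromℕ 3) c (fromℕ p) ⟩
      fromℕ 3 * (ε * (c * fromℕ p)) ℚR.∎)
      where
      c : ℚ
      c = + (2 ℕ.* d ℕ.+ 1) ℚ./ 6
      ε≥0 : ℚ.NonNegative ε
      ε≥0 = ℚ.nonNegative (ℚ.<⇒≤ 0<ε)
      d≤3c : fromℕ d ≤ fromℕ 3 * c
      d≤3c = ℚ.*-cancelˡ-≤-pos (fromℕ 2) (ℚR.begin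
        fromℕ 2 * fromℕ d ℚR.≡⟨ fromℕ-* 2 d ⟨
        fromℕ (2 ℕ.* d) ℚR.≤⟨ fromℕ-mono (ℕ.m≤m+n (2 ℕ.* d) 1) ⟩
        fromℕ (2 ℕ.* d ℕ.+ 1) ℚR.≡⟨ /-* (2 ℕ.* d ℕ.+ 1) 6 ⟨
        c * fromℕ 6 ℚR.≡⟨ solve 1 (λ c → c :* con (fromℕ 6) := con (fromℕ 2) :* (con (fromℕ 3) :* c)) refl c ⟩
        fromℕ 2 * (fromℕ 3 * c) ℚR.∎)

  -- With s = T d, p < 2ˢ would give s ≤ d log log p ≤ ½ log p + 1 ≤ ½ (s + 1) + 1, hence s ≤ 3.
  loglog-bound : ∀ (c : ℝ) → c <ᴿ fromℚ ½ → ∀ d p T .{{_ : NonZero d}} → 4 ℕ.≤ T → 2 ℕ.^ (2 ℕ.* 2 ℕ.^ (2 ℕ.* T)) ℕ.≤ p →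
                 fromℚ (fromℕ d) *ᴿ log (log (fromℚ (fromℕ p))) ≤ᴿ c *ᴿ log (fromℚ (fromℕ p)) → 2 ℕ.^ (T ℕ.* d) ℕ.≤ p
  loglog-bound c (δ , 0<δ , Nc , c+δ≤½) d p T 4≤T P≤p hyp with hyp 1ℚ (ℚ.positive⁻¹ 1ℚ)
  ... | Nh , dLL≤cL = ℕ.≮⇒≥ λ p<2^s → ℕ.<⇒≱ (ℕ.n<1+n 3) (ℕ.≤-trans (ℕ.≤-trans 4≤T (ℕ.m≤m*n T d)) (s≤3 p<2^s))
    where
    s n : ℕ
    s = T ℕ.* d
    -- A single index for all comparisons: past s for `log-upper`, past Nc for c ≤ ½, past Nh for
    -- the hypothesis with slack 1.
    n = s ℕ.⊔ (Nc ℕ.⊔ Nh)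
    L LL cₙ : ℚ
    L  = seq (log (fromℚ (fromℕ p))) n
    LL = seq (log (log (fromℚ (fromℕ p)))) n
    cₙ = seq c n
    cₙ≤½ : cₙ ≤ ½
    cₙ≤½ = ℚ.≤-trans (≤+ (ℚ.<⇒≤ 0<δ)) (c+δ≤½ n (≤⊔ˡ {Nc} (≤⊔ʳ {s} {Nc ℕ.⊔ Nh} ℕ.≤-refl)))
    ½*2* : ∀ k → ½ * fromℕ (2 ℕ.* k) ≡ fromℕ k
    ½*2* k = trans (cong (½ *_) (fromℕ-* 2 k)) (solve 1 (λ x → con ½ :* (con (fromℕ 2) :* x) := x) refl (fromℕ k))
    -- Each logarithm turns a lower bound 2^k into k / 2, so the threshold 2^(2 · 2^(2T)) gives log
    -- p ≥ 2^(2T) and then log log p ≥ T.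
    T≤LL : fromℕ T ≤ LL
    T≤LL = subst (_≤ LL) (½*2* T) (log-lower (log (fromℚ (fromℕ p))) n (2 ℕ.* T)
      (subst (_≤ L) (½*2* (2 ℕ.^ (2 ℕ.* T))) (log-lower (fromℚ (fromℕ p)) n (2 ℕ.* 2 ℕ.^ (2 ℕ.* T)) (fromℕ-mono P≤p))))
    0≤L : 0ℚ ≤ L
    0≤L = 0≤log (fromℚ (fromℕ p)) n
    s≤3 : p ℕ.< 2 ℕ.^ s → s ℕ.≤ 3
    s≤3 p<2^s = ℕ.≮⇒≥ λ 3<s → ℚ.≤⇒≤ᵇ {fromℕ 4} {fromℕ 3} (ℚ.≤-trans (fromℕ-mono 3<s) fromℕs≤3)
      where
      L≤ : L ≤ fromℕ s + 1ℚ
      L≤ = log-upper (fromℚ (fromℕ p)) n s (ℕ.m≤m⊔n s (Nc ℕ.⊔ Nh)) (fromℕ-mono (ℕ.<⇒≤ p<2^s))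
      s≤½s : fromℕ s ≤ ½ * (fromℕ s + 1ℚ) + 1ℚ
      s≤½s = ℚR.begin
        fromℕ (T ℕ.* d) ℚR.≡⟨ trans (cong fromℕ (ℕ.*-comm T d)) (fromℕ-* d T) ⟩
        fromℕ d * fromℕ T ℚR.≤⟨ ℚ.*-monoˡ-≤-nonNeg (fromℕ d) {{ℚ.nonNegative (0≤fromℕ d)}} T≤LL ⟩
        fromℕ d * LL ℚR.≤⟨ dLL≤cL n (≤⊔ʳ {Nc} (≤⊔ʳ {s} {Nc ℕ.⊔ Nh} ℕ.≤-refl)) ⟩
        cₙ * L + 1ℚ ℚR.≤⟨ ℚ.+-monoˡ-≤ 1ℚ (ℚ.≤-trans (ℚ.*-monoʳ-≤-nonNeg L {{ℚ.nonNegative 0≤L}} cₙ≤½) (ℚ.*-monoˡ-≤-nonNeg ½ L≤)) ⟩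
        ½ * (fromℕ s + 1ℚ) + 1ℚ ℚR.∎
      fromℕs≤3 : fromℕ s ≤ fromℕ 3
      fromℕs≤3 = by-difference (2ℚ * (½ * (fromℕ s + 1ℚ) + 1ℚ - fromℕ s)) (0≤* (ℚ.nonNegative⁻¹ 2ℚ) (0≤- s≤½s))
        (solve 1 (λ s → con (fromℕ 3) :- s := con 2ℚ :* (con ½ :* (s :+ con 1ℚ) :+ con 1ℚ :- s)) refl (fromℕ s))

  level : ∀ {ε} → 0ℚ < ε → ∃[ M ] fromℕ 3 * fromℕ C₁ ≤ fromℕ M * ε
  level {ε} 0<ε = proj₁ bound , subst₂ _≤_ (proj₂ (proj₂ threshold)) (ℚ.*-comm ε (fromℕ (proj₁ bound)))
    (ℚ.*-monoˡ-≤-nonNeg ε {{ℚ.nonNegative (ℚ.<⇒≤ 0<ε)}} (proj₂ bound))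
    where
    threshold : ∃[ q ] 0ℚ < q × ε * q ≡ fromℕ 3 * fromℕ C₁
    threshold = split {fromℕ 3 * fromℕ C₁} {ε}
      (0<* (ℚ.positive⁻¹ (fromℕ 3)) (ℚ.<-≤-trans (ℚ.positive⁻¹ 1ℚ) (fromℕ-mono {1} {C₁} (ℕ.s≤s ℕ.z≤n)))) 0<ε
    bound : ∃[ M ] proj₁ threshold ≤ fromℕ M
    bound = archimedean (proj₁ threshold)

-- Explicit constants and thresholds for the two estimates.

open import Defs
open import Data.Nat.Base as ℕ using (ℕ; NonZero)
open import Data.Nat.DivMod using (_/_)
open import Data.Nat.Divisibility using (_∣_)
open import Data.Nat.Primality using (Prime)
import Data.Nat.Properties as ℕ
open import Data.Product.Base using (∃-syntax; _×_; _,_)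
open import Data.Rational.Base as ℚ using (ℚ; 0ℚ; ½)
import Data.Rational.Properties as ℚ
open import Relation.Binary.PropositionalEquality using (_≡_)
open import Relation.Nullary using (¬_)
open Totients using (γ≤d∸1; γ-prime)
open PrimitivePartSize using (n≤2^n)
open LogBounds using (≤+)
open ErrorBounds using (C₁; 𝒜-error; error≤; level; small-error; loglog-bound)

theorem4p2 : (∀ d → ¬ 2 ∣ d → 1 ℕ.< d → γ d ℕ.≤ d ℕ.∸ 1)
    × (∀ d → ¬ 2 ∣ d → Prime d → γ d ≡ d ℕ.∸ 1)
    × (∃[ C ] ∀ (d p : ℕ) .{{_ : NonZero d}} → ¬ 2 ∣ d →
    (p-prime : Prime p) → 2 ℕ.* d ∣ p ℕ.∸ 1 →
    (X : DirichletCharacter p) (ord : HasOrder X ((p ℕ.∸ 1) / d)) → IsOddCharacter X →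
    fromℚ ℚ.∣ 𝒜 p-prime X ord ℚ.- mainTerm p d ∣
    ≤ᴿ fromℚ (C ℚ.* fromℕ d)
    *ᴿ (log (fromℚ (fromℕ p)) *ᴿ log (fromℚ (fromℕ p)))
    *ᴿ (p ^[ γ d ℕ.∸ 1 / γ d ]) {{γ-nonZero d}})
    × (∀ (c : ℝ) → c <ᴿ fromℚ ½ → ∀ (ε : ℚ) → 0ℚ ℚ.< ε →
    ∃[ P ] ∀ (d p : ℕ) .{{_ : NonZero d}} → P ℕ.≤ p → ¬ 2 ∣ d →
    (p-prime : Prime p) → 2 ℕ.* d ∣ p ℕ.∸ 1 →
    (X : DirichletCharacter p) (ord : HasOrder X ((p ℕ.∸ 1) / d)) → IsOddCharacter X →
    fromℚ (fromℕ d) *ᴿ log (log (fromℚ (fromℕ p))) ≤ᴿ c *ᴿ log (fromℚ (fromℕ p)) →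
    ℚ.∣ 𝒜 p-prime X ord ℚ.- mainTerm p d ∣ ℚ.≤ ε ℚ.* mainTerm p d)
theorem4p2 = (λ d _ → γ≤d∸1 d) , (λ d _ → γ-prime d) ,
  -- The inequality holds for every term of the approximating sequences, so the index 0 serves for
  -- each slack ε.
  (fromℕ (4 ℕ.* C₁) , λ d p d-odd p-prime 2d∣ X ord _ ε 0<ε → 0 , λ n _ →
    ℚ.≤-trans (𝒜-error d-odd p-prime 2d∣ X ord) (ℚ.≤-trans (error≤ d-odd p-prime 2d∣ n) (≤+ (ℚ.<⇒≤ 0<ε)))) ,
  -- The summand M secures M ≤ 2^T for `small-error`, and the summand 4 secures T ≥ 4, which
  -- contradicts T d ≤ 3 in `loglog-bound`.
  λ c c<½ ε 0<ε → let (M , 3C₁≤Mε) = level 0<ε ; T = 4 ℕ.+ M in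
    2 ℕ.^ (2 ℕ.* 2 ℕ.^ (2 ℕ.* T)) , λ d p P≤p d-odd p-prime 2d∣ X ord _ hyp →
      ℚ.≤-trans (𝒜-error d-odd p-prime 2d∣ X ord)
        (small-error d-odd p-prime 2d∣ ε M T 0<ε 3C₁≤Mε (ℕ.≤-trans (n≤2^n M) (ℕ.^-monoʳ-≤ 2 (ℕ.m≤n+m M 4)))
          (loglog-bound c c<½ d p T (ℕ.m≤m+n 4 M) P≤p hyp))
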